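{- There is an algorithm that, given an instance of $n\ge 2$ keys with pairwise distinct weights, all lying in the interval $[1,R]$ (where $R\ge1$ may depend arbitrarily on $n$), computes the cost of an optimal 2WCST for the instance in time $O(n^3\log(nR))$.
   Context: An instance consists of a linearly ordered set of $n$ keys, given in sorted order, each key $k$ having a weight $w_k$. A two-way comparison search tree (2WCST) is a rooted binary decision tree whose leaves are in bijection with the keys and in which each internal node is labelled either with an equal-to test $\langle =k\rangle$ ("is $q=k$?") or a less-than test $\langle <k\rangle$ ("is $q<k$?") for a key $k$, and has two children, one for "yes" and one for "no". It is required that for each key $q$, the search for $q$ starting at the root ends in the leaf labelled $q$. Its cost is $\sum_k w_k\cdot\mathrm{depth}(k)$, where $\mathrm{depth}(k)$ is the number of comparison nodes on the path from the root to leaf $k$; an optimal 2WCST is one of minimum cost. Time is measured in the unit-cost model (arithmetic operations and comparisons on weights take constant time), and the constant in the $O$-notation is absolute. -}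

module Defs where

open import Algebra.Bundles using (CommutativeRing)
import Algebra.Definitions.RawMonoid as RawMonoid
open import Data.Bool.Base using (Bool; true; false; if_then_else_; _∧_)
open import Data.Fin.Base as Fin using (Fin; fromℕ<)
import Data.Fin.Properties as Fin
open import Data.List.Base using (List; []; _∷_; [_]; _++_; allFin)
import Data.List.Properties as List
open import Data.List.Relation.Binary.Permutation.Propositional using (_↭_)
open import Data.Nat.Base as ℕ using (ℕ; zero; suc)
import Data.Nat.Properties as ℕ
open import Data.Product.Base using (∃-syntax; _×_)
open import Function.Definitions using (Injective)
open import Level as Level using (0ℓ)
open import Relation.Binary.Core using (Rel)
open import Relation.Binary.Structures using (IsDecTotalOrder)
open import Relation.Binary.PropositionalEquality using (_≡_)
open import Relation.Nullary using (¬_; does; yes; no)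

-- Weights are drawn from an arbitrary linearly ordered commutative ring with
-- decidable order.  The real numbers of the unit-cost model, with their exact
-- comparisons, are one such ring; ℤ and ℚ are others.

record OrderedRing : Set (Level.suc 0ℓ) where
  infix 4 _≤_
  field
    commutativeRing : CommutativeRing 0ℓ 0ℓ
  open CommutativeRing commutativeRing public
  field
    _≤_             : Rel Carrier 0ℓ
    isDecTotalOrder : IsDecTotalOrder _≈_ _≤_
    +-monoˡ-≤       : ∀ z {x y} → x ≤ y → x + z ≤ y + z
    *-nonNegative   : ∀ {x y} → 0# ≤ x → 0# ≤ y → 0# ≤ x * y
    1#≉0#           : ¬ (1# ≈ 0#)
  open IsDecTotalOrder isDecTotalOrder public
    using (_≤?_; _≟_; antisym; total)
    renaming (refl to ≤-refl; trans to ≤-trans; reflexive to ≤-reflexive)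
  open RawMonoid +-rawMonoid public using (sum) renaming (_×_ to _·_)

  -- For x ≥ 2 the least such L is at most 2 log₂ x, so a bound of the form
  -- c · L for every such L is the same as a bound O(log x).
  ⌈log₂_⌉≤_ : Carrier → ℕ → Set
  ⌈log₂ x ⌉≤ L = x ≤ (2 ℕ.^ L) · 1#

------------------------------------------------------------------------
-- Search trees.  The sorted keys are identified with their ranks in Fin n.

data Test (n : ℕ) : Set where
  ⟨=_⟩ ⟨<_⟩ : Fin n → Test n

answer : ∀ {n} → Test n → Fin n → Bool
answer ⟨= k ⟩ q = does (q Fin.≟ k)
answer ⟨< k ⟩ q = does (q Fin.<? k)

data Tree (n : ℕ) : Set where
  leaf : Fin n → Tree n
  node : Test n → (yes no : Tree n) → Tree n

leaves : ∀ {n} → Tree n → List (Fin n)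
leaves (leaf k)     = k ∷ []
leaves (node _ y z) = leaves y ++ leaves z

search : ∀ {n} → Tree n → Fin n → Fin n
search (leaf k)     q = k
search (node τ y z) q = if answer τ q then search y q else search z q

record Is2WCST {n} (t : Tree n) : Set where
  field
    bijective : leaves t ↭ allFin n
    correct   : ∀ q → search t q ≡ q

-- The number of comparisons on the search path of q.  In a 2WCST this path
-- leads from the root to the only leaf labelled q.
depth : ∀ {n} → Tree n → Fin n → ℕ
depth (leaf _)     q = 0
depth (node τ y z) q = suc (if answer τ q then depth y q else depth z q)

------------------------------------------------------------------------
-- Programs of a unit-cost random access machine.  Its memory consists of
-- arrays of natural numbers and of arrays of weights, whose cells are
-- addressed by finite lists of naturals; a scalar variable is the cell at [].
-- A program does not depend on n, on the weights or on the ring.  Naturals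
-- cannot be multiplied, which rules out packing data into huge integers.
-- There is no conversion from weights to naturals.

data Sort : Set where
  nat weight : Sort

Name : Set
Name = ℕ

infix  9 _⟦_⟧
infixl 7 _⊗_
infixl 6 _⊕_ _⊖_
infix  4 _≔_ _≼_
infixr 3 _⨾_

data Exp : Sort → Set where
  lit     : ∀ {s} → ℕ → Exp s
  _⟦_⟧    : ∀ {s} → Name → List (Exp nat) → Exp s
  _⊕_ _⊖_ : ∀ {s} → Exp s → Exp s → Exp s
  _⊗_     : Exp weight → Exp weight → Exp weight

data Cond : Set where
  _≼_ : ∀ {s} → Exp s → Exp s → Cond

record LValue (s : Sort) : Set where
  constructor _⟦_⟧
  field
    array   : Name
    indices : List (Exp nat)

data Cmd : Set where
  skip          : Cmd
  _≔_           : ∀ {s} → LValue s → Exp s → Cmd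
  _⨾_           : Cmd → Cmd → Cmd
  If_Then_Else_ : Cond → Cmd → Cmd → Cmd
  While_Do_     : Cond → Cmd → Cmd

-- One time unit for every operator, literal and memory access.
mutual
  timeᵉ : ∀ {s} → Exp s → ℕ
  timeᵉ (lit _)    = 1
  timeᵉ (_ ⟦ is ⟧) = 1 ℕ.+ timeˢ is
  timeᵉ (d ⊕ e)    = 1 ℕ.+ timeᵉ d ℕ.+ timeᵉ e
  timeᵉ (d ⊖ e)    = 1 ℕ.+ timeᵉ d ℕ.+ timeᵉ e
  timeᵉ (d ⊗ e)    = 1 ℕ.+ timeᵉ d ℕ.+ timeᵉ e

  timeˢ : List (Exp nat) → ℕ
  timeˢ []       = 0
  timeˢ (e ∷ es) = timeᵉ e ℕ.+ timeˢ es

timeᶜ : Cond → ℕ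
timeᶜ (d ≼ e) = 1 ℕ.+ timeᵉ d ℕ.+ timeᵉ e

module Semantics (K : OrderedRing) where
  open OrderedRing K

  Val : Sort → Set
  Val nat    = ℕ
  Val weight = Carrier

  Memory : Set → Set
  Memory A = Name → List ℕ → A

  record Store : Set where
    constructor store
    field
      nats    : Memory ℕ
      weights : Memory Carrier
  open Store public

  update : ∀ {A} → Name → List ℕ → A → Memory A → Memory A
  update x is v m y js =
    if does (x ℕ.≟ y) ∧ does (List.≡-dec ℕ._≟_ is js) then v else m y js

  read : ∀ s → Store → Memory (Val s)
  read nat    = nats
  read weight = weights

  write : ∀ s → Name → List ℕ → Val s → Store → Store
  write nat    x is v σ = store (update x is v (nats σ)) (weights σ)
  write weight x is v σ = store (nats σ) (update x is v (weights σ))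

  -- Subtraction of naturals is truncated; the literal k denotes k · 1# as a
  -- weight.
  literal : ∀ s → ℕ → Val s
  literal nat    k = k
  literal weight k = k · 1#

  plus minus : ∀ s → Val s → Val s → Val s
  plus  nat    = ℕ._+_
  plus  weight = _+_
  minus nat    = ℕ._∸_
  minus weight = _-_

  leq : ∀ s → Val s → Val s → Bool
  leq nat    a b = does (a ℕ.≤? b)
  leq weight a b = does (a ≤? b)

  mutual
    evalᵉ : ∀ {s} → Store → Exp s → Val s
    evalᵉ {s} σ (lit k)    = literal s k
    evalᵉ {s} σ (x ⟦ is ⟧) = read s σ x (evalˢ σ is)
    evalᵉ {s} σ (d ⊕ e)    = plus  s (evalᵉ σ d) (evalᵉ σ e)
    evalᵉ {s} σ (d ⊖ e)    = minus s (evalᵉ σ d) (evalᵉ σ e)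
    evalᵉ     σ (d ⊗ e)    = evalᵉ σ d * evalᵉ σ e

    evalˢ : Store → List (Exp nat) → List ℕ
    evalˢ σ []       = []
    evalˢ σ (e ∷ es) = evalᵉ σ e ∷ evalˢ σ es

  evalᶜ : Store → Cond → Bool
  evalᶜ σ (_≼_ {s} d e) = leq s (evalᵉ σ d) (evalᵉ σ e)

  -- ⟨ c , σ ⟩⇓⟨ σ′ , t ⟩: started in σ, the command c halts in σ′ after
  -- exactly t time units.
  infix 2 ⟨_,_⟩⇓⟨_,_⟩

  data ⟨_,_⟩⇓⟨_,_⟩ : Cmd → Store → Store → ℕ → Set where
    ⇓skip : ∀ {σ} → ⟨ skip , σ ⟩⇓⟨ σ , 1 ⟩

    ⇓assign : ∀ {s x is} {e : Exp s} {σ} →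
      ⟨ x ⟦ is ⟧ ≔ e , σ ⟩⇓⟨ write s x (evalˢ σ is) (evalᵉ σ e) σ
                           , 1 ℕ.+ timeˢ is ℕ.+ timeᵉ e ⟩

    ⇓seq : ∀ {c d σ σ₁ σ₂ t u} →
      ⟨ c , σ ⟩⇓⟨ σ₁ , t ⟩ → ⟨ d , σ₁ ⟩⇓⟨ σ₂ , u ⟩ →
      ⟨ c ⨾ d , σ ⟩⇓⟨ σ₂ , t ℕ.+ u ⟩

    ⇓then : ∀ {b c d σ σ₁ t} → evalᶜ σ b ≡ true →
      ⟨ c , σ ⟩⇓⟨ σ₁ , t ⟩ →
      ⟨ If b Then c Else d , σ ⟩⇓⟨ σ₁ , timeᶜ b ℕ.+ t ⟩

    ⇓else : ∀ {b c d σ σ₁ t} → evalᶜ σ b ≡ false →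
      ⟨ d , σ ⟩⇓⟨ σ₁ , t ⟩ →
      ⟨ If b Then c Else d , σ ⟩⇓⟨ σ₁ , timeᶜ b ℕ.+ t ⟩

    ⇓stop : ∀ {b c σ} → evalᶜ σ b ≡ false →
      ⟨ While b Do c , σ ⟩⇓⟨ σ , timeᶜ b ⟩

    ⇓loop : ∀ {b c σ σ₁ σ₂ t u} → evalᶜ σ b ≡ true →
      ⟨ c , σ ⟩⇓⟨ σ₁ , t ⟩ → ⟨ While b Do c , σ₁ ⟩⇓⟨ σ₂ , u ⟩ →
      ⟨ While b Do c , σ ⟩⇓⟨ σ₂ , timeᶜ b ℕ.+ t ℕ.+ u ⟩

  -- Input: the variable 0 of sort nat holds n, and cell i of the weight array
  -- 0 holds the weight of key i.  All other memory is zero.  Output: the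
  -- weight variable 0.
  initial : ∀ {n} → (Fin n → Carrier) → Store
  initial {n} w = store (update 0 [] n (λ _ _ → 0)) input
    where
    input : Memory Carrier
    input zero (i ∷ []) with i ℕ.<? n
    ... | yes i<n = w (fromℕ< i<n)
    ... | no  _   = 0#
    input _ _ = 0#

  output : Store → Carrier
  output σ = weights σ 0 []

  Computes : Cmd → ∀ {n} → (Fin n → Carrier) → Carrier → ℕ → Set
  Computes P w v t = ∃[ σ ] (⟨ P , initial w ⟩⇓⟨ σ , t ⟩ × output σ ≈ v)

module Optimality (K : OrderedRing) where
  open OrderedRing K

  cost : ∀ {n} → (Fin n → Carrier) → Tree n → Carrier
  cost w t = sum (λ k → depth t k · w k)

  record IsOptimal {n} (w : Fin n → Carrier) (t : Tree n) : Set where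
    field
      valid   : Is2WCST t
      minimal : ∀ t′ → Is2WCST t′ → cost w t ≤ cost w t′

{-# OPTIONS --safe #-}

-- Below a node of an optimal tree lie the keys of an interval that have not been
-- removed by equal-to tests above it.  Rotating a test above its parent shows that
-- equal-to tests may be assumed to remove heaviest keys, so such a set is given by
-- an interval [i, j) and the number h of its heaviest keys that are missing.  If
-- the root of an optimal tree is an equal-to test for m, then the total weight W
-- is at most 12 w(m): otherwise the three topmost tests each split off little,
-- and asking a weighted median first would save each of them for almost half of
-- the weight.  Hence the largest weight halves within 24 equal-to tests, only
-- h = O(log (nR)) occurs, and a dynamic program with O(n² log (nR)) states and
-- O(n) tests per state finds the optimal cost.

module Submission where

open import Algebra.Bundles using (CommutativeMonoid)
import Algebra.Properties.CommutativeMonoid.Sum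
import Algebra.Properties.Monoid.Mult
import Algebra.Properties.Ring
import Algebra.Solver.CommutativeMonoid as MonoidSolver
open import Data.Bool.Base using (Bool; true; false; if_then_else_; _∧_; _∨_; not)
import Data.Bool.Properties as Bool
open import Data.Empty using (⊥; ⊥-elim)
open import Data.Fin.Base as Fin using (Fin; zero; suc; toℕ; fromℕ<)
import Data.Fin.Properties as Fin
open import Data.List.Base using (List; []; _∷_; _++_; allFin; map)
open import Data.List.Membership.Propositional using () renaming (_∈_ to _∈ₗ_)
open import Data.List.Membership.Propositional.Properties using (∈-++⁺ˡ; ∈-++⁺ʳ; ∈-++⁻; ∈-map⁺; ∈-allFin)
open import Data.List.Membership.Propositional.Properties.WithK using (unique∧set⇒bag)
import Data.List.Properties as List
open import Data.List.Relation.Binary.BagAndSetEquality using (∼bag⇒↭)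
open import Data.List.Relation.Unary.All as All using ()
open import Data.List.Relation.Unary.AllPairs as AllPairs using ()
open import Data.List.Relation.Unary.Any using (here; there)
open import Data.List.Relation.Unary.Unique.Propositional using (Unique)
import Data.List.Relation.Unary.Unique.Propositional.Properties as Unique
open import Data.Nat.Base as ℕ using (ℕ; zero; suc)
import Data.Nat.Properties as ℕ
open import Data.Product.Base using (∃; ∃-syntax; _×_; _,_; proj₁; proj₂)
open import Data.Sum.Base using (_⊎_; inj₁; inj₂; [_,_]′)
open import Defs
open import Function.Base using (_∘_; _$_; const; case_of_)
open import Function.Bundles using (mk⇔)
open import Function.Definitions using (Injective)
open import Relation.Binary.PropositionalEquality as ≡ using (_≡_; _≢_)
open import Relation.Nullary using (does; yes; no; ¬_; contradiction; Dec)
open import Relation.Nullary.Decidable using (dec-true; dec-false)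

-- Sums over sets of keys

-- Everything is phrased through the optimal cost `o` of an arbitrary set of keys, the minimum over
-- all trees that answer correctly on that set, even with repeated or useless leaves. Such trees
-- stay correct on subsets, so rotations and the median argument become linear inequalities between
-- values of `o`. That the minimum is attained by a tree whose leaves are exactly the keys is
-- settled once, when it is constructed. The ring has no division, so all halves are stated doubled.
--
-- The constant 12 is 2 + 4 + 6, the losses in three doubled savings. Doubled again it gives 24:
-- measure 2W in units of 2ˡ. Removing a key with 2w ≥ 2ˡ uses up a unit, and when the removed key
-- is lighter, at most 24 units remain at the next smaller scale.
--
-- The program cannot tell which states an optimal tree visits, so it cuts the table off at `H`
-- holes with a crude upper bound. Entries near this edge may be too large; the proof shows that no
-- optimal path from the full set depends on them. Nor need doubling ever reach the total weight, as
-- the ring may be non-Archimedean. Hence the search for `H` stops after n doublings, when the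
-- number of keys itself is a sufficient bound.

KeySet : ℕ → Set
KeySet n = Fin n → Bool

infix 4 _∈_ _≐_
_∈_ : ∀ {n} → Fin n → KeySet n → Set
k ∈ p = p k ≡ true

_≐_ : ∀ {n} → KeySet n → KeySet n → Set
p ≐ q = ∀ k → p k ≡ q k

infixr 6 _∩_ _∪_
infixl 6 _∖_
_∩_ _∪_ : ∀ {n} → KeySet n → KeySet n → KeySet n
(p ∩ q) k = p k ∧ q k
(p ∪ q) k = p k ∨ q k

∁ : ∀ {n} → KeySet n → KeySet n
∁ p k = not (p k)

only : ∀ {n} → Fin n → KeySet n
only a k = does (k Fin.≟ a)

_∖_ : ∀ {n} → KeySet n → Fin n → KeySet n
p ∖ a = p ∩ ∁ (only a)

only-self : ∀ {n} (a : Fin n) → a ∈ only a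
only-self a with a Fin.≟ a
... | yes _  = ≡.refl
... | no a≢a = contradiction ≡.refl a≢a

only⇒≡ : ∀ {n} {a k : Fin n} → k ∈ only a → k ≡ a
only⇒≡ {a = a} {k} k∈ with yes k≡a ← k Fin.≟ a = k≡a

module Sums {c ℓ} (M : CommutativeMonoid c ℓ) where
  open CommutativeMonoid M
    renaming (_∙_ to _+_; ε to 0#; ∙-cong to +-cong; ∙-congˡ to +-congˡ; ∙-congʳ to +-congʳ;
              identityˡ to +-identityˡ; identityʳ to +-identityʳ)
  open import Algebra.Properties.CommutativeMonoid.Sum M

  infix 5 _on_
  _on_ : ∀ {n} → (Fin n → Carrier) → KeySet n → Fin n → Carrier
  (f on p) k = if p k then f k else 0#

  abstract
    Σ[_] : ∀ {n} → KeySet n → (Fin n → Carrier) → Carrier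
    Σ[ p ] f = sum (f on p)

    Σ-sum : ∀ {n} (p : KeySet n) (f : Fin n → Carrier) → Σ[ p ] f ≈ sum (f on p)
    Σ-sum p f = refl

    Σ-cong : ∀ {n} {p q : KeySet n} {f g : Fin n → Carrier} → p ≐ q →
             (∀ {k} → k ∈ p → f k ≈ g k) → Σ[ p ] f ≈ Σ[ q ] g
    Σ-cong {p = p} {q} {f} {g} p≐q f≈g = sum-cong-≋ pointwise
      where
      pointwise : ∀ k → (if p k then f k else 0#) ≈ (if q k then g k else 0#)
      pointwise k rewrite ≡.sym (p≐q k) with p k in k∈
      ... | true  = f≈g k∈
      ... | false = refl

    Σ-+ : ∀ {n} (p : KeySet n) (f g : Fin n → Carrier) →
          Σ[ p ] (λ k → f k + g k) ≈ Σ[ p ] f + Σ[ p ] g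
    Σ-+ {n} p f g = trans (sum-cong-≋ pointwise) (∑-distrib-+ {n} (f on p) (g on p))
      where
      pointwise : ∀ k → (if p k then f k + g k else 0#) ≈
                        (if p k then f k else 0#) + (if p k then g k else 0#)
      pointwise k with p k
      ... | true  = refl
      ... | false = sym (+-identityˡ 0#)

    Σ-split : ∀ {n} (p q : KeySet n) (f : Fin n → Carrier) →
              Σ[ p ] f ≈ Σ[ p ∩ q ] f + Σ[ p ∩ ∁ q ] f
    Σ-split {n} p q f = trans (sum-cong-≋ pointwise) (∑-distrib-+ {n} (f on p ∩ q) (f on p ∩ ∁ q))
      where
      pointwise : ∀ k → (if p k then f k else 0#) ≈
                        (if p k ∧ q k then f k else 0#) + (if p k ∧ not (q k) then f k else 0#)
      pointwise k with p k | q k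
      ... | true  | true  = sym (+-identityʳ _)
      ... | true  | false = sym (+-identityˡ _)
      ... | false | _     = sym (+-identityʳ _)

    Σ-zero : ∀ {n} {p : KeySet n} {f : Fin n → Carrier} → (∀ {k} → k ∈ p → f k ≈ 0#) → Σ[ p ] f ≈ 0#
    Σ-zero {n} {p} {f} f≈0 = trans (sum-cong-≋ pointwise) (sum-replicate-zero n)
      where
      pointwise : ∀ k → (if p k then f k else 0#) ≈ 0#
      pointwise k with p k in k∈p
      ... | true  = f≈0 k∈p
      ... | false = refl

    Σ-empty : ∀ {n} {p : KeySet n} (f : Fin n → Carrier) → (∀ k → p k ≡ false) → Σ[ p ] f ≈ 0#
    Σ-empty {p = p} f empty = Σ-zero λ {k} k∈p → contradiction (≡.trans (≡.sym k∈p) (empty k)) λ ()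

    Σ-only : ∀ {n} (a : Fin n) (f : Fin n → Carrier) → Σ[ only a ] f ≈ f a
    Σ-only zero    f = trans (+-congˡ (Σ-empty (f ∘ suc) λ _ → ≡.refl)) (+-identityʳ _)
    Σ-only {suc n} (suc a) f = trans (+-identityˡ _) (trans (Σ-cong suc-only λ _ → refl) (Σ-only a (f ∘ suc)))
      where
      suc-only : ∀ k → only (Fin.suc a) (suc k) ≡ only a k
      suc-only k with k Fin.≟ a
      ... | yes _ = ≡.refl
      ... | no _  = ≡.refl

    Σ-remove : ∀ {n} {p : KeySet n} {a} (f : Fin n → Carrier) → a ∈ p →
               Σ[ p ] f ≈ f a + Σ[ p ∖ a ] f
    Σ-remove {p = p} {a} f a∈p =
      trans (Σ-split p (only a) f) (+-congʳ (trans (Σ-cong pointwise λ _ → refl) (Σ-only a f)))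
      where
      pointwise : p ∩ only a ≐ only a
      pointwise k with k Fin.≟ a
      ... | yes ≡.refl rewrite a∈p = ≡.refl
      ... | no _  = Bool.∧-zeroʳ (p k)

    Σ-insert : ∀ {n} {p q : KeySet n} {a} (f : Fin n → Carrier) → p a ≡ false →
               q ≐ p ∪ only a → Σ[ q ] f ≈ f a + Σ[ p ] f
    Σ-insert {p = p} {q} {a} f a∉p q≐ =
      trans (Σ-remove f (≡.trans (q≐ a) (≡.trans (≡.cong (p a ∨_) (only-self a)) (Bool.∨-zeroʳ _))))
            (+-congˡ (Σ-cong pointwise λ _ → refl))
      where
      pointwise : q ∖ a ≐ p
      pointwise k rewrite q≐ k with k Fin.≟ a
      ... | yes ≡.refl rewrite a∉p = ≡.refl
      ... | no _ = ≡.trans (Bool.∧-identityʳ _) (Bool.∨-identityʳ _)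

-- Ordered rings and minimal trees

module ℕΣ = Sums ℕ.+-0-commutativeMonoid

size : ∀ {n} → KeySet n → ℕ
size p = ℕΣ.Σ[ p ] (const 1)

Nonempty : ∀ {n} → KeySet n → Set
Nonempty p = ∃[ k ] k ∈ p

nonempty? : ∀ {n} (p : KeySet n) → Dec (Nonempty p)
nonempty? p = Fin.any? λ k → p k Bool.≟ true

¬nonempty⇒empty : ∀ {n} {p : KeySet n} → ¬ Nonempty p → ∀ k → p k ≡ false
¬nonempty⇒empty ¬∃ k = Bool.¬-not λ k∈p → ¬∃ (k , k∈p)

infix 7 _==_
_==_ : Bool → Bool → Bool
b == true  = b
b == false = not b

==⇒≡ : ∀ {b c} → b == c ≡ true → b ≡ c
==⇒≡ {true}  {true}  _ = ≡.refl
==⇒≡ {false} {false} _ = ≡.refl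

==-refl : ∀ b → b == b ≡ true
==-refl true  = ≡.refl
==-refl false = ≡.refl

-- `==` reduces as soon as `c` is known, so the two sides are by definition the intersections of `p`
-- with `answer τ` and with its complement. In particular the no-side of `⟨= a ⟩` is literally `p`
-- with `a` removed.
part : ∀ {n} → Test n → Bool → KeySet n → KeySet n
part τ c p k = p k ∧ answer τ k == c

∧⇒ˡ : ∀ {b c} → b ∧ c ≡ true → b ≡ true
∧⇒ˡ {true} _ = ≡.refl

∧⇒ʳ : ∀ {b c} → b ∧ c ≡ true → c ≡ true
∧⇒ʳ {true} c≡true = c≡true

∧-intro : ∀ {b c} → b ≡ true → c ≡ true → b ∧ c ≡ true
∧-intro ≡.refl c≡true = c≡true

∈-part⁻ˡ : ∀ {n} (τ : Test n) c {p k} → k ∈ part τ c p → k ∈ p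
∈-part⁻ˡ τ c = ∧⇒ˡ

∈-part⁻ʳ : ∀ {n} (τ : Test n) c {p k} → k ∈ part τ c p → answer τ k ≡ c
∈-part⁻ʳ τ c {p} k∈ = ==⇒≡ (∧⇒ʳ {p _} k∈)

∈-part⁺ : ∀ {n} (τ : Test n) {c p k} → k ∈ p → answer τ k ≡ c → k ∈ part τ c p
∈-part⁺ τ k∈p ≡.refl = ∧-intro k∈p (==-refl (answer τ _))

part-empty⇒≐ : ∀ {n} (τ : Test n) c {p} → ¬ Nonempty (part τ c p) → p ≐ part τ (not c) p
part-empty⇒≐ τ true  {p} ¬ne k with p k | answer τ k | ¬nonempty⇒empty ¬ne k
... | true  | false | _ = ≡.refl
... | false | _     | _ = ≡.refl
part-empty⇒≐ τ false {p} ¬ne k with p k | answer τ k | ¬nonempty⇒empty ¬ne k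
... | true  | true | _ = ≡.refl
... | false | _    | _ = ≡.refl

Splits : ∀ {n} → Test n → KeySet n → Set
Splits τ p = Nonempty (part τ true p) × Nonempty (part τ false p)

size-part : ∀ {n} (τ : Test n) p → size p ≡ size (part τ true p) ℕ.+ size (part τ false p)
size-part τ p = ℕΣ.Σ-split p (answer τ) (const 1)

nonempty⇒size : ∀ {n} {p : KeySet n} → Nonempty p → 1 ℕ.≤ size p
nonempty⇒size {p = p} (k , k∈p) =
  ≡.subst (1 ℕ.≤_) (≡.sym (ℕΣ.Σ-remove {p = p} (const 1) k∈p)) (ℕ.s≤s ℕ.z≤n)

size-part< : ∀ {n} (τ : Test n) {p} → Nonempty (part τ true p) → Nonempty (part τ false p) →
             ∀ c → size (part τ c p) ℕ.< size p
size-part< τ {p} yes≠∅ no≠∅ true =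
  ≡.subst (size (part τ true p) ℕ.<_) (≡.sym (size-part τ p)) (ℕ.m<m+n _ (nonempty⇒size no≠∅))
size-part< τ {p} yes≠∅ no≠∅ false =
  ≡.subst (size (part τ false p) ℕ.<_) (≡.sym (size-part τ p)) (ℕ.m<n+m _ (nonempty⇒size yes≠∅))

module Order (K : OrderedRing) where
  open OrderedRing K public hiding (zero)
  open Sums +-commutativeMonoid public
  open Algebra.Properties.CommutativeMonoid.Sum +-commutativeMonoid public
    using (sum-cong-≋; sum-replicate)
  open Algebra.Properties.Ring ring using (-‿distribˡ-*; -‿distribʳ-*; -‿involutive)
  open MonoidSolver +-commutativeMonoid public using (solve; _⊜_) renaming (_⊕_ to _⊞_; id to ⓪)

  private variable a b x x′ y y′ z : Carrier

  ≤-respˡ : x ≈ y → x ≤ z → y ≤ z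
  ≤-respˡ x≈y x≤z = ≤-trans (≤-reflexive (sym x≈y)) x≤z

  ≤-respʳ : x ≈ y → z ≤ x → z ≤ y
  ≤-respʳ x≈y z≤x = ≤-trans z≤x (≤-reflexive x≈y)

  +-monoʳ-≤ : ∀ z → x ≤ y → z + x ≤ z + y
  +-monoʳ-≤ z x≤y = ≤-respˡ (+-comm _ z) (≤-respʳ (+-comm _ z) (+-monoˡ-≤ z x≤y))

  +-mono-≤ : x ≤ y → x′ ≤ y′ → x + x′ ≤ y + y′
  +-mono-≤ x≤y x′≤y′ = ≤-trans (+-monoˡ-≤ _ x≤y) (+-monoʳ-≤ _ x′≤y′)

  +-cancelʳ-≤ : ∀ z → x + z ≤ y + z → x ≤ y
  +-cancelʳ-≤ z x+z≤y+z = ≤-respˡ (undo _) (≤-respʳ (undo _) (+-monoˡ-≤ (- z) x+z≤y+z))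
    where
    undo : ∀ x → x + z + - z ≈ x
    undo x = trans (+-assoc x z (- z)) (trans (+-congˡ (-‿inverseʳ z)) (+-identityʳ x))

  -- Linear inequalities are proved by adding up hypotheses and comparing
  -- both sides with the solver for commutative monoids.
  balance : x ≤ y → a + y ≈ b + x → a ≤ b
  balance {x} x≤y eq = +-cancelʳ-≤ x (≤-respʳ eq (+-monoʳ-≤ _ x≤y))

  x≤x+y : 0# ≤ y → x ≤ x + y
  x≤x+y 0≤y = ≤-respˡ (+-identityʳ _) (+-monoʳ-≤ _ 0≤y)

  x≤y+x : 0# ≤ y → x ≤ y + x
  x≤y+x 0≤y = ≤-respʳ (+-comm _ _) (x≤x+y 0≤y)

  +-nonNegative : 0# ≤ x → 0# ≤ y → 0# ≤ x + y
  +-nonNegative 0≤x 0≤y = ≤-trans 0≤x (x≤x+y 0≤y)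

  ·-nonNegative : ∀ m → 0# ≤ x → 0# ≤ m · x
  ·-nonNegative zero    0≤x = ≤-refl
  ·-nonNegative (suc m) 0≤x = +-nonNegative 0≤x (·-nonNegative m 0≤x)

  0≤1 : 0# ≤ 1#
  0≤1 with total 0# 1#
  ... | inj₁ 0≤1 = 0≤1
  ... | inj₂ 1≤0 = ≤-respʳ -1*-1≈1 (*-nonNegative 0≤-1 0≤-1)
    where
    0≤-1 : 0# ≤ - 1#
    0≤-1 = ≤-respˡ (-‿inverseʳ 1#) (≤-respʳ (+-identityˡ _) (+-monoˡ-≤ (- 1#) 1≤0))
    -1*-1≈1 : - 1# * - 1# ≈ 1#
    -1*-1≈1 = trans (sym (-‿distribˡ-* _ _)) (trans (-‿cong (*-identityˡ _)) (-‿involutive 1#))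

  1≰0 : ¬ 1# ≤ 0#
  1≰0 1≤0 = 1#≉0# (antisym 1≤0 0≤1)

  sum-mono : ∀ {n} {f g : Fin n → Carrier} → (∀ k → f k ≤ g k) → sum f ≤ sum g
  sum-mono {zero}  f≤g = ≤-refl
  sum-mono {suc n} f≤g = +-mono-≤ (f≤g zero) (sum-mono (f≤g ∘ suc))

  Σ-nonNegative : ∀ {n} {p : KeySet n} {f : Fin n → Carrier} → (∀ k → 0# ≤ f k) → 0# ≤ Σ[ p ] f
  Σ-nonNegative {n} {p} {f} 0≤f =
    ≤-respˡ (trans (sum-replicate n) (n·0≈0 n)) (≤-respʳ (sym (Σ-sum p f)) (sum-mono {f = const 0#} {g = f on p} 0≤))
    where
    n·0≈0 : ∀ n → n · 0# ≈ 0#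
    n·0≈0 zero    = refl
    n·0≈0 (suc n) = trans (+-identityˡ _) (n·0≈0 n)
    0≤ : ∀ k → 0# ≤ (f on p) k
    0≤ k with p k
    ... | true  = 0≤f k
    ... | false = ≤-refl

  Σ-⊆ : ∀ {n} {p q : KeySet n} {f : Fin n → Carrier} → (∀ k → 0# ≤ f k) →
        (∀ {k} → k ∈ p → k ∈ q) → Σ[ p ] f ≤ Σ[ q ] f
  Σ-⊆ {n} {p} {q} {f} 0≤f p⊆q = ≤-respˡ (sym (Σ-sum p f))
      (≤-respʳ (sym (Σ-sum q f)) (sum-mono {f = f on p} {g = f on q} pointwise))
    where
    pointwise : ∀ k → (f on p) k ≤ (f on q) k
    pointwise k with p k in k∈p
    ... | true rewrite p⊆q k∈p = ≤-refl
    ... | false with q k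
    ...   | true  = 0≤f k
    ...   | false = ≤-refl

module OptimalTrees (K : OrderedRing) {n} (w : Fin n → OrderedRing.Carrier K)
  (1≤w : ∀ k → OrderedRing._≤_ K (OrderedRing.1# K) (w k)) (k₀ : Fin n) where
  open Order K

  0≤w : ∀ k → 0# ≤ w k
  0≤w k = ≤-trans 0≤1 (1≤w k)

  W : KeySet n → Carrier
  W p = Σ[ p ] w

  cost : KeySet n → Tree n → Carrier
  cost p t = Σ[ p ] (λ k → depth t k · w k)

  Correct : KeySet n → Tree n → Set
  Correct p t = ∀ {k} → k ∈ p → search t k ≡ k

  record Proper (p : KeySet n) (t : Tree n) : Set where
    field
      unique   : Unique (leaves t)
      sound    : ∀ {k} → k ∈ₗ leaves t → k ∈ p
      complete : ∀ {k} → k ∈ p → k ∈ₗ leaves t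

  W-cong : ∀ {p q} → p ≐ q → W p ≈ W q
  W-cong {p} {q} p≐q = Σ-cong {p = p} {q} p≐q λ _ → refl

  cost-cong : ∀ {p q} t → p ≐ q → cost p t ≈ cost q t
  cost-cong {p} {q} t p≐q = Σ-cong {p = p} {q} p≐q λ _ → refl

  0≤W : ∀ p → 0# ≤ W p
  0≤W p = Σ-nonNegative {p = p} 0≤w

  0≤cost : ∀ p t → 0# ≤ cost p t
  0≤cost p t = Σ-nonNegative {p = p} λ k → ·-nonNegative (depth t k) (0≤w k)

  W-part : ∀ τ p → W p ≈ W (part τ true p) + W (part τ false p)
  W-part τ p = Σ-split p (answer τ) w

  W-part-≤ : ∀ τ c p → W (part τ c p) ≤ W p
  W-part-≤ τ c p = Σ-⊆ {p = part τ c p} {p} 0≤w λ {k} → ∈-part⁻ˡ τ c {p} {k}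

  cost-node : ∀ p τ y z →
    cost p (node τ y z) ≈ W p + (cost (part τ true p) y + cost (part τ false p) z)
  cost-node p τ y z =
    trans (Σ-+ p w below) $ +-congˡ $ trans (Σ-split p (answer τ) below) $
    +-cong (Σ-cong {p = part τ true p} (λ _ → ≡.refl) λ {k} k∈ →
             reflexive (≡.cong (λ b → (if b then depth y k else depth z k) · w k) (∈-part⁻ʳ τ true {p} {k} k∈)))
           (Σ-cong {p = part τ false p} (λ _ → ≡.refl) λ {k} k∈ →
             reflexive (≡.cong (λ b → (if b then depth y k else depth z k) · w k) (∈-part⁻ʳ τ false {p} {k} k∈)))
    where
    below : Fin n → Carrier
    below k = (if answer τ k then depth y k else depth z k) · w k

  correct-yes : ∀ {p} τ y z → Correct p (node τ y z) → Correct (part τ true p) y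
  correct-yes {p} τ y z ok {k} k∈
    with answer τ k | ∈-part⁻ʳ τ true {p} {k} k∈ | ok (∈-part⁻ˡ τ true {p} {k} k∈)
  ... | true | _ | ok-k = ok-k

  correct-no : ∀ {p} τ y z → Correct p (node τ y z) → Correct (part τ false p) z
  correct-no {p} τ y z ok {k} k∈
    with answer τ k | ∈-part⁻ʳ τ false {p} {k} k∈ | ok (∈-part⁻ˡ τ false {p} {k} k∈)
  ... | false | _ | ok-k = ok-k

  correct-node : ∀ {p} τ y z → Correct (part τ true p) y → Correct (part τ false p) z →
                 Correct p (node τ y z)
  correct-node {p} τ y z ok-y ok-z {k} k∈p with answer τ k in eq
  ... | true  = ok-y (∈-part⁺ τ {p = p} k∈p eq)
  ... | false = ok-z (∈-part⁺ τ {p = p} k∈p eq)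

  proper-node : ∀ {p} τ y z → Proper (part τ true p) y → Proper (part τ false p) z →
                Proper p (node τ y z)
  proper-node {p} τ y z proper-y proper-z = record
    { unique   = Unique.++⁺ Y.unique Z.unique λ (k∈y , k∈z) →
        contradiction (≡.trans (≡.sym (∈-part⁻ʳ τ true {p} (Y.sound k∈y))) (∈-part⁻ʳ τ false {p} (Z.sound k∈z))) λ ()
    ; sound    = λ k∈ → [ ∈-part⁻ˡ τ true {p} ∘ Y.sound , ∈-part⁻ˡ τ false {p} ∘ Z.sound ]′ (∈-++⁻ (leaves y) k∈)
    ; complete = complete
    }
    where
    module Y = Proper proper-y
    module Z = Proper proper-z
    complete : ∀ {k} → k ∈ p → k ∈ₗ leaves y ++ leaves z
    complete {k} k∈p with answer τ k in eq
    ... | true  = ∈-++⁺ˡ (Y.complete (∈-part⁺ τ {p = p} k∈p eq))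
    ... | false = ∈-++⁺ʳ (leaves y) (Z.complete (∈-part⁺ τ {p = p} k∈p eq))

  -- Minimality ranges over all correct trees, and `proper` brings the minimum back among genuine
  -- search trees. It presupposes a key because every tree has a leaf, so no tree is proper for the
  -- empty set.
  record Minimal (p : KeySet n) (t : Tree n) : Set where
    field
      correct : Correct p t
      minimal : ∀ t′ → Correct p t′ → cost p t ≤ cost p t′
      proper  : Nonempty p → Proper p t

  zero-cost : ∀ p k → cost p (leaf k) ≈ 0#
  zero-cost p k = Σ-zero {p = p} λ _ → refl

  private
    tests : List (Test n)
    tests = map ⟨=_⟩ (allFin n) ++ map ⟨<_⟩ (allFin n)

    ∈-tests : ∀ τ → τ ∈ₗ tests
    ∈-tests ⟨= k ⟩ = ∈-++⁺ˡ (∈-map⁺ ⟨=_⟩ (∈-allFin k))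
    ∈-tests ⟨< k ⟩ = ∈-++⁺ʳ (map ⟨=_⟩ (allFin n)) (∈-map⁺ ⟨<_⟩ (∈-allFin k))

    module Branch (p : KeySet n) (a b : Fin n) (a∈p : a ∈ p) (b∈p∖a : b ∈ p ∖ a)
      (smaller : ∀ q → size q ℕ.< size p → ∃ (Minimal q)) where

      open Minimal

      Best : Test n → Tree n → Set
      Best τ t = ∀ y z → Correct p (node τ y z) → cost p t ≤ cost p (node τ y z)

      candidate : ∀ τ → Splits τ p → ∃[ t ] (Correct p t × Proper p t × Best τ t)
      candidate τ (yes≠∅ , no≠∅)
        with y , opt-y ← smaller (part τ true p) (size-part< τ {p} yes≠∅ no≠∅ true)
           | z , opt-z ← smaller (part τ false p) (size-part< τ {p} yes≠∅ no≠∅ false)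
        = node τ y z
        , correct-node {p} τ y z (correct opt-y) (correct opt-z)
        , proper-node {p} τ y z (proper opt-y yes≠∅) (proper opt-z no≠∅)
        , λ y′ z′ ok → ≤-respˡ (sym (cost-node p τ y z)) $ ≤-respʳ (sym (cost-node p τ y′ z′)) $
            +-monoʳ-≤ _ (+-mono-≤ (minimal opt-y y′ (correct-yes {p} τ y′ z′ ok))
                                  (minimal opt-z z′ (correct-no {p} τ y′ z′ ok)))

      a-splits : Splits ⟨= a ⟩ p
      a-splits = (a , ∧-intro a∈p (only-self a)) , (b , b∈p∖a)

      best : (τs : List (Test n)) → ∃[ t ] (Correct p t × Proper p t × (∀ {τ} → τ ∈ₗ τs → Splits τ p → Best τ t))
      best [] with t , ok , pr , _ ← candidate ⟨= a ⟩ a-splits = t , ok , pr , λ ()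
      best (τ ∷ τs) with best τs | nonempty? (part τ true p) | nonempty? (part τ false p)
      ... | t , ok , pr , t-best | no yes=∅ | _ =
        t , ok , pr , λ { (here ≡.refl) (yes≠∅ , _) → contradiction yes≠∅ yes=∅ ; (there τ∈) → t-best τ∈ }
      ... | t , ok , pr , t-best | yes _ | no no=∅ =
        t , ok , pr , λ { (here ≡.refl) (_ , no≠∅) → contradiction no≠∅ no=∅ ; (there τ∈) → t-best τ∈ }
      ... | t , ok , pr , t-best | yes yes≠∅ | yes no≠∅ with candidate τ (yes≠∅ , no≠∅)
      ...   | u , ok-u , pr-u , u-best with total (cost p t) (cost p u)
      ...     | inj₁ t≤u = t , ok , pr ,
        λ { (here ≡.refl) _ y z ok → ≤-trans t≤u (u-best y z ok) ; (there τ∈) → t-best τ∈ }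
      ...     | inj₂ u≤t = u , ok-u , pr-u ,
        λ { (here ≡.refl) _ → u-best ; (there τ∈) splits y z ok → ≤-trans u≤t (t-best τ∈ splits y z ok) }

      optimum : ∃ (Minimal p)
      optimum with t , ok , pr , t-best ← best tests = t , record
        { correct = ok ; minimal = least ; proper = const pr }
        where
        child : ∀ c τ y z t′ → p ≐ part τ c p → cost (part τ c p) t′ ≤ cost (part τ true p) y + cost
            (part τ false p) z →
                cost p t′ ≤ cost p (node τ y z)
        child c τ y z t′ p≐ le = ≤-respˡ (sym (cost-cong t′ p≐)) $ ≤-respʳ (sym (cost-node p τ y z)) $
          ≤-trans le (x≤y+x (0≤W p))
        least : ∀ t′ → Correct p t′ → cost p t ≤ cost p t′
        least (leaf k) ok = contradiction (only⇒≡ {a = a} {b} b∈a) λ b≡a → contradiction b≡a λ _ → not-both b∈a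
            (∧⇒ʳ {p b} b∈p∖a)
          where
          b∈a : b ∈ only a
          b∈a rewrite ≡.trans (≡.sym (ok (∧⇒ˡ b∈p∖a))) (ok a∈p) = only-self a
          not-both : ∀ {b} → b ≡ true → not b ≡ true → ⊥
          not-both {true} _ ()
        least (node τ y z) ok with nonempty? (part τ true p) | nonempty? (part τ false p)
        ... | yes yes≠∅ | yes no≠∅ = t-best (∈-tests τ) (yes≠∅ , no≠∅) y z ok
        ... | no yes=∅ | _ = ≤-trans (least z λ {k} k∈p → correct-no {p} τ y z ok (≡.trans (≡.sym (p≐ k)) k∈p))
              (child false τ y z z p≐ (x≤y+x (0≤cost _ y)))
          where p≐ = part-empty⇒≐ τ true {p} yes=∅
        ... | yes _ | no no=∅ = ≤-trans (least y λ {k} k∈p → correct-yes {p} τ y z ok (≡.trans (≡.sym (p≐ k)) k∈p))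
              (child true τ y z y p≐ (x≤x+y (0≤cost _ z)))
          where p≐ = part-empty⇒≐ τ false {p} no=∅

  optimum : ∀ s p → size p ℕ.≤ s → ∃ (Minimal p)
  optimum s p size≤s with nonempty? p
  -- The empty set still needs some tree, and a leaf needs a key; `k₀` supplies it.
  ... | no p=∅ = leaf k₀ , record
    { correct = λ k∈p → contradiction (_ , k∈p) p=∅ ; minimal = λ t′ _ → ≤-respˡ (sym (zero-cost p k₀)) (0≤cost p t′)
    ; proper = λ p≠∅ → contradiction p≠∅ p=∅ }
  ... | yes (a , a∈p) with nonempty? (p ∖ a)
  ...   | no p∖a=∅ = leaf a , record
    { correct = ≡.sym ∘ p⊆a ; minimal = λ t′ _ → ≤-respˡ (sym (zero-cost p a)) (0≤cost p t′)
    ; proper = λ _ → record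
      { unique = All.[] AllPairs.∷ AllPairs.[] ; sound = λ { (here ≡.refl) → a∈p }
      ; complete = here ∘ p⊆a } }
    where
    p⊆a : ∀ {k} → k ∈ p → k ≡ a
    p⊆a {k} k∈p with k Fin.≟ a in eq
    ... | yes k≡a = k≡a
    ... | no k≢a  = contradiction (k , ∧-intro k∈p (≡.cong (not ∘ does) eq)) p∖a=∅
  optimum zero p size≤s | yes p≠∅ | yes _ = contradiction (ℕ.≤-trans (nonempty⇒size p≠∅) size≤s) λ ()
  optimum (suc s) p size≤s | yes (a , a∈p) | yes (b , b∈p∖a) =
    Branch.optimum p a b a∈p b∈p∖a λ q size< → optimum s q (ℕ.≤-pred (ℕ.<-≤-trans size< size≤s))

-- Structure of optimal trees

≐-intro : ∀ {n} {p q : KeySet n} → (∀ {k} → k ∈ p → k ∈ q) → (∀ {k} → k ∈ q → k ∈ p) → p ≐ q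
≐-intro {p = p} {q} p⊆q q⊆p k with p k in eqp | q k in eqq
... | true  | true  = ≡.refl
... | false | false = ≡.refl
... | true  | false = ≡.trans (≡.sym (p⊆q eqp)) eqq
... | false | true  = ≡.trans (≡.sym eqp) (q⊆p eqq)

does⇒ : ∀ {A : Set} (a? : Dec A) → does a? ≡ true → A
does⇒ (yes a) _ = a

does⇒¬ : ∀ {A : Set} (a? : Dec A) → does a? ≡ false → ¬ A
does⇒¬ (no ¬a) _ = ¬a

≐-sym : ∀ {n} {p q : KeySet n} → p ≐ q → q ≐ p
≐-sym p≐q k = ≡.sym (p≐q k)

≢⇒∈∁only : ∀ {n} {a k : Fin n} → k ≢ a → k ∈ ∁ (only a)
≢⇒∈∁only {a = a} {k} k≢a with k Fin.≟ a
... | yes k≡a = contradiction k≡a k≢a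
... | no _    = ≡.refl

∈∁only⇒≢ : ∀ {n} {a k : Fin n} → k ∈ ∁ (only a) → k ≢ a
∈∁only⇒≢ {a = a} k∈ ≡.refl with a Fin.≟ a
∈∁only⇒≢ {a = a} () ≡.refl | yes _
... | no a≢a = a≢a ≡.refl

∈∖ : ∀ {n} {p : KeySet n} {a k} → k ∈ p → k ≢ a → k ∈ p ∖ a
∈∖ k∈p k≢a = ∧-intro k∈p (≢⇒∈∁only k≢a)

∈∖⁻ˡ : ∀ {n} {p : KeySet n} {a k} → k ∈ p ∖ a → k ∈ p
∈∖⁻ˡ = ∧⇒ˡ

∈∖⁻ʳ : ∀ {n} {p : KeySet n} {a k} → k ∈ p ∖ a → k ≢ a
∈∖⁻ʳ {p = p} {a} {k} k∈ = ∈∁only⇒≢ (∧⇒ʳ {p k} k∈)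

≡-or-≡not : ∀ b c → b ≡ c ⊎ b ≡ not c
≡-or-≡not true  true  = inj₁ ≡.refl
≡-or-≡not true  false = inj₂ ≡.refl
≡-or-≡not false true  = inj₂ ≡.refl
≡-or-≡not false false = inj₁ ≡.refl

b≢not-b : ∀ {b c} → b ≡ c → b ≡ not c → ⊥
b≢not-b {true}  ≡.refl ()
b≢not-b {false} ≡.refl ()

size-remove : ∀ {n} {p : KeySet n} {a} → a ∈ p → size p ≡ suc (size (p ∖ a))
size-remove {p = p} = ℕΣ.Σ-remove {p = p} (const 1)

size⇒nonempty : ∀ {n} {p : KeySet n} → 1 ℕ.≤ size p → Nonempty p
size⇒nonempty {p = p} 1≤ with nonempty? p
... | yes p≠∅ = p≠∅
... | no p=∅ with () ← ≡.subst (1 ℕ.≤_) (ℕΣ.Σ-empty (const 1) (¬nonempty⇒empty p=∅)) 1≤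

two-keys : ∀ {n} {p : KeySet n} → 2 ℕ.≤ size p → ∃[ a ] ∃[ b ] (a ∈ p × b ∈ p ∖ a)
two-keys {p = p} 2≤
  with a , a∈p ← size⇒nonempty {p = p} (ℕ.≤-trans (ℕ.s≤s ℕ.z≤n) 2≤)
  with b , b∈ ← size⇒nonempty {p = p ∖ a} (ℕ.≤-pred (≡.subst (2 ℕ.≤_) (size-remove {p = p} a∈p) 2≤))
  = a , b , a∈p , b∈

size≤1⇒≡ : ∀ {n} {p : KeySet n} → size p ℕ.≤ 1 → ∀ {a b} → a ∈ p → b ∈ p → a ≡ b
size≤1⇒≡ {p = p} ≤1 {a} {b} a∈p b∈p with a Fin.≟ b
... | yes a≡b = a≡b
... | no a≢b = contradiction (ℕ.≤-trans (nonempty⇒size (a , ∈∖ {p = p} a∈p a≢b))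
                              (ℕ.≤-pred (≡.subst (ℕ._≤ 1) (size-remove {p = p} b∈p) ≤1))) λ ()

part-comm : ∀ {n} (τ σ : Test n) c d p → part τ c (part σ d p) ≐ part σ d (part τ c p)
part-comm τ σ c d p k with p k | answer σ k == d | answer τ k == c
... | false | _     | _     = ≡.refl
... | true  | true  | true  = ≡.refl
... | true  | true  | false = ≡.refl
... | true  | false | true  = ≡.refl
... | true  | false | false = ≡.refl

part-id : ∀ {n} (τ : Test n) c {p} → (∀ {k} → k ∈ p → answer τ k ≡ c) → part τ c p ≐ p
part-id τ c {p} const-on-p = ≐-intro (λ {k} → ∈-part⁻ˡ τ c {p} {k}) λ k∈p → ∈-part⁺ τ {p = p} k∈p (const-on-p k∈p)

-- That is, one of the four combinations of answers to two tests never occurs.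
noncrossing : ∀ {n} (τ σ : Test n) → ∃[ d ] ∃[ c ] (∀ {k} → answer τ k ≡ d → answer σ k ≡ c)
noncrossing ⟨= x ⟩ σ = true , answer σ x , λ {k} k≟x → ≡.cong (answer σ) (only⇒≡ {a = x} {k} k≟x)
noncrossing ⟨< x ⟩ ⟨= y ⟩ = not (answer ⟨< x ⟩ y) , false , avoids
  where
  avoids : ∀ {k} → answer ⟨< x ⟩ k ≡ not (answer ⟨< x ⟩ y) → answer ⟨= y ⟩ k ≡ false
  avoids {k} k≡ with k Fin.≟ y
  ... | yes ≡.refl = ⊥-elim (b≢not-b ≡.refl k≡)
  ... | no _ = ≡.refl
noncrossing ⟨< x ⟩ ⟨< y ⟩ with Fin.≤-total x y
... | inj₁ x≤y = true , true , λ {k} k<x →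
  dec-true (k Fin.<? y) (ℕ.<-≤-trans (does⇒ (k Fin.<? x) k<x) x≤y)
... | inj₂ y≤x = false , false , λ {k} k≮x →
  dec-false (k Fin.<? y) λ k<y → does⇒¬ (k Fin.<? x) k≮x (ℕ.<-≤-trans k<y y≤x)

splits-part : ∀ {n} (τ : Test n) {p} → Splits τ p → ∀ c → Nonempty (part τ c p)
splits-part τ (yes≠∅ , _) true  = yes≠∅
splits-part τ (_ , no≠∅)  false = no≠∅

-- Both answers to σ occur on the side `a` of τ, so the combination of answers that never occurs
-- must lie on the opposite side.
splits⇒const : ∀ {n} (τ σ : Test n) a {p} → Splits σ (part τ a p) →
               ∃[ c ] (∀ {k} → answer τ k ≡ not a → answer σ k ≡ c)
splits⇒const τ σ a {p} splits with noncrossing τ σ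
... | d , c , τ≡d⇒σ≡c with ≡-or-≡not d a
...   | inj₂ ≡.refl = c , τ≡d⇒σ≡c
...   | inj₁ ≡.refl with k , k∈ ← splits-part σ {part τ a p} splits (not c) =
  ⊥-elim (b≢not-b (τ≡d⇒σ≡c (∈-part⁻ʳ τ a {p} (∈-part⁻ˡ σ (not c) {part τ a p} k∈)))
                  (∈-part⁻ʳ σ (not c) {part τ a p} k∈))

module Structure (K : OrderedRing) {n} (w : Fin n → OrderedRing.Carrier K)
  (1≤w : ∀ k → OrderedRing._≤_ K (OrderedRing.1# K) (w k)) (k₀ : Fin n) where
  open Order K
  open OptimalTrees K w 1≤w k₀

  abstract
    best-tree : ∀ p → ∃ (Minimal p)
    best-tree p = optimum (size p) p ℕ.≤-refl

  o : KeySet n → Carrier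
  o p = cost p (proj₁ (best-tree p))

  o-≤ : ∀ {p} t → Correct p t → o p ≤ cost p t
  o-≤ {p} t = Minimal.minimal (proj₂ (best-tree p)) t

  0≤o : ∀ p → 0# ≤ o p
  0≤o p = 0≤cost p (proj₁ (best-tree p))

  o-cong : ∀ {p q} → p ≐ q → o p ≈ o q
  o-cong p≐q = antisym (half p≐q) (half (≐-sym p≐q))
    where
    half : ∀ {p q} → p ≐ q → o p ≤ o q
    half {p} {q} p≐q with t , opt ← best-tree q =
      ≤-respʳ (cost-cong t p≐q) (o-≤ {p} t λ {k} k∈p → Minimal.correct opt (≡.trans (≡.sym (p≐q k)) k∈p))

  o-small : ∀ {p} → (∀ {a b} → a ∈ p → b ∈ p → a ≡ b) → o p ≈ 0#
  o-small {p} all≡ = antisym (≤-respʳ (zero-cost p any-key) (o-≤ {p} (leaf any-key) correct)) (0≤o p)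
    where
    key : Dec (Nonempty p) → Fin n
    key (yes (a , _)) = a
    key (no _)        = k₀
    any-key : Fin n
    any-key = key (nonempty? p)
    correct : Correct p (leaf any-key)
    correct k∈p with nonempty? p
    ... | yes (a , a∈p) = all≡ a∈p k∈p
    ... | no p=∅ = contradiction (_ , k∈p) p=∅

  W-parts : ∀ τ c p → W p ≈ W (part τ c p) + W (part τ (not c) p)
  W-parts τ true  p = W-part τ p
  W-parts τ false p = trans (W-part τ p) (+-comm _ _)

  o-step : ∀ τ c p → o p ≤ W p + (o (part τ c p) + o (part τ (not c) p))
  o-step τ true p with y , opt-y ← best-tree (part τ true p) | z , opt-z ← best-tree (part τ false p) =
    ≤-respʳ (cost-node p τ y z)
      (o-≤ {p} (node τ y z) (correct-node {p} τ y z (Minimal.correct opt-y) (Minimal.correct opt-z)))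
  o-step τ false p = ≤-respʳ (+-congˡ (+-comm _ _)) (o-step τ true p)

  -- With `o-step` this is Bellman's equation: some optimal tree for `p` asks `τ` first. It stands
  -- in for an explicit tree in all exchange arguments.
  Tight : Test n → KeySet n → Set
  Tight τ p = W p + (o (part τ true p) + o (part τ false p)) ≤ o p

  tight-parts : ∀ τ c {p} → Tight τ p → W p + (o (part τ c p) + o (part τ (not c) p)) ≤ o p
  tight-parts τ true  tight = tight
  tight-parts τ false tight = ≤-respˡ (+-congˡ (+-comm _ _)) tight

  tight-via : ∀ τ c σ {p} → part σ true p ≐ part τ c p → part σ false p ≐ part τ (not c) p →
              Tight τ p → Tight σ p
  tight-via τ c σ yes≐ no≐ tight =
    ≤-respˡ (+-congˡ (+-cong (sym (o-cong yes≐)) (sym (o-cong no≐)))) (tight-parts τ c tight)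

  w≤W : ∀ {k p} → k ∈ p → w k ≤ W p
  w≤W {k} {p} k∈p = ≤-respʳ (sym (Σ-remove {p = p} w k∈p)) (x≤x+y (0≤W (p ∖ k)))

  ∃-tight : ∀ p → 2 ℕ.≤ size p → ∃[ τ ] (Tight τ p × Splits τ p)
  ∃-tight p 2≤ = split _ (proj₂ (best-tree p)) refl
    where
    split : ∀ t → Minimal p t → cost p t ≈ o p → ∃[ τ ] (Tight τ p × Splits τ p)
    split (leaf k) opt _ with a , b , a∈p , b∈ ← two-keys {p = p} 2≤ =
      contradiction (≡.trans (≡.sym (Minimal.correct opt (∈∖⁻ˡ {p = p} b∈))) (Minimal.correct opt a∈p))
                    (∈∖⁻ʳ {p = p} b∈)
    split (node τ y z) opt cost≈ = τ , tight , part≠∅ true , part≠∅ false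
      where
      tight : Tight τ p
      tight = ≤-respʳ (trans (sym (cost-node p τ y z)) cost≈)
        (+-monoʳ-≤ _ (+-mono-≤ (o-≤ {part τ true p} y (correct-yes {p} τ y z (Minimal.correct opt)))
                               (o-≤ {part τ false p} z (correct-no {p} τ y z (Minimal.correct opt)))))
      -- A test with an empty side would add W p > 0 to the cost in vain.
      part≠∅ : ∀ c → Nonempty (part τ c p)
      part≠∅ c with nonempty? (part τ c p)
      ... | yes ne = ne
      ... | no empty with a , _ , a∈p , _ ← two-keys {p = p} 2≤ =
        contradiction (≤-trans (≤-trans (1≤w a) (w≤W {a} {p} a∈p)) W≤0) 1≰0
        where
        W≤0 : W p ≤ 0#
        W≤0 = balance (+-mono-≤ (tight-parts τ c {p} tight) (0≤o (part τ c p)))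
          (trans (+-congˡ (+-congʳ (o-cong (part-empty⇒≐ τ c {p} empty))))
            (solve 3 (λ W x y → W ⊞ (y ⊞ x) ⊜ ⓪ ⊞ ((W ⊞ (x ⊞ y)) ⊞ ⓪)) refl
              (W p) (o (part τ c p)) (o (part τ (not c) p))))

  -- Moving `σ` above `τ` lifts the keys of `A₁` by one level, pushes those of `B` down by one and
  -- leaves all other depths alone. As the original order is optimal, `A₁` weighs no more than `B`.
  -- The inequality is the sum of tightness of `τ` and `σ` with two uses of `o-step` for the rotated
  -- tree.
  rotate : ∀ τ a σ c {p} → (∀ {k} → answer τ k ≡ not a → answer σ k ≡ c) →
           Tight τ p → Tight σ (part τ a p) →
           W (part σ (not c) (part τ a p)) ≤ W (part τ (not a) p)
  rotate τ a σ c {p} σ-const tight-τ tight-σ =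
    balance (+-mono-≤ (+-mono-≤ (tight-parts τ a tight-τ) h₂) (+-mono-≤ h₃ h₄))
      (solve 10 (λ Wp WA₁ WA₂ WB op oA oA₁ oA₂ oB oq →
          WA₁ ⊞ ((op ⊞ oA) ⊞ ((Wp ⊞ (oq ⊞ oA₁)) ⊞ ((WA₂ ⊞ WB) ⊞ (oA₂ ⊞ oB)))) ⊜
          WB ⊞ (((Wp ⊞ (oA ⊞ oB)) ⊞ ((WA₂ ⊞ WA₁) ⊞ (oA₂ ⊞ oA₁))) ⊞ (op ⊞ oq)))
        refl (W p) (W A₁) (W A₂) (W B) (o p) (o A) (o A₁) (o A₂) (o B) (o q))
    where
    A = part τ a p
    B = part τ (not a) p
    A₁ = part σ (not c) A
    A₂ = part σ c A
    q = part σ c p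
    σ-not-c⇒τ-a : ∀ {k} → answer σ k ≡ not c → answer τ k ≡ a
    σ-not-c⇒τ-a {k} σ≡ with ≡-or-≡not (answer τ k) a
    ... | inj₁ τ≡ = τ≡
    ... | inj₂ τ≡ = ⊥-elim (b≢not-b (σ-const τ≡) σ≡)
    outer≐ : part σ (not c) p ≐ A₁
    outer≐ = ≐-sym λ k → ≡.trans (part-comm σ τ (not c) a p k)
      (part-id τ a {part σ (not c) p} (λ {k} k∈ → σ-not-c⇒τ-a (∈-part⁻ʳ σ (not c) {p} k∈)) k)
    q-A : part τ a q ≐ A₂
    q-A = part-comm τ σ a c p
    q-B : part τ (not a) q ≐ B
    q-B k = ≡.trans (part-comm τ σ (not a) c p k)
      (part-id σ c {B} (λ {k} k∈ → σ-const (∈-part⁻ʳ τ (not a) {p} k∈)) k)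
    h₂ : (W A₂ + W A₁) + (o A₂ + o A₁) ≤ o A
    h₂ = ≤-respˡ (+-congʳ (W-parts σ c A)) (tight-parts σ c tight-σ)
    h₃ : o p ≤ W p + (o q + o A₁)
    h₃ = ≤-respʳ (+-congˡ (+-congˡ (o-cong outer≐))) (o-step σ c p)
    h₄ : o q ≤ (W A₂ + W B) + (o A₂ + o B)
    h₄ = ≤-respʳ (+-cong (trans (W-parts τ a q) (+-cong (W-cong q-A) (W-cong q-B)))
                          (+-cong (o-cong q-A) (o-cong q-B))) (o-step τ a q)

-- Equal-to tests of heaviest keys, and tests asked ahead of a tree

module HeaviestFirst (K : OrderedRing) {n} (w : Fin n → OrderedRing.Carrier K)
  (1≤w : ∀ k → OrderedRing._≤_ K (OrderedRing.1# K) (w k)) (k₀ : Fin n) where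
  open Order K
  open OptimalTrees K w 1≤w k₀
  open Structure K w 1≤w k₀

  Heaviest : Fin n → KeySet n → Set
  Heaviest m p = ∀ {a} → a ∈ p → w a ≤ w m

  heaviest : ∀ {p} s → size p ℕ.≤ s → Nonempty p → ∃[ m ] (m ∈ p × Heaviest m p)
  heaviest {p} s size≤ (a , a∈p) with nonempty? (p ∖ a)
  ... | no p∖a=∅ = a , a∈p , λ {b} b∈p → case b Fin.≟ a of λ where
    (yes ≡.refl) → ≤-refl
    (no b≢a)     → contradiction (b , ∈∖ {p = p} b∈p b≢a) p∖a=∅
  heaviest {p} zero size≤ (a , a∈p) | yes _ = contradiction (ℕ.≤-trans (nonempty⇒size (a , a∈p)) size≤) λ ()
  heaviest {p} (suc s) size≤ (a , a∈p) | yes p∖a≠∅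
    with m , m∈ , m-max ← heaviest {p ∖ a} s (ℕ.≤-pred (≡.subst (ℕ._≤ suc s) (size-remove {p = p} a∈p) size≤)) p∖a≠∅
    with total (w a) (w m)
  ... | inj₁ a≤m = m , ∈∖⁻ˡ {p = p} m∈ , λ {b} b∈p → case b Fin.≟ a of λ where
    (yes ≡.refl) → a≤m
    (no b≢a)     → m-max (∈∖ {p = p} b∈p b≢a)
  ... | inj₂ m≤a = a , a∈p , λ {b} b∈p → case b Fin.≟ a of λ where
    (yes ≡.refl) → ≤-refl
    (no b≢a)     → ≤-trans (m-max (∈∖ {p = p} b∈p b≢a)) m≤a

  -- Any test that isolates a single key acts on `p` like the equal-to test for that key, up to
  -- exchanging the answers. With `tight-via` it may therefore be replaced by that equal-to test.
  part-only : ∀ {p : KeySet n} {a} τ c → (∀ {k} → k ∈ part τ c p → k ≡ a) → a ∈ part τ c p →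
              (part ⟨= a ⟩ true p ≐ part τ c p) × (part ⟨= a ⟩ false p ≐ part τ (not c) p)
  part-only {p} {a} τ c all≡a a∈
    = ≐-intro (λ {k} k∈ → ≡.subst (_∈ part τ c p) (≡.sym (only⇒≡ {a = a} (∧⇒ʳ {p k} k∈))) a∈)
              (λ {k} k∈ → ∧-intro (∈-part⁻ˡ τ c {p} k∈) (≡.subst (_∈ only a) (≡.sym (all≡a k∈)) (only-self a)))
    , ≐-intro (λ {k} k∈ → ∈-part⁺ τ {not c} {p} (∧⇒ˡ k∈) (τk≡ k∈))
              (λ {k} k∈ → ∈∖ {p = p} (∈-part⁻ˡ τ (not c) {p} k∈)
                λ { ≡.refl → b≢not-b (∈-part⁻ʳ τ c {p} a∈) (∈-part⁻ʳ τ (not c) {p} k∈) })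
    where
    τk≡ : ∀ {k} → k ∈ part ⟨= a ⟩ false p → answer τ k ≡ not c
    τk≡ {k} k∈ with ≡-or-≡not (answer τ k) c
    ... | inj₂ ≡not = ≡not
    ... | inj₁ ≡c   = contradiction (all≡a (∈-part⁺ τ {c} {p} (∧⇒ˡ k∈) ≡c)) (∈∖⁻ʳ {p = p} k∈)

  W-part-only : ∀ {k p} → k ∈ p → W (part ⟨= k ⟩ true p) ≈ w k
  W-part-only {k} {p} k∈p = trans (W-cong pointwise) (Σ-only k w)
    where
    pointwise : part ⟨= k ⟩ true p ≐ only k
    pointwise = ≐-intro (λ {l} → ∧⇒ʳ {p l}) λ {l} l∈ → ∧-intro (≡.subst (_∈ p) (≡.sym (only⇒≡ {a = k} l∈)) k∈p) l∈

  -- Along a path of an optimal tree the weight that a test separates from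
  -- key k dominates w k, by rotating the next test on the path upwards.
  side-weight : ∀ s τ x {p k} → size p ℕ.≤ s → Tight τ p → Splits τ p → k ∈ part τ x p →
                w k ≤ W (part τ (not x) p) ⊎ (∀ {l} → l ∈ part τ x p → l ≡ k)
  side-weight s τ x {p} {k} size≤ tight-τ splits-τ k∈A with 2 ℕ.≤? size (part τ x p)
  ... | no ≱2 = inj₂ λ l∈A → size≤1⇒≡ {p = part τ x p} (ℕ.≤-pred (ℕ.≰⇒> ≱2)) l∈A k∈A
  side-weight zero τ x {p} {k} size≤ tight-τ splits-τ k∈A | yes ≥2 =
    contradiction (ℕ.≤-trans (nonempty⇒size {p = p} (k , ∈-part⁻ˡ τ x {p} k∈A)) size≤) λ ()
  side-weight (suc s) τ x {p} {k} size≤ tight-τ splits-τ k∈A | yes ≥2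
    with σ , tight-σ , splits-σ ← ∃-tight (part τ x p) ≥2
    with c , σ-const ← splits⇒const τ σ x {p} splits-σ
    with side-weight s σ (answer σ k) (ℕ.≤-pred (ℕ.<-≤-trans
        (size-part< τ {p} (proj₁ splits-τ) (proj₂ splits-τ) x) size≤))
           tight-σ splits-σ (∈-part⁺ σ {p = part τ x p} k∈A ≡.refl)
  ... | inj₁ w≤other = inj₁ (≤-trans (w≤ (not c)) (rotate τ x σ c {p} σ-const tight-τ tight-σ))
    where
    -- The rotation bounds only the weight of the side `not c` of σ. Either `k` lies there, or that
    -- is the side opposite to `k`, which outweighs `k` by induction.
    w≤ : ∀ d → w k ≤ W (part σ d (part τ x p))
    w≤ d with ≡-or-≡not d (answer σ k)
    ... | inj₁ ≡.refl = w≤W {k} {part σ (answer σ k) (part τ x p)} (∈-part⁺ σ {p = part τ x p} k∈A ≡.refl)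
    ... | inj₂ ≡.refl = w≤other
  -- If `k` is alone on its side of σ, that side might be the one the rotation does not bound. So σ
  -- is replaced by `⟨= k ⟩`, whose answer is no on the whole opposite side of τ, and the rotation
  -- bounds `w k` directly.
  ... | inj₂ alone with eq-yes , eq-no ← part-only {part τ x p} σ (answer σ k) alone
      (∈-part⁺ σ {p = part τ x p} k∈A ≡.refl) =
    inj₁ (≤-respˡ (W-part-only {k} {part τ x p} k∈A)
      (rotate τ x ⟨= k ⟩ false {p} avoids-k tight-τ
          (tight-via σ (answer σ k) ⟨= k ⟩ {part τ x p} eq-yes eq-no tight-σ)))
    where
    avoids-k : ∀ {l} → answer τ l ≡ not x → answer ⟨= k ⟩ l ≡ false
    avoids-k {l} τl≡ = dec-false (l Fin.≟ k) λ { ≡.refl → b≢not-b (∈-part⁻ʳ τ x {p} k∈A) τl≡ }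

  eq-splits : ∀ {p : KeySet n} {k} → Splits ⟨= k ⟩ p → k ∈ p
  eq-splits {p} {k} ((l , l∈) , _) = ≡.subst (_∈ p) (only⇒≡ {a = k} (∧⇒ʳ {p l} l∈)) (∧⇒ˡ l∈)

  -- A heaviest key `m` other than `k` lies on the no-side of `⟨= k ⟩`. By `side-weight` either
  -- `w m` is at most `w k`, so that `k` is itself heaviest, or only `k` and `m` are present and
  -- testing for either one splits them in the same way.
  tight⇒heaviest : ∀ {k p} → Tight ⟨= k ⟩ p → Splits ⟨= k ⟩ p →
                   ∃[ m ] (m ∈ p × Heaviest m p × Tight ⟨= m ⟩ p)
  tight⇒heaviest {k} {p} tight splits
    with k∈p ← eq-splits {p} {k} splits
    with m , m∈p , m-max ← heaviest {p} (size p) ℕ.≤-refl (k , k∈p)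
    with m Fin.≟ k
  ... | yes ≡.refl = m , m∈p , m-max , tight
  ... | no m≢k with side-weight (size p) ⟨= k ⟩ false {p} {m} ℕ.≤-refl tight splits (∈∖ {p = p} m∈p m≢k)
  ...   | inj₁ w≤ = k , k∈p , (λ a∈p → ≤-trans (m-max a∈p) (≤-respʳ (W-part-only {k} {p} k∈p) w≤)) , tight
  ...   | inj₂ alone with eq-yes , eq-no ← part-only {p} ⟨= k ⟩ false alone (∈∖ {p = p} m∈p m≢k) =
    m , m∈p , m-max , tight-via ⟨= k ⟩ false ⟨= m ⟩ {p} eq-yes eq-no tight

  W-small : ∀ {p ε} → 0# ≤ ε → (∀ {a b} → a ∈ p → b ∈ p → a ≡ b) → (∀ {a} → a ∈ p → w a ≤ ε) → W p ≤ ε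
  W-small {p} 0≤ε all≡ w≤ε with nonempty? p
  ... | no p=∅ = ≤-respˡ (sym (Σ-empty {p = p} w (¬nonempty⇒empty p=∅))) 0≤ε
  ... | yes (a , a∈p) = ≤-respˡ (sym (trans (Σ-remove {p = p} w a∈p)
          (trans (+-congˡ (Σ-empty {p = p ∖ a} w rest)) (+-identityʳ _)))) (w≤ε a∈p)
    where
    rest : ∀ k → (p ∖ a) k ≡ false
    rest = ¬nonempty⇒empty λ (b , b∈) → ∈∖⁻ʳ {p = p} b∈ (all≡ (∈∖⁻ˡ {p = p} b∈) a∈p)

  module Median (μ : Test n) where

    -- The cost of asking `μ` first, without the charge for `μ` itself.
    split-cost : KeySet n → Carrier
    split-cost p = o (part μ true p) + o (part μ false p)

    half : Bool → KeySet n → Carrier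
    half d p = W (part μ d p)

    split-cost-parts : ∀ d p → split-cost p ≈ o (part μ d p) + o (part μ (not d) p)
    split-cost-parts true  p = refl
    split-cost-parts false p = +-comm _ _

    o-half : ∀ d τ c p →
      o (part μ d p) ≤ half d p + (o (part μ d (part τ c p)) + o (part μ d (part τ (not c) p)))
    o-half d τ c p = ≤-respʳ (+-congˡ (+-cong (o-cong (part-comm τ μ c d p)) (o-cong (part-comm τ μ (not c) d p))))
      (o-step τ c (part μ d p))

    -- An optimal tree for `p` can be used on either side of `μ` separately, and no key is charged
    -- more than before. The induction follows the tests of such a tree.
    split-cost-≤ : ∀ s p → size p ℕ.≤ s → split-cost p ≤ o p
    split-cost-≤ s p size≤ with 2 ℕ.≤? size p
    ... | no ≱2 = ≤-respˡ (sym (trans (+-cong (small true) (small false)) (+-identityˡ 0#))) (0≤o p)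
      where
      small : ∀ d → o (part μ d p) ≈ 0#
      small d = o-small {part μ d p} λ a∈ b∈ →
        size≤1⇒≡ {p = p} (ℕ.≤-pred (ℕ.≰⇒> ≱2)) (∈-part⁻ˡ μ d {p} a∈) (∈-part⁻ˡ μ d {p} b∈)
    split-cost-≤ zero p size≤ | yes ≥2 = contradiction (ℕ.≤-trans ≥2 size≤) λ ()
    split-cost-≤ (suc s) p size≤ | yes ≥2 with τ , tight , yes≠∅ , no≠∅ ← ∃-tight p ≥2 =
      balance (+-mono-≤ (+-mono-≤ tight (+-mono-≤ (o-half true τ true p) (o-half false τ true p)))
                        (+-mono-≤ (smaller true) (smaller false)))
        (trans
          (solve 11 (λ h₀ h₁ y z p₀ p₁ y₀ y₁ z₀ z₁ op →
            (p₁ ⊞ p₀) ⊞ ((op ⊞ ((h₁ ⊞ (y₁ ⊞ z₁)) ⊞ (h₀ ⊞ (y₀ ⊞ z₀)))) ⊞ (y ⊞ z)) ⊜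
            op ⊞ ((((h₁ ⊞ h₀) ⊞ (y ⊞ z)) ⊞ (p₁ ⊞ p₀)) ⊞ ((y₁ ⊞ y₀) ⊞ (z₁ ⊞ z₀)))) refl
            (half false p) (half true p) (o Y) (o N) (o (part μ false p)) (o (part μ true p))
            (o (part μ false Y)) (o (part μ true Y)) (o (part μ false N)) (o (part μ true N)) (o p))
          (+-congˡ (+-congʳ (+-congʳ (+-congʳ (sym (W-part μ p)))))))
      where
      Y = part τ true p
      N = part τ false p
      smaller : ∀ c → split-cost (part τ c p) ≤ o (part τ c p)
      smaller c = split-cost-≤ s (part τ c p) (ℕ.≤-pred (ℕ.<-≤-trans (size-part< τ {p} yes≠∅ no≠∅ c) size≤))

    -- If μ is asked first, then τ need not be asked on a side of μ on which its
    -- answer is constant.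
    saving : ∀ τ b {p d c} → (∀ {k} → answer μ k ≡ d → answer τ k ≡ c) → Tight τ p →
             (split-cost p + half d p) + o (part τ b p) ≤ o p + split-cost (part τ b p)
    saving τ b {p} {d} {c} τ-const tight =
      ≤-respˡ (+-congʳ (+-congʳ (sym (split-cost-parts d p)))) $ ≤-respʳ (+-congˡ (sym (split-cost-parts d X))) $
      balance (+-mono-≤ (+-mono-≤ h₁ h₂) (+-mono-≤ h₃ h₄))
        (solve 11 (λ Wd Wd′ op X O pd pd′ X₀ X₁ O₀ O₁ →
          ((((pd ⊞ pd′) ⊞ Wd) ⊞ X) ⊞ ((op ⊞ (Wd′ ⊞ (X₁ ⊞ O₁))) ⊞ ((X₀ ⊞ O₀) ⊞ O))) ⊜
          ((op ⊞ (X₀ ⊞ X₁)) ⊞ ((((Wd ⊞ Wd′) ⊞ (X ⊞ O)) ⊞ pd′) ⊞ (pd ⊞ (O₀ ⊞ O₁)))))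
          refl (half d p) (half (not d) p) (o p) (o X) (o O) (o (part μ d p)) (o (part μ (not d) p))
          (o (part μ d X)) (o (part μ (not d) X)) (o (part μ d O)) (o (part μ (not d) O)))
      where
      X = part τ b p
      O = part τ (not b) p
      h₁ : (half d p + half (not d) p) + (o X + o O) ≤ o p
      h₁ = ≤-respˡ (+-congʳ (W-parts μ d p)) (tight-parts τ b {p} tight)
      h₂ : o (part μ (not d) p) ≤ half (not d) p + (o (part μ (not d) X) + o (part μ (not d) O))
      h₂ = o-half (not d) τ b p
      h₃ : o (part μ d p) ≤ o (part μ d X) + o (part μ d O)
      -- On side `d` of `μ` the test is answered `c` throughout, so one of the two sets is all of
      -- `part μ d p`. Here the charge for asking τ on that side, `half d p`, is saved.
      h₃ with ≡-or-≡not c b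
      ... | inj₁ ≡.refl = ≤-trans (≤-reflexive (sym (o-cong same))) (x≤x+y (0≤o (part μ d O)))
        where
        same : part μ d X ≐ part μ d p
        same k = ≡.trans (≡.sym (part-comm τ μ c d p k))
            (part-id τ c {part μ d p} (λ k∈ → τ-const (∈-part⁻ʳ μ d {p} k∈)) k)
      ... | inj₂ ≡.refl = ≤-trans (≤-reflexive (sym (o-cong same))) (x≤y+x (0≤o (part μ d X)))
        where
        same : part μ d O ≐ part μ d p
        same k = ≡.trans (≡.sym (part-comm τ μ c d p k))
            (part-id τ c {part μ d p} (λ k∈ → τ-const (∈-part⁻ʳ μ d {p} k∈)) k)
      h₄ : o (part μ d O) + o (part μ (not d) O) ≤ o O
      h₄ = ≤-respˡ (split-cost-parts d O) (split-cost-≤ (size O) O ℕ.≤-refl)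

    half-part : ∀ d τ c p → half d p ≤ half d (part τ c p) + W (part τ (not c) p)
    half-part d τ c p = ≤-respˡ (sym (W-parts τ c (part μ d p)))
      (+-mono-≤ (≤-reflexive (W-cong (part-comm τ μ c d p)))
                (≤-respˡ (W-cong (part-comm μ τ d (not c) p)) (W-part-≤ μ d (part τ (not c) p))))

-- The total weight below an equal-to root

module HeavyRoots (K : OrderedRing) {n} (w : Fin n → OrderedRing.Carrier K)
  (1≤w : ∀ k → OrderedRing._≤_ K (OrderedRing.1# K) (w k)) (k₀ : Fin n) where
  open Order K
  open OptimalTrees K w 1≤w k₀
  open Structure K w 1≤w k₀
  open HeaviestFirst K w 1≤w k₀

  times : ∀ {m} → ℕ → _ → _
  times {m} zero    e = ⓪ {m}
  times {m} (suc c) e = e ⊞ times {m} c e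

  crossing : (P : ℕ → Carrier) (x : Carrier) → ∀ m → P 0 ≤ x → ¬ P m ≤ x →
             ∃[ l ] (l ℕ.< m × P l ≤ x × ¬ P (suc l) ≤ x)
  crossing P x zero    P0≤x P0≰x = contradiction P0≤x P0≰x
  crossing P x (suc m) P0≤x Pm≰x with P m ≤? x
  ... | yes Pm≤x = m , ℕ.≤-refl , Pm≤x , Pm≰x
  ... | no  Pm≰x′ with l , l<m , rest ← crossing P x m P0≤x Pm≰x′ = l , ℕ.m<n⇒m<1+n l<m , rest

  ≰⇒≥ : ∀ {x y} → ¬ x ≤ y → y ≤ x
  ≰⇒≥ {x} {y} x≰y with total x y
  ... | inj₁ x≤y = contradiction x≤y x≰y
  ... | inj₂ y≤x = y≤x

  -- The substitute for dividing by two, valid because the order is total.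
  halve-≤ : ∀ {x y} → x + x ≤ y + y → x ≤ y
  halve-≤ {x} {y} 2x≤2y with total x y
  ... | inj₁ x≤y = x≤y
  ... | inj₂ y≤x = balance (+-mono-≤ 2x≤2y y≤x) (solve 2 (λ x y → x ⊞ ((y ⊞ y) ⊞ x) ⊜ y ⊞ ((x ⊞ x) ⊞ y)) refl x y)

  below : ℕ → KeySet n → KeySet n
  below m p k = p k ∧ does (toℕ k ℕ.<? m)

  -- `x` is the key at which the doubled weight of the initial segments passes `W p`. The keys from
  -- `x` on weigh at least half; those before `x` fall short of half by at most the weight of `x`,
  -- whence the slack ε on each doubled half.
  median : ∀ {p ε} → Nonempty p → (∀ {a} → a ∈ p → w a ≤ ε) →
           ∃[ x ] (∀ d → W p ≤ (W (part ⟨< x ⟩ d p) + W (part ⟨< x ⟩ d p)) + (ε + ε))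
  median {p} {ε} (a , a∈p) w≤ε with crossing (λ m → W (below m p) + W (below m p)) (W p) n P0 Pn
    where
    P0 : W (below 0 p) + W (below 0 p) ≤ W p
    P0 = ≤-respˡ (sym (trans (+-cong W0 W0) (+-identityˡ 0#))) (0≤W p)
      where W0 = Σ-empty {p = below 0 p} w λ k → Bool.∧-zeroʳ (p k)
    Pn : ¬ W (below n p) + W (below n p) ≤ W p
    Pn 2W≤W = 1≰0 (≤-trans (1≤w a) (≤-trans (w≤W {a} {p} a∈p)
      (balance (≤-respˡ (+-cong all all) 2W≤W) (solve 1 (λ W → W ⊞ W ⊜ ⓪ ⊞ (W ⊞ W)) refl (W p)))))
      where
      all : W (below n p) ≈ W p
      all = W-cong λ k → ≡.trans (≡.cong (p k ∧_) (dec-true (toℕ k ℕ.<? n) (Fin.toℕ<n k))) (Bool.∧-identityʳ _)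
  ... | m , m<n , Pm , ¬Psm = x , λ where
          true  → ≤-trans (≰⇒≥ ¬Psm) (≤-trans (+-mono-≤ step step)
                    (≤-reflexive (solve 2 (λ h e → (h ⊞ e) ⊞ (h ⊞ e) ⊜ (h ⊞ h) ⊞ (e ⊞ e)) refl _ _)))
          false → ≤-trans (balance {x = W (part ⟨< x ⟩ true p) + W (part ⟨< x ⟩ true p)}
              (≤-respˡ (+-cong below≈ below≈) Pm)
                    (trans (+-cong (W-part ⟨< x ⟩ p) (W-part ⟨< x ⟩ p))
                      (solve 2 (λ h f → (h ⊞ f) ⊞ (h ⊞ f) ⊜ (f ⊞ f) ⊞ (h ⊞ h)) refl _ _)))
                    (x≤x+y (+-nonNegative 0≤ε 0≤ε))
    where
    x : Fin n
    x = fromℕ< m<n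
    0≤ε : 0# ≤ ε
    0≤ε = ≤-trans (0≤w a) (w≤ε a∈p)
    below≈ : W (below m p) ≈ W (part ⟨< x ⟩ true p)
    below≈ = W-cong λ k → ≡.cong (λ m → p k ∧ does (toℕ k ℕ.<? m)) (≡.sym (Fin.toℕ-fromℕ< m<n))
    step : W (below (suc m) p) ≤ W (part ⟨< x ⟩ true p) + ε
    step = ≤-respˡ (sym (trans (Σ-split q (only x) w) (+-comm _ _)))
      (+-mono-≤ (Σ-⊆ {p = q ∩ ∁ (only x)} {part ⟨< x ⟩ true p} 0≤w others)
                (W-small {q ∩ only x} 0≤ε
                  (λ {a} {b} a∈ b∈ → ≡.trans (only⇒≡ {a = x} (∧⇒ʳ {q a} a∈)) (≡.sym (only⇒≡ {a = x} (∧⇒ʳ {q b} b∈))))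
                  λ {a} a∈ → w≤ε (∧⇒ˡ {p a} (∧⇒ˡ a∈))))
      where
      q = below (suc m) p
      others : ∀ {k} → k ∈ q ∩ ∁ (only x) → k ∈ part ⟨< x ⟩ true p
      others {k} k∈ = ∧-intro (∧⇒ˡ (∧⇒ˡ k∈)) (dec-true (k Fin.<? x) (≡.subst (toℕ k ℕ.<_) (≡.sym (Fin.toℕ-fromℕ< m<n))
        (ℕ.≤∧≢⇒< (ℕ.≤-pred (does⇒ (toℕ k ℕ.<? suc m) (∧⇒ʳ {p k} (∧⇒ˡ k∈))))
          λ k≡m → ∈∁only⇒≢ (∧⇒ʳ {q k} k∈) (Fin.toℕ-injective (≡.trans k≡m (≡.sym (Fin.toℕ-fromℕ< m<n)))))))

  -- The three topmost tests of an optimal tree whose root is light each split off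
  -- little weight.  Asking a median test μ first makes each of them superfluous
  -- on one side of μ, hence for almost half of the weight.
  heavy-root : ∀ {m p} → m ∈ p → Heaviest m p → Tight ⟨= m ⟩ p → W p ≤ 12 · w m
  heavy-root {m} {p} m∈p m-max tight with median {p} (m , m∈p) m-max
  ... | x , W≤half = bound
    where
    open Median ⟨< x ⟩
    ε = w m
    0≤ε = 0≤w m
    p₁ = part ⟨= m ⟩ false p
    W-p : W p ≤ ε + W p₁
    W-p = ≤-reflexive (trans (W-part ⟨= m ⟩ p) (+-congʳ (W-part-only {m} {p} m∈p)))
    -- When fewer than two keys are left after one or two tests, there is no further test to save;
    -- but then `W p` is at most 2ε or 3ε.
    small : ∀ c {q} → (∀ {k} → k ∈ q → k ∈ p) → ¬ 2 ℕ.≤ size q → W p ≤ c · ε + W q → c ℕ.< 12 → W p ≤ 12 · ε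
    small c {q} q⊆p ≱2 W≤ c<12 = ≤-trans W≤ (≤-trans (+-monoʳ-≤ _ W-q≤)
        (≤-respʳ rearr (x≤x+y (·-nonNegative (12 ℕ.∸ suc c) 0≤ε))))
      where
      W-q≤ : W q ≤ ε
      W-q≤ = W-small {q} 0≤ε (size≤1⇒≡ {p = q} (ℕ.≤-pred (ℕ.≰⇒> ≱2))) λ a∈ → m-max (q⊆p a∈)
      rearr : (c · ε + ε) + (12 ℕ.∸ suc c) · ε ≈ 12 · ε
      rearr = trans (+-congʳ (+-comm _ _)) (trans (sym (×-homo-+ ε (suc c) (12 ℕ.∸ suc c)))
        (reflexive (≡.cong (_· ε) (ℕ.m+[n∸m]≡n c<12))))
        where open import Algebra.Properties.Monoid.Mult +-monoid using (×-homo-+)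
    bound : W p ≤ 12 · ε
    bound with 2 ℕ.≤? size p₁
    ... | no ≱2 = small 1 {p₁} (λ {k} → ∧⇒ˡ) ≱2 (≤-trans W-p (≤-reflexive (+-congʳ (sym (+-identityʳ ε))))) (ℕ.s≤s (ℕ.s≤s ℕ.z≤n))
    ... | yes ≥2 with ∃-tight p₁ ≥2
    ...   | σ , tight-σ , splits-σ with splits⇒const ⟨= m ⟩ σ false {p} splits-σ
    ...     | c , σ-const = with-third (2 ℕ.≤? size p₂)
      where
      p₂ = part σ c p₁
      light : W (part σ (not c) p₁) ≤ ε
      light = ≤-respʳ (W-part-only {m} {p} m∈p) (rotate ⟨= m ⟩ false σ c {p} σ-const tight tight-σ)
      W-p₁ : W p₁ ≤ W p₂ + ε
      W-p₁ = ≤-respˡ (sym (W-parts σ c p₁)) (+-monoʳ-≤ _ light)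
      with-third : Dec (2 ℕ.≤ size p₂) → W p ≤ 12 · ε
      with-third (no ≱2) = small 2 {p₂} (λ {k} k∈ → ∧⇒ˡ {p k} (∧⇒ˡ k∈)) ≱2
        (balance (+-mono-≤ W-p W-p₁) (solve 4 (λ W e a b → W ⊞ ((e ⊞ a) ⊞ (b ⊞ e)) ⊜ (times 2 e ⊞ b) ⊞ (W ⊞ a))
            refl (W p) ε (W p₁) (W p₂)))
        (ℕ.s≤s (ℕ.s≤s (ℕ.s≤s ℕ.z≤n)))
      with-third (yes ≥2) with ∃-tight p₂ ≥2
      ... | ρ , tight-ρ , _ with noncrossing ⟨< x ⟩ ⟨= m ⟩ | noncrossing ⟨< x ⟩ σ | noncrossing ⟨< x ⟩ ρ
      ...   | d , _ , m-const | d₁ , _ , σ-const | d₂ , _ , ρ-const =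
        -- The sum of savings is doubled and compared with three copies of `W p`. Each use of
        -- `W≤half` loses 2ε. Passing from `p` to `p₁` loses 2ε more for the second test, and
        -- passing on to `p₂` loses 4ε more in all for the third. Thus 3W is at most 2W + (2 + 4 +
        -- 6)ε.
        balance (+-mono-≤ (+-mono-≤ sum-of-savings sum-of-savings)
                  (+-mono-≤ (+-mono-≤ (W≤half d) (+-mono-≤ (W≤half d₁) (+-mono-≤ (drop d₁) (drop d₁))))
                            (+-mono-≤ (W≤half d₂) (+-mono-≤ (+-mono-≤ (drop d₂) (drop₁ d₂))
                                (+-mono-≤ (drop d₂) (drop₁ d₂))))))
          (solve 8 (λ W e h₀ h₁ h₁′ h₂ h₂′ h₂″ →
              W ⊞ (((W ⊞ W)) ⊞ ((((h₀ ⊞ h₀) ⊞ (e ⊞ e)) ⊞ (((h₁ ⊞ h₁) ⊞ (e ⊞ e)) ⊞ ((h₁′ ⊞ e) ⊞ (h₁′ ⊞ e))))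
                ⊞ (((h₂ ⊞ h₂) ⊞ (e ⊞ e)) ⊞ (((h₂′ ⊞ e) ⊞ (h₂″ ⊞ e)) ⊞ ((h₂′ ⊞ e) ⊞ (h₂″ ⊞ e))))))
              ⊜ times 12 e ⊞ ((((h₀ ⊞ (h₁′ ⊞ h₂″)) ⊞ (h₀ ⊞ (h₁′ ⊞ h₂″)))) ⊞ ((W ⊞ (W ⊞ (h₁ ⊞ h₁)))
                ⊞ (W ⊞ ((h₂ ⊞ h₂′) ⊞ (h₂ ⊞ h₂′))))))
            refl (W p) ε (half d p) (half d₁ p) (half d₁ p₁) (half d₂ p) (half d₂ p₁) (half d₂ p₂))
        where
        drop : ∀ d → half d p ≤ half d p₁ + ε
        drop d = ≤-trans (half-part d ⟨= m ⟩ false p) (+-monoʳ-≤ _ (≤-reflexive (W-part-only {m} {p} m∈p)))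
        drop₁ : ∀ d → half d p₁ ≤ half d p₂ + ε
        drop₁ d = ≤-trans (half-part d σ c p₁) (+-monoʳ-≤ _ light)
        p₃ = part ρ true p₂
        -- The three savings telescope along `p`, `p₁`, `p₂`, `p₃`. The ends are closed by asking
        -- `μ` first at the price `W p`, and by `split-cost-≤` for `p₃`. Either side of ρ could
        -- serve as `p₃`.
        sum-of-savings : half d p + (half d₁ p₁ + half d₂ p₂) ≤ W p
        sum-of-savings =
          balance (+-mono-≤ (+-mono-≤ (saving ⟨= m ⟩ false {p} m-const tight) (saving σ c {p₁} σ-const tight-σ))
                            (+-mono-≤ (saving ρ true {p₂} ρ-const tight-ρ)
                                      (+-mono-≤ (split-cost-≤ (size p₃) p₃ ℕ.≤-refl) (o-step ⟨< x ⟩ true p))))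
            (solve 12 (λ h₀ h₁ h₂ W s₀ s₁ s₂ s₃ o₀ o₁ o₂ o₃ →
              (h₀ ⊞ (h₁ ⊞ h₂)) ⊞ (((o₀ ⊞ s₁) ⊞ (o₁ ⊞ s₂)) ⊞ ((o₂ ⊞ s₃) ⊞ (o₃ ⊞ (W ⊞ s₀)))) ⊜
              W ⊞ ((((s₀ ⊞ h₀) ⊞ o₁) ⊞ ((s₁ ⊞ h₁) ⊞ o₂)) ⊞ (((s₂ ⊞ h₂) ⊞ o₃) ⊞ (s₃ ⊞ o₀))))
              refl (half d p) (half d₁ p₁) (half d₂ p₂) (W p) (split-cost p) (split-cost p₁) (split-cost p₂)
              (split-cost p₃) (o p) (o p₁) (o p₂) (o p₃))

-- Intervals, ranks and states of the dynamic program

size-⊆ : ∀ {n} {p q : KeySet n} → (∀ {k} → k ∈ p → k ∈ q) → size p ℕ.≤ size q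
size-⊆ {p = p} {q} p⊆q = ≡.subst (size p ℕ.≤_) (≡.sym split) (ℕ.m≤m+n _ _)
  where
  split : size q ≡ size p ℕ.+ size (q ∩ ∁ p)
  split = ≡.trans (ℕΣ.Σ-split q p (const 1)) (≡.cong (ℕ._+ size (q ∩ ∁ p)) (ℕΣ.Σ-cong {p = q ∩ p} {p}
    (≐-intro (λ {k} k∈ → ∧⇒ʳ {q k} k∈) λ k∈p → ∧-intro (p⊆q k∈p) k∈p) λ _ → ≡.refl))

size-cong : ∀ {n} {p q : KeySet n} → p ≐ q → size p ≡ size q
size-cong {p = p} {q} p≐q = ℕΣ.Σ-cong {p = p} {q} p≐q λ _ → ≡.refl

inside : ∀ {n} → ℕ → ℕ → KeySet n
inside i j k = does (i ℕ.≤? toℕ k) ∧ does (toℕ k ℕ.<? j)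

∈-inside : ∀ {n i j} {k : Fin n} → i ℕ.≤ toℕ k → toℕ k ℕ.< j → k ∈ inside i j
∈-inside i≤k k<j = ∧-intro (dec-true (_ ℕ.≤? _) i≤k) (dec-true (_ ℕ.<? _) k<j)

inside⇒≤ : ∀ {n i j} {k : Fin n} → k ∈ inside i j → i ℕ.≤ toℕ k
inside⇒≤ {i = i} {k = k} k∈ = does⇒ (i ℕ.≤? toℕ k) (∧⇒ˡ k∈)

inside⇒< : ∀ {n i j} {k : Fin n} → k ∈ inside i j → toℕ k ℕ.< j
inside⇒< {i = i} {j} {k} k∈ = does⇒ (toℕ k ℕ.<? j) (∧⇒ʳ {does (i ℕ.≤? toℕ k)} k∈)

∉-inside-top : ∀ {n} i (k : Fin n) → inside i (toℕ k) k ≡ false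
∉-inside-top i k = ≡.trans (≡.cong (does (i ℕ.≤? toℕ k) ∧_) (dec-false (toℕ k ℕ.<? toℕ k) (ℕ.<-irrefl ≡.refl)))
                         (Bool.∧-zeroʳ _)

∉-inside-bottom : ∀ {n} (k : Fin n) j → inside (suc (toℕ k)) j k ≡ false
∉-inside-bottom k j = ≡.cong (_∧ does (toℕ k ℕ.<? j)) (dec-false (suc (toℕ k) ℕ.≤? toℕ k) (ℕ.<-irrefl ≡.refl))

∈-∪⁻ : ∀ {n} (p q : KeySet n) {k} → k ∈ p ∪ q → k ∈ p ⊎ k ∈ q
∈-∪⁻ p q {k} k∈ with p k
... | true  = inj₁ ≡.refl
... | false = inj₂ k∈

inside-snoc : ∀ {n i} {x : Fin n} → i ℕ.≤ toℕ x → inside i (suc (toℕ x)) ≐ inside i (toℕ x) ∪ only x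
inside-snoc {i = i} {x} i≤x = ≐-intro to from
  where
  to : ∀ {k} → k ∈ inside i (suc (toℕ x)) → k ∈ inside i (toℕ x) ∪ only x
  to {k} k∈ with k Fin.≟ x
  ... | yes ≡.refl = Bool.∨-zeroʳ _
  ... | no k≢x = ≡.trans (Bool.∨-identityʳ _) (∈-inside (inside⇒≤ {i = i} {suc (toℕ x)} k∈)
    (ℕ.≤∧≢⇒< (ℕ.≤-pred (inside⇒< {i = i} {suc (toℕ x)} k∈)) (k≢x ∘ Fin.toℕ-injective)))
  from : ∀ {k} → k ∈ inside i (toℕ x) ∪ only x → k ∈ inside i (suc (toℕ x))
  from {k} k∈ with ∈-∪⁻ (inside i (toℕ x)) (only x) {k} k∈
  ... | inj₁ k∈i = ∈-inside (inside⇒≤ {i = i} {toℕ x} k∈i) (ℕ.m<n⇒m<1+n (inside⇒< {i = i} {toℕ x} k∈i))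
  ... | inj₂ k∈o with ≡.refl ← only⇒≡ {a = x} {k} k∈o = ∈-inside i≤x ℕ.≤-refl

inside-cons : ∀ {n j} {x : Fin n} → toℕ x ℕ.< j → inside (toℕ x) j ≐ inside (suc (toℕ x)) j ∪ only x
inside-cons {j = j} {x} x<j = ≐-intro to from
  where
  to : ∀ {k} → k ∈ inside (toℕ x) j → k ∈ inside (suc (toℕ x)) j ∪ only x
  to {k} k∈ with k Fin.≟ x
  ... | yes ≡.refl = Bool.∨-zeroʳ _
  ... | no k≢x = ≡.trans (Bool.∨-identityʳ _) (∈-inside
    (ℕ.≤∧≢⇒< (inside⇒≤ {i = toℕ x} {j} k∈) (k≢x ∘ Fin.toℕ-injective ∘ ≡.sym)) (inside⇒< {i = toℕ x} {j} k∈))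
  from : ∀ {k} → k ∈ inside (suc (toℕ x)) j ∪ only x → k ∈ inside (toℕ x) j
  from {k} k∈ with ∈-∪⁻ (inside (suc (toℕ x)) j) (only x) {k} k∈
  ... | inj₁ k∈i = ∈-inside (ℕ.<⇒≤ (inside⇒≤ {i = suc (toℕ x)} {j} k∈i)) (inside⇒< {i = suc (toℕ x)} {j} k∈i)
  ... | inj₂ k∈o with ≡.refl ← only⇒≡ {a = x} {k} k∈o = ∈-inside ℕ.≤-refl x<j

inside-empty : ∀ {n} i (k : Fin n) → inside i i k ≡ false
inside-empty i k = Bool.¬-not λ k∈ → ℕ.<⇒≱ (inside⇒< {i = i} {i} k∈) (inside⇒≤ {i = i} {i} k∈)

size-inside : ∀ {n} i j → i ℕ.≤ j → j ℕ.≤ n → size (inside {n} i j) ≡ j ℕ.∸ i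
size-inside {n} i j i≤j j≤n = ≡.trans (≡.cong (size ∘ inside {n} i) (≡.sym j≡))
    (count (j ℕ.∸ i) (ℕ.≤-trans (ℕ.≤-reflexive j≡) j≤n))
  where
  j≡ : (j ℕ.∸ i) ℕ.+ i ≡ j
  j≡ = ℕ.m∸n+n≡m i≤j
  count : ∀ d → d ℕ.+ i ℕ.≤ n → size (inside {n} i (d ℕ.+ i)) ≡ d
  count zero    _ = ℕΣ.Σ-empty {p = inside i i} (const 1) (inside-empty i)
  count (suc d) d+i<n = ≡.trans
    (ℕΣ.Σ-insert {p = inside i (d ℕ.+ i)} {inside i (suc (d ℕ.+ i))} {x} (const 1)
      (≡.subst (λ m → inside i m x ≡ false) x≡ (∉-inside-top i x))
      (≡.subst (λ m → inside i (suc m) ≐ inside i m ∪ only x) x≡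
        (inside-snoc (ℕ.≤-trans (ℕ.m≤n+m i d) (ℕ.≤-reflexive (≡.sym x≡))))))
    (≡.cong suc (count d (ℕ.<⇒≤ d+i<n)))
    where
    x : Fin n
    x = fromℕ< d+i<n
    x≡ : toℕ x ≡ d ℕ.+ i
    x≡ = Fin.toℕ-fromℕ< d+i<n

-- Bounding the number of equal-to tests on a path

module Budgets (K : OrderedRing) {n} (w : Fin n → OrderedRing.Carrier K)
  (1≤w : ∀ k → OrderedRing._≤_ K (OrderedRing.1# K) (w k)) (k₀ : Fin n) where
  open Order K
  open OptimalTrees K w 1≤w k₀
  open Structure K w 1≤w k₀
  open HeaviestFirst K w 1≤w k₀
  open HeavyRoots K w 1≤w k₀
  open Algebra.Properties.Monoid.Mult +-monoid using (×-homo-+)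

  pow₂ : ℕ → Carrier
  pow₂ l = (2 ℕ.^ l) · 1#

  pow₂-suc : ∀ l → pow₂ (suc l) ≈ pow₂ l + pow₂ l
  pow₂-suc l = trans (×-homo-+ 1# (2 ℕ.^ l) (2 ℕ.^ l ℕ.+ 0))
    (+-congˡ (reflexive (≡.cong (_· 1#) (ℕ.+-identityʳ (2 ℕ.^ l)))))

  ·-mono-≤ : ∀ c {x y} → x ≤ y → c · x ≤ c · y
  ·-mono-≤ zero    x≤y = ≤-refl
  ·-mono-≤ (suc c) x≤y = +-mono-≤ x≤y (·-mono-≤ c x≤y)

  -- Budget p b bounds by b the number of equal-to tests on a path of an optimal
  -- tree for p.  In the second case all weights in p are at most 2ˡ, and after
  -- at most c further equal-to tests they are at most 2ˡ⁻¹.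
  Budget : KeySet n → ℕ → Set
  Budget p b = size p ℕ.< b ⊎
    (∃[ l ] ∃[ c ] ((∀ {a} → a ∈ p → w a ≤ pow₂ l) × W p + W p ≤ c · pow₂ l × 24 ℕ.* l ℕ.+ c ℕ.< b))

  budget-⊆ : ∀ {p q a b} → (∀ {k} → k ∈ p → k ∈ q) → a ℕ.≤ b → Budget q a → Budget p b
  budget-⊆ p⊆q a≤b (inj₁ size<) = inj₁ (ℕ.≤-<-trans (size-⊆ p⊆q) (ℕ.<-≤-trans size< a≤b))
  budget-⊆ {p} {q} p⊆q a≤b (inj₂ (l , c , w≤ , W≤ , <a)) =
    inj₂ (l , c , w≤ ∘ p⊆q , ≤-trans (+-mono-≤ Wp≤Wq Wp≤Wq) W≤ , ℕ.<-≤-trans <a a≤b)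
    where Wp≤Wq = Σ-⊆ {p = p} {q} 0≤w p⊆q

  -- The quantity 24l + c is a potential. If 2w(m) ≥ 2ˡ, removing `m` lowers 2W by at least 2ˡ and
  -- `c` by one. Otherwise `heavy-root` gives 2W ≤ 24w(m) ≤ 24 · 2ˡ⁻¹, so the pair (l, c) becomes (l
  -- - 1, 24); the potential still drops, because `c` was positive. The case l = 0 cannot be light,
  -- as weights are at least 1.
  budget-eq : ∀ {m p b} → m ∈ p → Heaviest m p → Tight ⟨= m ⟩ p → Budget p (suc b) → Budget (p ∖ m) b
  budget-eq {p = p} m∈p _ _ (inj₁ size<) =
    inj₁ (ℕ.≤-pred (≡.subst (ℕ._< _) (size-remove {p = p} m∈p) size<))
  budget-eq {m} {p} {b} m∈p m-max tight (inj₂ (l , c , w≤ , W≤ , <b)) with total (w m + w m) (pow₂ l)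
  ... | inj₁ light = lighter l w≤ W≤ <b light
    where
    1≤c : ∀ c → W p + W p ≤ c · pow₂ l → 1 ℕ.≤ c
    1≤c zero    W≤0 = contradiction (≤-trans (≤-trans (1≤w m) (≤-trans (w≤W {m} {p} m∈p) (x≤x+y (0≤W p)))) W≤0) 1≰0
    1≤c (suc c) _   = ℕ.s≤s ℕ.z≤n
    lighter : ∀ l → (∀ {a} → a ∈ p → w a ≤ pow₂ l) → W p + W p ≤ c · pow₂ l → 24 ℕ.* l ℕ.+ c ℕ.< suc b →
              w m + w m ≤ pow₂ l → Budget (p ∖ m) b
    lighter zero _ _ _ 2w≤1 = contradiction
      (balance (≤-trans (+-mono-≤ (1≤w m) (1≤w m)) 2w≤1)
        (solve 1 (λ x → x ⊞ (x ⊞ ⓪) ⊜ ⓪ ⊞ (x ⊞ x)) refl 1#)) 1≰0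
    lighter (suc l) _ _ <b 2w≤ = inj₂ (l , 24 , (λ a∈ → ≤-trans (m-max (∈∖⁻ˡ {p = p} a∈)) w≤half) , W≤′ , <b′)
      where
      w≤half : w m ≤ pow₂ l
      w≤half = halve-≤ (≤-respʳ (pow₂-suc l) 2w≤)
      W-≤12 : W (p ∖ m) ≤ 12 · pow₂ l
      W-≤12 = ≤-trans (Σ-⊆ {p = p ∖ m} {p} 0≤w (∈∖⁻ˡ {p = p}))
          (≤-trans (heavy-root m∈p m-max tight) (·-mono-≤ 12 w≤half))
      W≤′ : W (p ∖ m) + W (p ∖ m) ≤ 24 · pow₂ l
      W≤′ = ≤-trans (+-mono-≤ W-≤12 W-≤12) (≤-reflexive (sym (×-homo-+ (pow₂ l) 12 12)))
      <b′ : 24 ℕ.* l ℕ.+ 24 ℕ.< b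
      <b′ = ℕ.≤-trans (ℕ.s≤s (ℕ.≤-reflexive (≡.trans (ℕ.+-comm (24 ℕ.* l) 24) (≡.sym (ℕ.*-suc 24 l)))))
        (ℕ.≤-trans (ℕ.m<m+n (24 ℕ.* suc l) (1≤c c W≤)) (ℕ.≤-pred <b))
  ... | inj₂ heavy = heavier c W≤ <b
    where
    heavier : ∀ c → W p + W p ≤ c · pow₂ l → 24 ℕ.* l ℕ.+ c ℕ.< suc b → Budget (p ∖ m) b
    heavier zero    W≤0 _ = contradiction (≤-trans (≤-trans (1≤w m) (≤-trans (w≤W {m} {p} m∈p) (x≤x+y (0≤W p))))
        W≤0) 1≰0
    heavier (suc c) W≤ <b = inj₂ (l , c , w≤ ∘ ∈∖⁻ˡ {p = p} , W≤′ , ℕ.≤-pred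
        (≡.subst (ℕ._< suc b) (ℕ.+-suc (24 ℕ.* l) c) <b))
      where
      W-p = Σ-remove {p = p} w m∈p
      W≤′ : W (p ∖ m) + W (p ∖ m) ≤ c · pow₂ l
      W≤′ = balance (+-mono-≤ (≤-respˡ (+-cong W-p W-p) W≤) heavy)
        (solve 4 (λ W x u cu → (W ⊞ W) ⊞ ((u ⊞ cu) ⊞ (x ⊞ x)) ⊜ cu ⊞ (((x ⊞ W) ⊞ (x ⊞ W)) ⊞ u)) refl
          (W (p ∖ m)) (w m) (pow₂ l) (c · pow₂ l))

-- Ranks by weight and removal of heaviest keys

module Ranks (K : OrderedRing) {n} (w : Fin n → OrderedRing.Carrier K)
  (w-injective : Injective _≡_ (OrderedRing._≈_ K) w) where
  open OrderedRing K using (_≤?_; antisym; total; ≤-trans; ≤-refl) renaming (_≤_ to _≤ʷ_)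

  above : Fin n → KeySet n
  above k a = not (does (w a ≤? w k))

  above⇒≰ : ∀ {a k} → a ∈ above k → ¬ w a ≤ʷ w k
  above⇒≰ {a} {k} a∈ a≤k = contradiction (≡.trans (≡.sym (≡.cong not (dec-true (w a ≤? w k) a≤k))) a∈) λ ()

  ≰⇒above : ∀ {a k} → ¬ w a ≤ʷ w k → a ∈ above k
  ≰⇒above {a} {k} a≰k = ≡.cong not (dec-false (w a ≤? w k) a≰k)

  rank : KeySet n → Fin n → ℕ
  rank p k = size (p ∩ above k)

  low : KeySet n → ℕ → KeySet n
  low p h k = does (h ℕ.≤? rank p k)

  -- holes p h consists of the h heaviest keys of p, and rest p h of the others.
  rest holes : KeySet n → ℕ → KeySet n
  rest p h  = p ∩ low p h
  holes p h = p ∩ ∁ (low p h)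

  low⇒≤ : ∀ {p h k} → k ∈ low p h → h ℕ.≤ rank p k
  low⇒≤ {p} {h} {k} = does⇒ (h ℕ.≤? rank p k)

  ≤⇒low : ∀ {p h k} → h ℕ.≤ rank p k → k ∈ low p h
  ≤⇒low {p} {h} {k} = dec-true (h ℕ.≤? rank p k)

  ∁low⇒< : ∀ {p h k} → k ∈ ∁ (low p h) → rank p k ℕ.< h
  ∁low⇒< {p} {h} {k} k∈ = ℕ.≰⇒> λ h≤r →
    contradiction (≡.trans (≡.sym (≡.cong not (≤⇒low {p} h≤r))) k∈) λ ()

  <⇒∁low : ∀ {p h k} → rank p k ℕ.< h → k ∈ ∁ (low p h)
  <⇒∁low {p} {h} {k} r<h = ≡.cong not (dec-false (h ℕ.≤? rank p k) (ℕ.<⇒≱ r<h))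

  rank-anti : ∀ {p a k} → w a ≤ʷ w k → rank p k ℕ.≤ rank p a
  rank-anti {p} {a} {k} a≤k = size-⊆ {p = p ∩ above k} {p ∩ above a} λ {b} b∈ →
    ∧-intro (∧⇒ˡ b∈) (≰⇒above λ b≤a → above⇒≰ (∧⇒ʳ {p b} b∈) (≤-trans b≤a a≤k))

  rank-< : ∀ {p a k} → a ∈ p → ¬ w a ≤ʷ w k → rank p a ℕ.< rank p k
  rank-< {p} {a} {k} a∈p a≰k = ≡.subst (rank p a ℕ.<_) (≡.sym (size-remove {p = p ∩ above k} {a} a∈)) (ℕ.s≤s
    (size-⊆ {p = p ∩ above a} {(p ∩ above k) ∖ a} λ {b} b∈ →
      ∈∖ {p = p ∩ above k} (∧-intro (∧⇒ˡ b∈) (≰⇒above λ b≤k → above⇒≰ (∧⇒ʳ {p b} b∈) (≤-trans b≤k k≤a)))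
        λ { ≡.refl → above⇒≰ (∧⇒ʳ {p b} b∈) ≤-refl }))
    where
    a∈ : a ∈ p ∩ above k
    a∈ = ∧-intro a∈p (≰⇒above a≰k)
    k≤a : w k ≤ʷ w a
    k≤a with total (w k) (w a)
    ... | inj₁ k≤a = k≤a
    ... | inj₂ a≤k = contradiction a≤k a≰k

  rank-<⇒≰ : ∀ {p a k} → rank p a ℕ.< rank p k → ¬ w a ≤ʷ w k
  rank-<⇒≰ {p} r< a≤k = ℕ.<⇒≱ r< (rank-anti {p} a≤k)

  rank-injective : ∀ {p a k} → a ∈ p → k ∈ p → rank p a ≡ rank p k → a ≡ k
  rank-injective {p} {a} {k} a∈p k∈p r≡ with w a ≤? w k | w k ≤? w a
  ... | yes a≤k | yes k≤a = w-injective (antisym a≤k k≤a)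
  ... | no a≰k  | _       = contradiction r≡ (ℕ.<⇒≢ (rank-< {p} a∈p a≰k))
  ... | yes _   | no k≰a  = contradiction (≡.sym r≡) (ℕ.<⇒≢ (rank-< {p} k∈p k≰a))

  -- The removed keys of `p` are closed upwards in weight, so those of them in `q` are the heaviest
  -- keys of `q`. Thus both sides of a less-than test are again an interval without its heaviest
  -- keys.
  rest-⊆ : ∀ {p q h} → (∀ {k} → k ∈ q → k ∈ p) → q ∩ low p h ≐ rest q (size (q ∩ ∁ (low p h)))
  rest-⊆ {p} {q} {h} q⊆p = ≐-intro to from
    where
    to : ∀ {k} → k ∈ q ∩ low p h → k ∈ rest q (size (q ∩ ∁ (low p h)))
    to {k} k∈ = ∧-intro (∧⇒ˡ k∈) (≤⇒low {q} (size-⊆ {p = q ∩ ∁ (low p h)} {q ∩ above k} λ {a} a∈ →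
      ∧-intro (∧⇒ˡ a∈) (≰⇒above (rank-<⇒≰ {p} (ℕ.<-≤-trans (∁low⇒< {p} {h} (∧⇒ʳ {q a} a∈))
          (low⇒≤ {p} {h} (∧⇒ʳ {q k} k∈)))))))
    from : ∀ {k} → k ∈ rest q (size (q ∩ ∁ (low p h))) → k ∈ q ∩ low p h
    from {k} k∈ with h ℕ.≤? rank p k
    ... | yes h≤r = ∧-intro (∧⇒ˡ k∈) (≤⇒low {p} h≤r)
    ... | no h≰r  = contradiction (low⇒≤ {q} (∧⇒ʳ {q k} k∈)) (ℕ.<⇒≱
      (≡.subst (rank q k ℕ.<_) (≡.sym (size-remove {p = q ∩ ∁ (low p h)} {k} k-hole)) (ℕ.s≤s
        (size-⊆ {p = q ∩ above k} {(q ∩ ∁ (low p h)) ∖ k} λ {a} a∈ →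
          ∈∖ {p = q ∩ ∁ (low p h)} (∧-intro (∧⇒ˡ a∈)
            (<⇒∁low {p} (ℕ.<-trans (rank-< {p} (q⊆p (∧⇒ˡ a∈)) (above⇒≰ (∧⇒ʳ {q a} a∈))) (ℕ.≰⇒> h≰r))))
            λ { ≡.refl → above⇒≰ (∧⇒ʳ {q a} a∈) ≤-refl }))))
      where
      k-hole : k ∈ q ∩ ∁ (low p h)
      k-hole = ∧-intro (∧⇒ˡ k∈) (<⇒∁low {p} (ℕ.≰⇒> h≰r))

  size-holes-rest : ∀ p h → size p ≡ size (rest p h) ℕ.+ size (holes p h)
  size-holes-rest p h = ℕΣ.Σ-split p (low p h) (const 1)

  module _ {p h m} (holes≡h : size (holes p h) ≡ h) (m∈ : m ∈ rest p h)
           (m-max : ∀ {a} → a ∈ rest p h → w a ≤ʷ w m) where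

    rank-heaviest : rank p m ≡ h
    rank-heaviest = ≡.trans (size-cong {p = p ∩ above m} {holes p h} (≐-intro
      (λ {a} a∈ → ∧-intro {p a} (∧⇒ˡ {p a} a∈) (<⇒∁low {p} {h} {a} (ℕ.≰⇒> λ h≤r →
        above⇒≰ (∧⇒ʳ {p a} a∈) (m-max (∧-intro {p a} (∧⇒ˡ {p a} a∈) (≤⇒low {p} {h} {a} h≤r))))))
      (λ {a} a∈ → ∧-intro {p a} (∧⇒ˡ {p a} a∈) (≰⇒above (rank-<⇒≰ {p}
        (ℕ.<-≤-trans (∁low⇒< {p} {h} (∧⇒ʳ {p a} a∈)) (low⇒≤ {p} {h} (∧⇒ʳ {p m} m∈)))))))) holes≡h

    -- The heaviest remaining key has rank exactly `h`, and since weights are distinct no other key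
    -- of `p` shares this rank.
    rest-suc : rest p (suc h) ≐ rest p h ∖ m
    rest-suc = ≐-intro
      (λ {a} a∈ → ∈∖ {p = rest p h} (∧-intro (∧⇒ˡ a∈) (≤⇒low {p} (ℕ.<⇒≤ (low⇒≤ {p} {suc h} (∧⇒ʳ {p a} a∈)))))
        λ { ≡.refl → ℕ.<⇒≢ (low⇒≤ {p} {suc h} (∧⇒ʳ {p a} a∈)) (≡.sym rank-heaviest) })
      (λ {a} a∈ → let a∈rest = ∈∖⁻ˡ {p = rest p h} a∈ in
        ∧-intro (∧⇒ˡ a∈rest) (≤⇒low {p} (ℕ.≤∧≢⇒< (low⇒≤ {p} {h} (∧⇒ʳ {p a} a∈rest))
          λ h≡ → ∈∖⁻ʳ {p = rest p h} a∈ (rank-injective {p} (∧⇒ˡ a∈rest) (∧⇒ˡ m∈)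
              (≡.trans (≡.sym h≡) (≡.sym rank-heaviest))))))

module States (K : OrderedRing) {n} (w : Fin n → OrderedRing.Carrier K)
  (1≤w : ∀ k → OrderedRing._≤_ K (OrderedRing.1# K) (w k)) (k₀ : Fin n)
  (w-injective : Injective _≡_ (OrderedRing._≈_ K) w) where
  open HeaviestFirst K w 1≤w k₀
  open Ranks K w w-injective public

  -- By distinctness the ranks in `p` are 0, 1, 2, ... without gaps: raising `h` by one removes
  -- exactly the heaviest remaining key, which exists while `h` is below the size.
  size-holes : ∀ {p} h → h ℕ.≤ size p → size (holes p h) ≡ h
  size-holes {p} zero    _ = ℕΣ.Σ-empty {p = holes p 0} (const 1) λ k → Bool.∧-zeroʳ (p k)
  size-holes {p} (suc h) h<size = ℕ.suc-injective (ℕ.+-cancelˡ-≡ (size (rest p (suc h))) _ _ (begin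
    size (rest p (suc h)) ℕ.+ suc (size (holes p (suc h)))  ≡⟨ ℕ.+-suc _ _ ⟩
    suc (size (rest p (suc h)) ℕ.+ size (holes p (suc h)))  ≡⟨ ≡.cong suc (≡.sym (size-holes-rest p (suc h))) ⟩
    suc (size p)                                            ≡⟨ ≡.cong suc (size-holes-rest p h) ⟩
    suc (size (rest p h) ℕ.+ size (holes p h))              ≡⟨ ≡.cong suc (≡.cong₂ ℕ._+_ rest≡ holes≡h) ⟩
    suc (suc (size (rest p (suc h))) ℕ.+ h)                 ≡⟨ ≡.cong suc (≡.sym (ℕ.+-suc _ h)) ⟩
    suc (size (rest p (suc h)) ℕ.+ suc h)                   ≡⟨ ≡.sym (ℕ.+-suc _ (suc h)) ⟩
    size (rest p (suc h)) ℕ.+ suc (suc h)                   ∎))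
    where
    open ≡.≡-Reasoning
    holes≡h : size (holes p h) ≡ h
    holes≡h = size-holes h (ℕ.<⇒≤ h<size)
    rest≠∅ : Nonempty (rest p h)
    rest≠∅ = size⇒nonempty (ℕ.+-cancelʳ-≤ h _ _ (ℕ.≤-trans h<size
      (ℕ.≤-reflexive (≡.trans (size-holes-rest p h) (≡.cong (size (rest p h) ℕ.+_) holes≡h)))))
    rest≡ : size (rest p h) ≡ suc (size (rest p (suc h)))
    rest≡ with m , m∈ , m-max ← heaviest {rest p h} _ ℕ.≤-refl rest≠∅ =
      ≡.trans (size-remove {p = rest p h} m∈) (≡.cong suc
          (≡.sym (size-cong {p = rest p (suc h)} (rest-suc {p} holes≡h m∈ m-max))))

  size-rest : ∀ {p} h → h ℕ.≤ size p → size p ≡ size (rest p h) ℕ.+ h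
  size-rest {p} h h≤ = ≡.trans (size-holes-rest p h) (≡.cong (size (rest p h) ℕ.+_) (size-holes h h≤))

-- The recursion on states

module Cells (K : OrderedRing) {n} (w : Fin n → OrderedRing.Carrier K)
  (1≤w : ∀ k → OrderedRing._≤_ K (OrderedRing.1# K) (w k)) (k₀ : Fin n)
  (w-injective : Injective _≡_ (OrderedRing._≈_ K) w) where
  open Order K
  open OptimalTrees K w 1≤w k₀
  open Structure K w 1≤w k₀
  open HeaviestFirst K w 1≤w k₀
  open Budgets K w 1≤w k₀
  open States K w 1≤w k₀ w-injective

  -- If every test splits, no path has more tests than there are keys less one. This makes n times
  -- the total weight a safe entry for the edge of the table.
  o-≤-size : ∀ s {p} → size p ℕ.≤ suc s → o p ≤ s · W p
  o-≤-size zero {p} size≤ = ≤-reflexive (o-small {p} (size≤1⇒≡ {p = p} size≤))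
  o-≤-size (suc s) {p} size≤ with 2 ℕ.≤? size p
  ... | no ≱2 = ≤-respˡ (sym (o-small {p} (size≤1⇒≡ {p = p} (ℕ.≤-pred (ℕ.≰⇒> ≱2))))) (·-nonNegative (suc s) (0≤W p))
  ... | yes ≥2 with τ , tight , yes≠∅ , no≠∅ ← ∃-tight p ≥2 =
    ≤-trans (o-step τ true p) (+-monoʳ-≤ _ (≤-respʳ (trans (sym (·-distrib s _ _)) (·-congʳ s (sym (W-part τ p))))
      (+-mono-≤ (smaller true) (smaller false))))
    where
    open import Algebra.Properties.CommutativeMonoid.Mult +-commutativeMonoid using (×-distrib-+; ×-congʳ)
    ·-congʳ : ∀ s {x y} → x ≈ y → s · x ≈ s · y
    ·-congʳ s = ×-congʳ s
    ·-distrib : ∀ s x y → s · (x + y) ≈ s · x + s · y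
    ·-distrib s x y = ×-distrib-+ x y s
    smaller : ∀ c → o (part τ c p) ≤ s · W (part τ c p)
    smaller c = o-≤-size s {part τ c p} (ℕ.≤-pred (ℕ.<-≤-trans (size-part< τ {p} yes≠∅ no≠∅ c) size≤))

  size-rest-≤1 : ∀ {p} h → size p ℕ.≤ suc h → size (rest p h) ℕ.≤ 1
  size-rest-≤1 {p} h size≤ with ℕ.≤-total h (size p)
  ... | inj₁ h≤ = ℕ.+-cancelʳ-≤ h _ 1 (≡.subst (ℕ._≤ suc h) (size-rest {p} h h≤) size≤)
  -- With more holes requested than there are keys, `size-rest` does not apply; all keys are then
  -- removed, as already happens for `h` equal to the size.
  ... | inj₂ ≤h = ℕ.≤-trans (size-⊆ {p = rest p h} {rest p (size p)}
          λ {k} k∈ → ∧-intro {p k} (∧⇒ˡ k∈) (≤⇒low {p} {size p} {k} (ℕ.≤-trans ≤h (low⇒≤ {p} {h} {k} (∧⇒ʳ {p k} k∈)))))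
        (ℕ.≤-trans (ℕ.≤-reflexive (ℕ.+-cancelʳ-≡ (size p) _ 0 (≡.sym (size-rest {p} (size p) ℕ.≤-refl)))) ℕ.z≤n)

  state : ℕ → ℕ → ℕ → KeySet n
  state i j h = rest (inside i j) h

  -- The number of holes that a less-than test at `m` sends to its right side.
  holesFrom : ℕ → ℕ → ℕ → ℕ → ℕ
  holesFrom i j h m = size (inside m j ∩ ∁ (low (inside i j) h))

  module _ {i j h : ℕ} (x : Fin n) (i≤x : i ℕ.≤ toℕ x) (x<j : toℕ x ℕ.< j) where
    private
      L = low (inside i j) h
      x≤j = ℕ.<⇒≤ x<j

      left-inside : ∀ {k : Fin n} → k ∈ inside i (toℕ x) → k ∈ inside i j
      left-inside k∈ = ∈-inside (inside⇒≤ {i = i} {toℕ x} k∈) (ℕ.<-trans (inside⇒< {i = i} {toℕ x} k∈) x<j)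

      right-inside : ∀ {k : Fin n} → k ∈ inside (toℕ x) j → k ∈ inside i j
      right-inside k∈ = ∈-inside (ℕ.≤-trans i≤x (inside⇒≤ {i = toℕ x} {j} k∈)) (inside⇒< {i = toℕ x} {j} k∈)

      left : ∀ (q : KeySet n) → part ⟨< x ⟩ true (inside i j ∩ q) ≐ inside i (toℕ x) ∩ q
      left q = ≐-intro
        (λ {k} k∈ → let k∈ij = ∧⇒ˡ (∧⇒ˡ k∈) in
          ∧-intro (∈-inside (inside⇒≤ {i = i} {j} k∈ij) (does⇒ (k Fin.<? x) (∧⇒ʳ {inside i j k ∧ q k} k∈)))
                  (∧⇒ʳ {inside i j k} (∧⇒ˡ k∈)))
        (λ {k} k∈ → ∧-intro (∧-intro (left-inside (∧⇒ˡ k∈)) (∧⇒ʳ {inside i (toℕ x) k} k∈))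
          (dec-true (k Fin.<? x) (inside⇒< {i = i} {toℕ x} (∧⇒ˡ k∈))))

      right : ∀ (q : KeySet n) → part ⟨< x ⟩ false (inside i j ∩ q) ≐ inside (toℕ x) j ∩ q
      right q = ≐-intro
        (λ {k} k∈ → let k∈ij = ∧⇒ˡ (∧⇒ˡ k∈) in
          ∧-intro (∈-inside (ℕ.≮⇒≥ (does⇒¬ (k Fin.<? x) (∈-part⁻ʳ ⟨< x ⟩ false {inside i j ∩ q} {k} k∈)))
                            (inside⇒< {i = i} {j} k∈ij))
                  (∧⇒ʳ {inside i j k} (∧⇒ˡ k∈)))
        (λ {k} k∈ → ∈-part⁺ ⟨< x ⟩ {false} {inside i j ∩ q} {k}
          (∧-intro (right-inside (∧⇒ˡ k∈)) (∧⇒ʳ {inside (toℕ x) j k} k∈))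
          (dec-false (k Fin.<? x) (ℕ.≤⇒≯ (inside⇒≤ {i = toℕ x} {j} (∧⇒ˡ k∈)))))

    state-right : part ⟨< x ⟩ false (state i j h) ≐ state (toℕ x) j (holesFrom i j h (toℕ x))
    state-right k = ≡.trans (right L k) (rest-⊆ {inside i j} {inside (toℕ x) j} {h} right-inside k)

    -- As `h` does not exceed the length of the interval, exactly `h` holes exist, and those not on
    -- the right are on the left. Hence it is enough for the program to count on one side.
    holes-left : h ℕ.≤ j ℕ.∸ i → j ℕ.≤ n → size (inside i (toℕ x) ∩ ∁ L) ≡ h ℕ.∸ holesFrom i j h (toℕ x)
    holes-left h≤ j≤n = ≡.trans (≡.sym (ℕ.m+n∸n≡m (size (inside i (toℕ x) ∩ ∁ L)) (holesFrom i j h (toℕ x))))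
        (≡.cong (ℕ._∸ holesFrom i j h (toℕ x)) (begin
      size (inside i (toℕ x) ∩ ∁ L) ℕ.+ holesFrom i j h (toℕ x)
        ≡⟨ ≡.cong₂ ℕ._+_ (size-cong {p = inside i (toℕ x) ∩ ∁ L} {part ⟨< x ⟩ true H} (≐-sym (left (∁ L))))
                         (size-cong {p = inside (toℕ x) j ∩ ∁ L} {part ⟨< x ⟩ false H} (≐-sym (right (∁ L)))) ⟩
      size (part ⟨< x ⟩ true H) ℕ.+ size (part ⟨< x ⟩ false H)  ≡⟨ size-part ⟨< x ⟩ H ⟨
      size H
        ≡⟨ size-holes h (ℕ.≤-trans h≤ (ℕ.≤-reflexive (≡.sym (size-inside i j (ℕ.≤-trans i≤x x≤j) j≤n)))) ⟩
      h                                                         ∎))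
      where
      open ≡.≡-Reasoning
      H = holes (inside i j) h

    state-left : h ℕ.≤ j ℕ.∸ i → j ℕ.≤ n →
                 part ⟨< x ⟩ true (state i j h) ≐ state i (toℕ x) (h ℕ.∸ holesFrom i j h (toℕ x))
    state-left h≤ j≤n k = ≡.trans (left L k) (≡.trans (rest-⊆ {inside i j} {inside i (toℕ x)} {h} left-inside k)
      (≡.cong (λ a → state i (toℕ x) a k) (holes-left h≤ j≤n)))

  module Table (H : ℕ) where

    -- Entries of states that are not known to occur in an optimal tree for all
    -- keys only have to be upper bounds; at h = H this holds of every state.
    Cell : ℕ → ℕ → ℕ → Carrier → Set
    Cell i j h v = o (state i j h) ≤ v × (Budget (state i j h) (H ℕ.∸ h) → v ≤ o (state i j h))

    cell-small : ∀ {i j h} → i ℕ.≤ j → j ℕ.≤ n → j ℕ.∸ i ℕ.≤ suc h → Cell i j h 0#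
    cell-small {i} {j} {h} i≤j j≤n small = ≤-reflexive o≈0 , λ _ → ≤-reflexive (sym o≈0)
      where
      o≈0 = o-small {state i j h} (size≤1⇒≡ {p = state i j h}
        (size-rest-≤1 {inside i j} h (ℕ.≤-trans (ℕ.≤-reflexive (size-inside i j i≤j j≤n)) small)))

    no-budget : ∀ {p} → ¬ Budget p 0
    no-budget (inj₁ ())
    no-budget (inj₂ (_ , _ , _ , _ , ()))

    cell-top : ∀ {i j v} → n · W (λ _ → true) ≤ v → Cell i j H v
    cell-top {i} {j} {v} big≤v =
      ≤-trans (o-≤-size n {state i j H} (ℕ.m≤n⇒m≤1+n size≤n)) (≤-trans (·-mono-≤ n W≤) big≤v) ,
      λ budget → contradiction (≡.subst (Budget (state i j H)) (ℕ.n∸n≡0 H) budget) no-budget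
      where
      W≤ : W (state i j H) ≤ W (λ _ → true)
      W≤ = Σ-⊆ {p = state i j H} {λ _ → true} 0≤w λ _ → ≡.refl
      size≤n : size (state i j H) ℕ.≤ n
      size≤n = ℕ.≤-trans (size-⊆ {p = state i j H} {inside 0 n} λ {k} _ → ∈-inside ℕ.z≤n (Fin.toℕ<n k))
        (ℕ.≤-reflexive (size-inside 0 n ℕ.z≤n ℕ.≤-refl))

    module Step {i j h : ℕ} (i<j : i ℕ.< j) (j≤n : j ℕ.≤ n) (h<H : h ℕ.< H) (large : 2 ℕ.+ h ℕ.≤ j ℕ.∸ i) where
      private
        S = state i j h
        h≤ : h ℕ.≤ j ℕ.∸ i
        h≤ = ℕ.≤-trans (ℕ.m≤n+m h 2) large
        i≤j = ℕ.<⇒≤ i<j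

      size-S : 2 ℕ.≤ size S
      size-S = ℕ.+-cancelʳ-≤ h 2 _ (ℕ.≤-trans large (ℕ.≤-reflexive (≡.trans (≡.sym (size-inside i j i≤j j≤n))
        (size-rest {inside i j} h (ℕ.≤-trans h≤ (ℕ.≤-reflexive (≡.sym (size-inside i j i≤j j≤n))))))))

      state-suc : ∀ {m} → m ∈ S → Heaviest m S → state i j (suc h) ≐ S ∖ m
      state-suc m∈ m-max = rest-suc {inside i j} {h}
        (size-holes h (ℕ.≤-trans h≤ (ℕ.≤-reflexive (≡.sym (size-inside i j i≤j j≤n))))) m∈ m-max

      o-eq : ∀ {m} → o (part ⟨= m ⟩ true S) ≈ 0#
      o-eq {m} = o-small {part ⟨= m ⟩ true S} λ {a} {b} a∈ b∈ →
        ≡.trans (only⇒≡ {a = m} {a} (∧⇒ʳ {S a} a∈)) (≡.sym (only⇒≡ {a = m} {b} (∧⇒ʳ {S b} b∈)))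

      eq-sound : ∀ {v} → Cell i j (suc h) v → o S ≤ W S + v
      eq-sound (o≤v , _) with m , m∈ , m-max ← heaviest {S} _ ℕ.≤-refl (size⇒nonempty {p = S} (ℕ.<⇒≤ size-S)) =
        ≤-trans (o-step ⟨= m ⟩ true S) (+-monoʳ-≤ _
          (≤-respˡ (sym (trans (+-cong o-eq (sym (o-cong (state-suc m∈ m-max)))) (+-identityˡ _))) o≤v))

      module _ {m : ℕ} (i<m : i ℕ.< m) (m<j : m ℕ.< j) where
        private
          x : Fin n
          x = fromℕ< (ℕ.<-≤-trans m<j j≤n)
          x≡m : toℕ x ≡ m
          x≡m = Fin.toℕ-fromℕ< (ℕ.<-≤-trans m<j j≤n)
          r = holesFrom i j h m
          i≤x : i ℕ.≤ toℕ x
          i≤x = ℕ.≤-trans (ℕ.<⇒≤ i<m) (ℕ.≤-reflexive (≡.sym x≡m))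
          x<j : toℕ x ℕ.< j
          x<j = ℕ.≤-<-trans (ℕ.≤-reflexive x≡m) m<j

        left≐ : part ⟨< x ⟩ true S ≐ state i m (h ℕ.∸ r)
        left≐ = ≡.subst (λ m → part ⟨< x ⟩ true S ≐ state i m (h ℕ.∸ holesFrom i j h m)) x≡m
          (state-left {i} {j} {h} x i≤x x<j h≤ j≤n)

        right≐ : part ⟨< x ⟩ false S ≐ state m j r
        right≐ = ≡.subst (λ m → part ⟨< x ⟩ false S ≐ state m j (holesFrom i j h m)) x≡m
          (state-right {i} {j} {h} x i≤x x<j)

        split-sound : ∀ {v u} → Cell i m (h ℕ.∸ r) v → Cell m j r u → o S ≤ W S + (v + u)
        split-sound (o≤v , _) (o≤u , _) = ≤-trans (o-step ⟨< x ⟩ true S) (+-monoʳ-≤ _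
          (+-mono-≤ (≤-respˡ (sym (o-cong left≐)) o≤v) (≤-respˡ (sym (o-cong right≐)) o≤u)))

        holesFrom-≤ : holesFrom i j h m ℕ.≤ h
        holesFrom-≤ = ℕ.≤-trans
          (size-⊆ {p = inside m j ∩ ∁ (low (inside i j) h)} {holes (inside i j) h} λ {k} k∈ →
            ∧-intro {inside i j k} (∈-inside (ℕ.≤-trans (ℕ.<⇒≤ i<m)
                (inside⇒≤ {i = m} {j} (∧⇒ˡ {inside m j k} k∈))) (inside⇒< {i = m} {j} (∧⇒ˡ {inside m j k} k∈)))
                    (∧⇒ʳ {inside m j k} k∈))
          (ℕ.≤-reflexive (size-holes h (ℕ.≤-trans h≤ (ℕ.≤-reflexive (≡.sym (size-inside i j i≤j j≤n))))))

      Dominated : Carrier → ℕ → Set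
      Dominated b m = ∃[ v ] ∃[ u ] (Cell i m (h ℕ.∸ holesFrom i j h m) v × Cell m j (holesFrom i j h m) u × b ≤ v
          + u)

      -- An equal-to root may be moved to the heaviest key; it spends one unit of budget, just as
      -- the step from `h` to `h` + 1 lowers the allowance `H ∸ h`. A less-than root splits the
      -- state, so it lies strictly between `i` and `j` and is among the splits tried. Its sides
      -- inherit the budget, since they have no more holes than the whole.
      complete : ∀ {b v} → Cell i j (suc h) v → b ≤ v → (∀ {m} → i ℕ.< m → m ℕ.< j → Dominated b m) →
                 Budget S (H ℕ.∸ h) → W S + b ≤ o S
      complete {b} (_ , v≤) b≤v dominated budget with ∃-tight S size-S
      ... | ⟨= k ⟩ , tight , splits with m , m∈ , m-max , tight-m ← tight⇒heaviest {k} {S} tight splits =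
        ≤-trans (+-monoʳ-≤ (W S) (≤-trans b≤v (≤-trans (v≤ budget′)
          (≤-reflexive (trans (o-cong (state-suc m∈ m-max))
              (trans (sym (+-identityˡ _)) (+-congʳ (sym o-eq)))))))) tight-m
        where
        budget′ : Budget (state i j (suc h)) (H ℕ.∸ suc h)
        budget′ = budget-⊆ {state i j (suc h)} {S ∖ m} (λ {a} a∈ → ≡.trans (≡.sym (state-suc m∈ m-max a)) a∈) ℕ.≤-refl
          (budget-eq {m} {S} m∈ m-max tight-m (≡.subst (Budget S) (ℕ.+-∸-assoc 1 h<H) budget))
      ... | ⟨< x ⟩ , tight , (a , a∈) , (c , c∈) = via (dominated i<x x<j)
        where
        i<x : i ℕ.< toℕ x
        i<x = ℕ.≤-<-trans (inside⇒≤ {i = i} {j} {a} (∧⇒ˡ (∧⇒ˡ a∈))) (does⇒ (a Fin.<? x) (∧⇒ʳ {S a} a∈))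
        x<j : toℕ x ℕ.< j
        x<j = ℕ.≤-<-trans (ℕ.≮⇒≥ (does⇒¬ (c Fin.<? x) (∈-part⁻ʳ ⟨< x ⟩ false {S} {c} c∈)))
                          (inside⇒< {i = i} {j} {c} (∧⇒ˡ (∧⇒ˡ c∈)))
        r = holesFrom i j h (toℕ x)
        left≐′ = state-left {i} {j} {h} x (ℕ.<⇒≤ i<x) x<j h≤ j≤n
        right≐′ = state-right {i} {j} {h} x (ℕ.<⇒≤ i<x) x<j
        via : Dominated b (toℕ x) → W S + b ≤ o S
        via (v , u , (_ , v≤) , (_ , u≤) , b≤v+u) =
          ≤-trans (+-monoʳ-≤ (W S) (≤-trans b≤v+u (+-mono-≤
            (≤-trans (v≤ (budget-⊆ {state i (toℕ x) (h ℕ.∸ r)} {S} (λ {a} a∈ → ∧⇒ˡ (≡.trans (left≐′ a) a∈)) (ℕ.∸-monoʳ-≤ H (ℕ.m∸n≤m h r)) budget))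
                     (≤-reflexive (sym (o-cong left≐′))))
            (≤-trans (u≤ (budget-⊆ {state (toℕ x) j r} {S} (λ {a} a∈ → ∧⇒ˡ (≡.trans (right≐′ a) a∈)) (ℕ.∸-monoʳ-≤ H (holesFrom-≤ i<x x<j)) budget))
                     (≤-reflexive (sym (o-cong right≐′))))))) tight

-- The program

-- Times are bounded by multiples of a unit Y: a loop of X rounds turns the unit Y
-- into X · Y, and all other commands only add numerals to the factor k.
module Hoare (K : OrderedRing) where
  open Semantics K

  record Runs (c : Cmd) (σ : Store) (k Y : ℕ) (Q : Store → Set) : Set where
    constructor runs
    field
      final : Store
      time  : ℕ
      exec  : ⟨ c , σ ⟩⇓⟨ final , time ⟩
      time≤ : time ℕ.≤ k ℕ.* Y
      post  : Q final

  private
    variable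
      x : Name
      is : List (Exp nat)
      c d : Cmd
      b : Cond
      σ : Store
      k l Y Z : ℕ
      Q R : Store → Set

    ≤-scale : ∀ {t} k → 1 ℕ.≤ Y → t ℕ.≤ k → t ℕ.≤ k ℕ.* Y
    ≤-scale k 1≤Y t≤k =
      ℕ.≤-trans t≤k (ℕ.≤-trans (ℕ.≤-reflexive (≡.sym (ℕ.*-identityʳ k))) (ℕ.*-monoʳ-≤ k 1≤Y))

    +-scale : ∀ {t u} k l → t ℕ.≤ k ℕ.* Y → u ℕ.≤ l ℕ.* Y → t ℕ.+ u ℕ.≤ (k ℕ.+ l) ℕ.* Y
    +-scale {Y} k l t≤ u≤ = ℕ.≤-trans (ℕ.+-mono-≤ t≤ u≤) (ℕ.≤-reflexive (≡.sym (ℕ.*-distribʳ-+ Y k l)))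

  run-skip : 1 ℕ.≤ Y → Q σ → Runs skip σ 1 Y Q
  run-skip 1≤Y q = runs _ _ ⇓skip (≤-scale 1 1≤Y ℕ.≤-refl) q

  run-assign : ∀ {s x is} {e : Exp s} {σ} → 1 ℕ.≤ Y → Q (write s x (evalˢ σ is) (evalᵉ σ e) σ) →
               Runs (x ⟦ is ⟧ ≔ e) σ (1 ℕ.+ timeˢ is ℕ.+ timeᵉ e) Y Q
  run-assign 1≤Y q = runs _ _ ⇓assign (≤-scale _ 1≤Y ℕ.≤-refl) q

  run-seq : Runs c σ k Y Q → (∀ σ → Q σ → Runs d σ l Y R) → Runs (c ⨾ d) σ (k ℕ.+ l) Y R
  run-seq {k = k} {l = l} (runs σ₁ t c⇓ t≤ q) run-d with run-d σ₁ q
  ... | runs σ₂ u d⇓ u≤ r = runs σ₂ (t ℕ.+ u) (⇓seq c⇓ d⇓) (+-scale k l t≤ u≤) r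

  run-assign⨾ : ∀ {s x is} {e : Exp s} {σ} → 1 ℕ.≤ Y → Runs d (write s x (evalˢ σ is) (evalᵉ σ e) σ) l Y R →
                Runs (x ⟦ is ⟧ ≔ e ⨾ d) σ ((1 ℕ.+ timeˢ is ℕ.+ timeᵉ e) ℕ.+ l) Y R
  run-assign⨾ {s = s} {x = x} {is = is} {e = e} {σ = σ} 1≤Y run-d =
    run-seq (run-assign {Q = _≡ write s x (evalˢ σ is) (evalᵉ σ e) σ} 1≤Y ≡.refl) λ { _ ≡.refl → run-d }

  run-if : 1 ℕ.≤ Y → (evalᶜ σ b ≡ true → Runs c σ k Y Q) → (evalᶜ σ b ≡ false → Runs d σ l Y Q) →
           Runs (If b Then c Else d) σ (timeᶜ b ℕ.+ (k ℕ.⊔ l)) Y Q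
  run-if {Y} {σ} {b} {k = k} {l = l} 1≤Y then-runs else-runs with evalᶜ σ b in eq
  ... | true  with runs σ₁ t c⇓ t≤ q ← then-runs ≡.refl =
    runs σ₁ _ (⇓then eq c⇓)
      (+-scale (timeᶜ b) (k ℕ.⊔ l) (≤-scale (timeᶜ b) 1≤Y ℕ.≤-refl) (ℕ.≤-trans t≤ (ℕ.*-monoˡ-≤ Y (ℕ.m≤m⊔n k l)))) q
  ... | false with runs σ₁ t d⇓ t≤ q ← else-runs ≡.refl =
    runs σ₁ _ (⇓else eq d⇓)
      (+-scale (timeᶜ b) (k ℕ.⊔ l) (≤-scale (timeᶜ b) 1≤Y ℕ.≤-refl) (ℕ.≤-trans t≤ (ℕ.*-monoˡ-≤ Y (ℕ.m≤n⊔m k l)))) q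

  run-unit : Y ℕ.≤ Z → Runs c σ k Y Q → Runs c σ k Z Q
  run-unit {k = k} Y≤Z (runs σ₁ t c⇓ t≤ q) = runs σ₁ t c⇓ (ℕ.≤-trans t≤ (ℕ.*-monoʳ-≤ k Y≤Z)) q

  run-cons : (∀ σ → Q σ → R σ) → Runs c σ k Y Q → Runs c σ k Y R
  run-cons Q⇒R (runs σ₁ t c⇓ t≤ q) = runs σ₁ t c⇓ t≤ (Q⇒R σ₁ q)

  -- The index of the invariant counts the rounds still to come. One `timeᶜ b` pays for the test in
  -- every round, the other for the final test that fails.
  run-while : ∀ {X} (I : ℕ → Store → Set) → 1 ℕ.≤ X → 1 ℕ.≤ Y →
              (∀ {σ} → I 0 σ → evalᶜ σ b ≡ false) →
              (∀ d σ → suc d ℕ.≤ X → I (suc d) σ → evalᶜ σ b ≡ true) →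
              (∀ d σ → suc d ℕ.≤ X → I (suc d) σ → Runs c σ k Y (I d)) →
              ∀ d → d ℕ.≤ X → I d σ →
              Runs (While b Do c) σ ((timeᶜ b ℕ.+ timeᶜ b) ℕ.+ k) (X ℕ.* Y) (I 0)
  run-while {Y} {b} {c} {k} {σ = σ₀} {X} I 1≤X 1≤Y stop continue step d₀ d₀≤X inv₀
    with iterate d₀ σ₀ d₀≤X inv₀
    where
    a = timeᶜ b
    iterate : ∀ d σ → d ℕ.≤ X → I d σ →
              ∃[ σ′ ] ∃[ t ] (⟨ While b Do c , σ ⟩⇓⟨ σ′ , t ⟩ × t ℕ.≤ a ℕ.+ d ℕ.* ((a ℕ.+ k) ℕ.* Y) × I 0 σ′)
    iterate zero    σ _ inv = σ , _ , ⇓stop (stop inv) , ℕ.≤-reflexive (≡.sym (ℕ.+-identityʳ a)) , inv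
    iterate (suc d) σ d<X inv
      with runs σ₁ t c⇓ t≤ inv′ ← step d σ d<X inv
      with σ₂ , u , w⇓ , u≤ , inv″ ← iterate d σ₁ (ℕ.<⇒≤ d<X) inv′ =
      σ₂ , _ , ⇓loop (continue d σ d<X inv) c⇓ w⇓ , time , inv″
      where
      open ℕ.≤-Reasoning
      time : a ℕ.+ t ℕ.+ u ℕ.≤ a ℕ.+ suc d ℕ.* ((a ℕ.+ k) ℕ.* Y)
      time = begin
        a ℕ.+ t ℕ.+ u  ≤⟨ ℕ.+-mono-≤ (+-scale a k (≤-scale a 1≤Y ℕ.≤-refl) t≤) u≤ ⟩
        B ℕ.+ (a ℕ.+ d ℕ.* B)  ≡⟨ ℕ.+-assoc B a (d ℕ.* B) ⟨
        B ℕ.+ a ℕ.+ d ℕ.* B  ≡⟨ ≡.cong (ℕ._+ d ℕ.* B) (ℕ.+-comm B a) ⟩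
        a ℕ.+ B ℕ.+ d ℕ.* B  ≡⟨ ℕ.+-assoc a B (d ℕ.* B) ⟩
        a ℕ.+ suc d ℕ.* B  ∎
        where B = (a ℕ.+ k) ℕ.* Y
  ... | σ′ , t , w⇓ , t≤ , inv = runs σ′ t w⇓ (ℕ.≤-trans t≤ bound) inv
    where
    open ℕ.≤-Reasoning
    a = timeᶜ b
    bound : a ℕ.+ d₀ ℕ.* ((a ℕ.+ k) ℕ.* Y) ℕ.≤ (a ℕ.+ a ℕ.+ k) ℕ.* (X ℕ.* Y)
    bound = begin
      a ℕ.+ d₀ ℕ.* ((a ℕ.+ k) ℕ.* Y)
        ≤⟨ ℕ.+-mono-≤ (≤-scale a (ℕ.*-mono-≤ 1≤X 1≤Y) ℕ.≤-refl) (ℕ.*-monoˡ-≤ _ d₀≤X) ⟩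
      a ℕ.* (X ℕ.* Y) ℕ.+ X ℕ.* ((a ℕ.+ k) ℕ.* Y)  ≡⟨ ≡.cong (a ℕ.* (X ℕ.* Y) ℕ.+_) swap ⟩
      a ℕ.* (X ℕ.* Y) ℕ.+ (a ℕ.+ k) ℕ.* (X ℕ.* Y)  ≡⟨ ℕ.*-distribʳ-+ (X ℕ.* Y) a (a ℕ.+ k) ⟨
      (a ℕ.+ (a ℕ.+ k)) ℕ.* (X ℕ.* Y)  ≡⟨ ≡.cong (ℕ._* (X ℕ.* Y)) (ℕ.+-assoc a a k) ⟨
      (a ℕ.+ a ℕ.+ k) ℕ.* (X ℕ.* Y)  ∎
      where
      swap : X ℕ.* ((a ℕ.+ k) ℕ.* Y) ≡ (a ℕ.+ k) ℕ.* (X ℕ.* Y)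
      swap = ≡.trans (≡.sym (ℕ.*-assoc X (a ℕ.+ k) Y))
          (≡.trans (≡.cong (ℕ._* Y) (ℕ.*-comm X (a ℕ.+ k))) (ℕ.*-assoc (a ℕ.+ k) X Y))

  update-same : ∀ {A : Set} x is (v : A) m → update x is v m x is ≡ v
  update-same x is v m
    rewrite dec-true (x ℕ.≟ x) ≡.refl | dec-true (List.≡-dec ℕ._≟_ is is) ≡.refl = ≡.refl

  update-other : ∀ {A : Set} x is js (v : A) m → is ≢ js → update x is v m x js ≡ m x js
  update-other x is js v m is≢js
    rewrite dec-true (x ℕ.≟ x) ≡.refl | dec-false (List.≡-dec ℕ._≟_ is js) is≢js = ≡.refl

-- When the interval [i, j) is processed, rank[m] is the number of keys in it that
-- are heavier than m, and V[i,j,h] is the cost for its keys without the h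
-- heaviest ones.  H bounds the numbers of holes to be considered, and big is an
-- upper bound for all costs.
natVar : Name → Exp nat
natVar x = x ⟦ [] ⟧

n′ i′ j′ h′ m′ r′ H′ : Exp nat
n′ = natVar 0
i′ = natVar 1
j′ = natVar 2
h′ = natVar 3
m′ = natVar 4
r′ = natVar 5
H′ = natVar 6

rankAt : Exp nat → Exp nat
rankAt m = 7 ⟦ m ∷ [] ⟧

weightAt : Exp nat → Exp weight
weightAt k = 0 ⟦ k ∷ [] ⟧

V : Exp nat → Exp nat → Exp nat → Exp weight
V i j h = 1 ⟦ i ∷ j ∷ h ∷ [] ⟧

S′ b′ x′ W′ big′ : Exp weight
S′ = 2 ⟦ [] ⟧
b′ = 3 ⟦ [] ⟧
x′ = 4 ⟦ [] ⟧
W′ = 5 ⟦ [] ⟧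
big′ = 6 ⟦ [] ⟧

-- Natural and weight variables are numbered separately, and the sort of the right-hand side tells
-- them apart. `big′` reaches n times the total weight by repeated addition, as n cannot be turned
-- into a weight; the same n rounds look for a power of two above the total weight, adding 24 to
-- `H′` per doubling.
sumBody sumWeights doubleBody doubling : Cmd
sumBody    = 4 ⟦ [] ⟧ ≔ m′ ⊖ lit 1 ⨾ 5 ⟦ [] ⟧ ≔ W′ ⊕ weightAt m′
sumWeights = While lit 1 ≼ m′ Do sumBody
doubleBody = 4 ⟦ [] ⟧ ≔ m′ ⊖ lit 1 ⨾ 6 ⟦ [] ⟧ ≔ big′ ⊕ W′ ⨾
             If x′ ≼ W′ Then (4 ⟦ [] ⟧ ≔ x′ ⊕ x′ ⨾ 6 ⟦ [] ⟧ ≔ H′ ⊕ lit 24) Else skip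
doubling   = While lit 1 ≼ m′ Do doubleBody

setup : Cmd
setup = 6 ⟦ [] ⟧ ≔ lit {nat} 3 ⨾ 4 ⟦ [] ⟧ ≔ lit {weight} 1 ⨾ 4 ⟦ [] ⟧ ≔ n′ ⨾ sumWeights ⨾ 4 ⟦ [] ⟧ ≔ n′ ⨾ doubling

-- When `j` joins the interval, comparing it with each key `m` raises the rank of the lighter of the
-- two. This takes linear time per interval; computing all ranks by pairwise comparison would take
-- quadratic time and spoil the cubic bound.
rankBody rankLoop : Cmd
rankBody = 4 ⟦ [] ⟧ ≔ m′ ⊖ lit 1 ⨾
           If weightAt m′ ≼ weightAt j′
           Then (7 ⟦ m′ ∷ [] ⟧ ≔ rankAt m′ ⊕ lit 1)
           Else (7 ⟦ j′ ∷ [] ⟧ ≔ rankAt j′ ⊕ lit 1)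
rankLoop = While i′ ⊕ lit 1 ≼ m′ Do rankBody

restBody restLoop : Cmd
restBody = 4 ⟦ [] ⟧ ≔ m′ ⊖ lit 1 ⨾
           If h′ ≼ rankAt m′ Then (2 ⟦ [] ⟧ ≔ S′ ⊕ weightAt m′) Else skip
restLoop = While i′ ⊕ lit 1 ≼ m′ Do restBody

split : Exp weight
split = V i′ m′ (h′ ⊖ r′) ⊕ V m′ j′ r′

-- `m` is decremented before use, so it runs from `j` - 1 down to `i` + 1. Keeping `r` up to date on
-- the way makes each split cost constant time.
splitBody splitLoop : Cmd
splitBody = 4 ⟦ [] ⟧ ≔ m′ ⊖ lit 1 ⨾
            If h′ ≼ rankAt m′ Then skip Else (5 ⟦ [] ⟧ ≔ r′ ⊕ lit 1) ⨾
            If split ≼ b′ Then (3 ⟦ [] ⟧ ≔ split) Else skip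
splitLoop = While i′ ⊕ lit 2 ≼ m′ Do splitBody

-- Holes are counted downwards because an equal-to test leads from `h` to `h` + 1; its value is the
-- initial candidate for `b`. The condition says that at least two keys remain.
cellBody cellLoop : Cmd
cellBody = 3 ⟦ [] ⟧ ≔ h′ ⊖ lit 1 ⨾
           If i′ ⊕ (h′ ⊕ lit 2) ≼ j′
           Then (2 ⟦ [] ⟧ ≔ lit {weight} 0 ⨾ 4 ⟦ [] ⟧ ≔ j′ ⨾ restLoop ⨾
                 5 ⟦ [] ⟧ ≔ lit {nat} 0 ⨾ 3 ⟦ [] ⟧ ≔ V i′ j′ (h′ ⊕ lit 1) ⨾ 4 ⟦ [] ⟧ ≔ j′ ⨾ splitLoop ⨾
                 1 ⟦ i′ ∷ j′ ∷ h′ ∷ [] ⟧ ≔ S′ ⊕ b′)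
           Else (1 ⟦ i′ ∷ j′ ∷ h′ ∷ [] ⟧ ≔ lit {weight} 0)
cellLoop = While lit 1 ≼ h′ Do cellBody

intervalBody intervalLoop : Cmd
intervalBody = 7 ⟦ j′ ∷ [] ⟧ ≔ lit {nat} 0 ⨾ 4 ⟦ [] ⟧ ≔ j′ ⨾ rankLoop ⨾ 2 ⟦ [] ⟧ ≔ j′ ⊕ lit 1 ⨾
               1 ⟦ i′ ∷ j′ ∷ H′ ∷ [] ⟧ ≔ big′ ⨾ 3 ⟦ [] ⟧ ≔ H′ ⨾ cellLoop
intervalLoop = While j′ ⊕ lit 1 ≼ n′ Do intervalBody

-- Left ends decrease and right ends increase, so of the two parts of a split the right one belongs
-- to an earlier row and the left one to a shorter interval of the same row.
rowBody rowLoop : Cmd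
rowBody = 1 ⟦ [] ⟧ ≔ i′ ⊖ lit 1 ⨾ 2 ⟦ [] ⟧ ≔ i′ ⨾ intervalLoop
rowLoop = While lit 1 ≼ i′ Do rowBody

program : Cmd
program = setup ⨾ 1 ⟦ [] ⟧ ≔ n′ ⨾ rowLoop ⨾ 0 ⟦ [] ⟧ ≔ V (lit 0) n′ (lit 0)

-- Verification of the program

module Setup (K : OrderedRing) {n} (w : Fin n → OrderedRing.Carrier K)
  (1≤w : ∀ k → OrderedRing._≤_ K (OrderedRing.1# K) (w k)) (k₀ : Fin n) (1≤n : 1 ℕ.≤ n) where
  open Order K
  open Semantics K
  open Hoare K
  open OptimalTrees K w 1≤w k₀
  open Structure K w 1≤w k₀
  open HeavyRoots K w 1≤w k₀
  open Budgets K w 1≤w k₀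

  all : KeySet n
  all _ = true

  W⊤ : Carrier
  W⊤ = W all

  Input : Store → Set
  Input σ = nats σ 0 [] ≡ n × (∀ k → weights σ 0 (toℕ k ∷ []) ≡ w k)

  Ready : ℕ → Store → Set
  Ready H σ = Input σ × nats σ 6 [] ≡ H × n · W⊤ ≤ weights σ 6 []

  ·1-cancel-≤ : ∀ a b → a · 1# ≤ b · 1# → a ℕ.≤ b
  ·1-cancel-≤ zero    b       _ = ℕ.z≤n
  ·1-cancel-≤ (suc a) zero    a≤0 = contradiction (≤-trans (x≤x+y (·-nonNegative a 0≤1)) a≤0) 1≰0
  ·1-cancel-≤ (suc a) (suc b) a≤b = ℕ.s≤s (·1-cancel-≤ a b (balance a≤b
    (solve 3 (λ x y z → x ⊞ (z ⊞ y) ⊜ y ⊞ (z ⊞ x)) refl (a · 1#) (b · 1#) 1#)))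

  pow₂-cancel-≤ : ∀ l L → pow₂ l ≤ pow₂ L → l ℕ.≤ L
  pow₂-cancel-≤ l L pow≤ with l ℕ.≤? L
  ... | yes l≤L = l≤L
  ... | no l≰L  = contradiction (·1-cancel-≤ (2 ℕ.^ l) (2 ℕ.^ L) pow≤)
                    (ℕ.<⇒≱ (ℕ.^-monoʳ-< 2 (ℕ.s≤s (ℕ.s≤s ℕ.z≤n)) (ℕ.≰⇒> l≰L)))

  does-≤ : ∀ {x y} → leq weight x y ≡ true → x ≤ y
  does-≤ {x} {y} = does⇒ (x ≤? y)

  does-≰ : ∀ {x y} → leq weight x y ≡ false → ¬ x ≤ y
  does-≰ {x} {y} = does⇒¬ (x ≤? y)

  key : ∀ {m} → m ℕ.< n → Fin n
  key m<n = fromℕ< m<n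

  weight-at : ∀ {σ m} → Input σ → (m<n : m ℕ.< n) → weights σ 0 (m ∷ []) ≡ w (key m<n)
  weight-at {σ} (_ , input) m<n =
    ≡.subst (λ m → weights σ 0 (m ∷ []) ≡ w (key m<n)) (Fin.toℕ-fromℕ< m<n) (input (key m<n))

  Summing : ℕ → Store → Set
  Summing d σ = Input σ × nats σ 6 [] ≡ 3 × weights σ 4 [] ≈ pow₂ 0 × weights σ 6 [] ≡ 0# ×
                nats σ 4 [] ≡ d × weights σ 5 [] ≈ W (inside d n)

  sumBody-runs : ∀ d σ → suc d ℕ.≤ n → Summing (suc d) σ → Runs sumBody σ 9 1 (Summing d)
  sumBody-runs d σ d<n (input , H≡ , x≈ , big≡ , m≡ , sum≈) =
    run-assign⨾ ℕ.≤-refl (run-assign ℕ.≤-refl (input , H≡ , x≈ , big≡ , m′≡ , sum′))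
    where
    m′≡ : nats σ 4 [] ℕ.∸ 1 ≡ d
    m′≡ = ≡.cong (ℕ._∸ 1) m≡
    x = key d<n
    toℕ-x : toℕ x ≡ d
    toℕ-x = Fin.toℕ-fromℕ< d<n
    W-cons : W (inside d n) ≈ w x + W (inside (suc d) n)
    W-cons = ≡.subst (λ d → W (inside d n) ≈ w x + W (inside (suc d) n)) toℕ-x
      (Σ-insert {p = inside (suc (toℕ x)) n} {inside (toℕ x) n} {x} w (∉-inside-bottom x n)
          (inside-cons (Fin.toℕ<n x)))
    sum′ : weights σ 5 [] + weights σ 0 ((nats σ 4 [] ℕ.∸ 1) ∷ []) ≈ W (inside d n)
    sum′ = trans (+-cong sum≈ (reflexive (≡.trans (≡.cong (λ m → weights σ 0 (m ∷ [])) m′≡)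
        (weight-at {σ} input d<n))))
      (trans (+-comm _ _) (sym W-cons))

  rise : ∀ {x l} → x ≡ 3 ℕ.+ 24 ℕ.* l → x ℕ.+ 24 ≡ 3 ℕ.+ 24 ℕ.* suc l
  rise {l = l} ≡.refl = raise 3 24 l
    where
    raise : ∀ a c l → a ℕ.+ c ℕ.* l ℕ.+ c ≡ a ℕ.+ c ℕ.* suc l
    raise a c l = ≡.trans (ℕ.+-assoc a (c ℕ.* l) c)
      (≡.cong (a ℕ.+_) (≡.trans (ℕ.+-comm (c ℕ.* l) c) (≡.sym (ℕ.*-suc c l))))

  -- The final alternative says that the power has reached the total weight unless every round so
  -- far has doubled it. The bound is `suc L` rather than `L` because the program doubles once more
  -- when the power equals the total weight.
  Doubling : ℕ → Store → Set
  Doubling d σ = Input σ × weights σ 5 [] ≈ W⊤ × nats σ 4 [] ≡ d ×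
    (∃[ c ] (c ℕ.+ d ≡ n × weights σ 6 [] ≈ c · W⊤)) ×
    (∃[ l ] (nats σ 6 [] ≡ 3 ℕ.+ 24 ℕ.* l × weights σ 4 [] ≈ pow₂ l ×
             (∀ L → W⊤ ≤ pow₂ L → l ℕ.≤ suc L) × (W⊤ ≤ pow₂ l ⊎ l ℕ.+ d ≡ n)))

  doubleBody-runs : ∀ d σ → suc d ℕ.≤ n → Doubling (suc d) σ → Runs doubleBody σ 19 1 (Doubling d)
  doubleBody-runs d σ d<n (input , W≈ , m≡ , (c , c+d≡n , big≈) , (l , H≡ , x≈ , l≤ , done)) =
    run-assign⨾ ℕ.≤-refl $ run-assign⨾ ℕ.≤-refl $ run-if {k = 8} {l = 1} ℕ.≤-refl
      (λ x≤W → run-assign⨾ ℕ.≤-refl $ run-assign ℕ.≤-refl $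
        let pow≤W = ≤-respˡ x≈ (≤-respʳ W≈ (does-≤ x≤W)) in
        input , W≈ , m≡′ , big′≈ , suc l ,
        rise H≡ ,
        trans (+-cong x≈ x≈) (sym (pow₂-suc l)) ,
        (λ L W≤ → ℕ.s≤s (pow₂-cancel-≤ l L (≤-trans pow≤W W≤))) ,
        [ (λ W≤ → inj₁ (≤-trans W≤ (≤-respʳ (sym (pow₂-suc l)) (x≤x+y (·-nonNegative (2 ℕ.^ l) 0≤1)))))
        , (λ l+d≡n → inj₂ (≡.trans (≡.sym (ℕ.+-suc l d)) l+d≡n)) ]′ done)
      (λ x≰W → run-skip ℕ.≤-refl
        (input , W≈ , m≡′ , big′≈ , l , H≡ , x≈ , l≤ , inj₁ (≤-respˡ W≈ (≤-respʳ x≈ (≰⇒≥ (does-≰ x≰W))))))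
    where
    m≡′ : nats σ 4 [] ℕ.∸ 1 ≡ d
    m≡′ = ≡.cong (ℕ._∸ 1) m≡
    big′≈ : ∃[ c ] (c ℕ.+ d ≡ n × weights σ 6 [] + weights σ 5 [] ≈ c · W⊤)
    big′≈ = suc c , ≡.trans (≡.sym (ℕ.+-suc c d)) c+d≡n , trans (+-cong big≈ W≈) (+-comm _ _)

  Prepared : Store → Set
  Prepared σ = ∃[ H ] (Ready H σ × Budget all H × 1 ℕ.≤ H × (∀ L → W⊤ ≤ pow₂ L → H ℕ.≤ 27 ℕ.+ 24 ℕ.* L))

  doubled⇒prepared : ∀ σ → Doubling 0 σ → Prepared σ
  doubled⇒prepared σ (input , W≈ , _ , (c , c≡n , big≈) , (l , H≡ , x≈ , l≤ , done)) =
    3 ℕ.+ 24 ℕ.* l , (input , H≡ , ≤-reflexive (sym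
        (trans big≈ (reflexive (≡.cong (_· W⊤) (≡.trans (≡.sym (ℕ.+-identityʳ c)) c≡n)))))) ,
    budget done , ℕ.s≤s ℕ.z≤n , λ L W≤ → ℕ.+-monoʳ-≤ 3
        (ℕ.≤-trans (ℕ.*-monoʳ-≤ 24 (l≤ L W≤)) (ℕ.≤-reflexive (ℕ.*-suc 24 L)))
    where
    budget : W⊤ ≤ pow₂ l ⊎ l ℕ.+ 0 ≡ n → Budget all (3 ℕ.+ 24 ℕ.* l)
    -- 2W is at most two units of 2ˡ, so c = 2. The initial value 3 of `H′` is the least that
    -- exceeds it.
    budget (inj₁ W≤) = inj₂ (l , 2 , (λ {a} a∈ → ≤-trans (w≤W {a} {all} a∈) W≤) ,
      ≤-trans (+-mono-≤ W≤ W≤) (≤-reflexive (+-congˡ (sym (+-identityʳ _)))) , ℕ.s≤s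
          (ℕ.≤-reflexive (ℕ.+-comm (24 ℕ.* l) 2)))
    -- All n rounds doubled, so 3 + 24l already exceeds the number of keys, whatever the weights
    -- are.
    budget (inj₂ l≡n) = inj₁ (ℕ.≤-<-trans size≤n
      (ℕ.s≤s (ℕ.≤-trans (ℕ.m≤m+n (1 ℕ.* l) (23 ℕ.* l))
          (ℕ.≤-trans (ℕ.≤-reflexive (≡.sym (ℕ.*-distribʳ-+ l 1 23))) (ℕ.m≤n+m (24 ℕ.* l) 2)))))
      where
      size≤n : size all ℕ.≤ 1 ℕ.* l
      size≤n = ℕ.≤-trans (size-⊆ {p = all} {inside 0 n} λ {k} _ → ∈-inside ℕ.z≤n (Fin.toℕ<n k))
        (ℕ.≤-reflexive (≡.trans (size-inside 0 n ℕ.z≤n ℕ.≤-refl) (≡.sym l≡n)))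

  setup-runs : ∀ σ → Input σ → weights σ 5 [] ≡ 0# → weights σ 6 [] ≡ 0# → Runs setup σ 48 n Prepared
  setup-runs σ input W≡0 big≡0 =
    run-assign⨾ 1≤n $ run-assign⨾ 1≤n $ run-assign⨾ 1≤n $
    run-seq (run-unit (ℕ.≤-reflexive (ℕ.*-identityʳ n)) (run-while Summing 1≤n ℕ.≤-refl
        (λ { (_ , _ , _ , _ , m≡ , _) → ≡.cong (1 ℕ.≤ᵇ_) m≡ }) (λ { d _ _ (_ , _ , _ , _ , m≡ , _) → ≡.cong (1 ℕ.≤ᵇ_) m≡ })
        sumBody-runs n ℕ.≤-refl
        (input , ≡.refl , refl , big≡0 , proj₁ input , trans (reflexive W≡0)
            (sym (Σ-empty {p = inside n n} w (inside-empty n))))))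
      λ { σ₁ (input , H≡ , x≈ , big≡ , _ , sum≈) →
    run-assign⨾ 1≤n $
    run-cons doubled⇒prepared $
    run-unit (ℕ.≤-reflexive (ℕ.*-identityʳ n)) (run-while Doubling 1≤n ℕ.≤-refl
        (λ { (_ , _ , m≡ , _) → ≡.cong (1 ℕ.≤ᵇ_) m≡ }) (λ { d _ _ (_ , _ , m≡ , _) → ≡.cong (1 ℕ.≤ᵇ_) m≡ })
        doubleBody-runs n ℕ.≤-refl
        (input , trans sum≈ (W-cong λ k → ∈-inside ℕ.z≤n (Fin.toℕ<n k)) , proj₁ input ,
         (0 , ≡.refl , reflexive big≡) , (0 , H≡ , x≈ , (λ _ _ → ℕ.z≤n) , inj₂ ≡.refl))) }

-- Invariants of the loops over one cell

inside-cons-∈ : ∀ {n j} (q : KeySet n) {y : Fin n} → toℕ y ℕ.< j → y ∈ q →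
                inside (toℕ y) j ∩ q ≐ (inside (suc (toℕ y)) j ∩ q) ∪ only y
inside-cons-∈ {j = j} q {y} y<j y∈q k rewrite inside-cons {x = y} y<j k with k Fin.≟ y
... | yes ≡.refl rewrite y∈q = ≡.trans (≡.cong (_∧ true) (Bool.∨-zeroʳ _)) (≡.sym (Bool.∨-zeroʳ _))
... | no _ = ≡.trans (≡.cong (_∧ q k) (Bool.∨-identityʳ _)) (≡.sym (Bool.∨-identityʳ _))

inside-cons-∉ : ∀ {n j} (q : KeySet n) {y : Fin n} → toℕ y ℕ.< j → q y ≡ false →
                inside (toℕ y) j ∩ q ≐ inside (suc (toℕ y)) j ∩ q
inside-cons-∉ {j = j} q {y} y<j y∉q k rewrite inside-cons {x = y} y<j k with k Fin.≟ y
... | yes ≡.refl rewrite y∉q = ≡.trans (Bool.∧-zeroʳ _) (≡.sym (Bool.∧-zeroʳ _))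
... | no _ = ≡.cong (_∧ q k) (Bool.∨-identityʳ _)

module Tabulate (K : OrderedRing) {n} (w : Fin n → OrderedRing.Carrier K)
  (1≤w : ∀ k → OrderedRing._≤_ K (OrderedRing.1# K) (w k)) (k₀ : Fin n) (1≤n : 1 ℕ.≤ n)
  (w-injective : Injective _≡_ (OrderedRing._≈_ K) w) (H : ℕ) where
  open Order K
  open Semantics K
  open Hoare K
  open OptimalTrees K w 1≤w k₀
  open Structure K w 1≤w k₀
  open HeavyRoots K w 1≤w k₀
  open Setup K w 1≤w k₀ 1≤n
  open States K w 1≤w k₀ w-injective
  open Cells K w 1≤w k₀ w-injective
  open Table H

  update-key : ∀ {m} x (y k : Fin n) v (mem : Memory ℕ) → m ≡ toℕ y →
               (k ≡ y → update x (m ∷ []) v mem x (toℕ k ∷ []) ≡ v) ×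
               (k ≢ y → update x (m ∷ []) v mem x (toℕ k ∷ []) ≡ mem x (toℕ k ∷ []))
  update-key x y k v mem ≡.refl =
    (λ { ≡.refl → update-same x (toℕ y ∷ []) v mem }) ,
    (λ k≢y → update-other x (toℕ y ∷ []) (toℕ k ∷ []) v mem λ eq → k≢y
        (Fin.toℕ-injective (≡.sym (List.∷-injectiveˡ eq))))

  -- The entries that are complete when the cells of the interval [i, j) with
  -- at least d holes have been computed.
  Region : ℕ → ℕ → ℕ → ℕ → ℕ → ℕ → Set
  Region i j d i₁ j₁ h₁ =
    i₁ ℕ.< j₁ × j₁ ℕ.≤ n × h₁ ℕ.≤ H × (i ℕ.< i₁ ⊎ (i₁ ≡ i × (j₁ ℕ.< j ⊎ (j₁ ≡ j × d ℕ.≤ h₁))))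

  Filled : (ℕ → ℕ → ℕ → Set) → Store → Set
  Filled P σ = ∀ i j h → P i j h → Cell i j h (weights σ 1 (i ∷ j ∷ h ∷ []))

  fill : ∀ {P P′ : ℕ → ℕ → ℕ → Set} {σ a b c i j h v} → Filled P σ → a ≡ i → b ≡ j → c ≡ h → Cell i j h v →
         (∀ i₁ j₁ h₁ → P′ i₁ j₁ h₁ → P i₁ j₁ h₁ ⊎ (i₁ ≡ i × j₁ ≡ j × h₁ ≡ h)) →
         Filled P′ (write weight 1 (a ∷ b ∷ c ∷ []) v σ)
  fill {σ = σ} {i = i} {j} {h} {v} filled ≡.refl ≡.refl ≡.refl cell P′⇒ i₁ j₁ h₁ p′
    with List.≡-dec ℕ._≟_ (i ∷ j ∷ h ∷ []) (i₁ ∷ j₁ ∷ h₁ ∷ [])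
  ... | yes ≡.refl = ≡.subst (Cell i j h) (≡.sym (update-same 1 (i ∷ j ∷ h ∷ []) v (weights σ))) cell
  ... | no ≢ with P′⇒ i₁ j₁ h₁ p′
  ...   | inj₂ (≡.refl , ≡.refl , ≡.refl) = contradiction ≡.refl ≢
  ...   | inj₁ p = ≡.subst (Cell i₁ j₁ h₁)
            (≡.sym (update-other 1 (i ∷ j ∷ h ∷ []) (i₁ ∷ j₁ ∷ h₁ ∷ []) v (weights σ) ≢)) (filled i₁ j₁ h₁ p)

  cell-at : ∀ {P σ a b c i j h} → Filled P σ → a ≡ i → b ≡ j → c ≡ h → P i j h →
            Cell i j h (weights σ 1 (a ∷ b ∷ c ∷ []))
  cell-at filled ≡.refl ≡.refl ≡.refl p = filled _ _ _ p

  Ranked : ℕ → ℕ → Store → Set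
  Ranked i j σ = ∀ k → k ∈ inside i j → nats σ 7 (toℕ k ∷ []) ≡ rank (inside i j) k

  Context : ℕ → ℕ → ℕ → Store → Set
  Context i j d σ = Ready H σ × nats σ 1 [] ≡ i × nats σ 2 [] ≡ j × Filled (Region i j d) σ

  rank-at : ∀ {i j m σ} → Ranked i j σ → (y : Fin n) → y ∈ inside i j → m ≡ toℕ y →
            nats σ 7 (m ∷ []) ≡ rank (inside i j) y
  rank-at ranked y y∈ ≡.refl = ranked y y∈

  does-≤ℕ : ∀ {a b c d} → a ≡ c → b ≡ d → leq nat a b ≡ true → c ℕ.≤ d
  does-≤ℕ {a} {b} ≡.refl ≡.refl = does⇒ (a ℕ.≤? b)

  does-≰ℕ : ∀ {a b c d} → a ≡ c → b ≡ d → leq nat a b ≡ false → d ℕ.< c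
  does-≰ℕ {a} {b} ≡.refl ≡.refl ab≡ = ℕ.≰⇒> (does⇒¬ (a ℕ.≤? b) ab≡)

  continue-≤ : ∀ {a b c d} → a ≡ c → b ≡ d → c ℕ.≤ d → leq nat a b ≡ true
  continue-≤ {a} {b} ≡.refl ≡.refl = dec-true (a ℕ.≤? b)

  stop-≤ : ∀ {a b c d} → a ≡ c → b ≡ d → d ℕ.< c → leq nat a b ≡ false
  stop-≤ {a} {b} ≡.refl ≡.refl d<c = dec-false (a ℕ.≤? b) (ℕ.<⇒≱ d<c)

  module _ {i j h d₀ : ℕ} (i<j : i ℕ.< j) (j≤n : j ℕ.≤ n) where

    L = low (inside i j) h

    Resting : ℕ → Store → Set
    Resting d σ = Context i j d₀ σ × Ranked i j σ × nats σ 3 [] ≡ h × nats σ 4 [] ≡ i ℕ.+ d × i ℕ.+ d ℕ.≤ j ×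
                  weights σ 2 [] ≈ W (inside (i ℕ.+ d) j ∩ L)

    restBody-runs : ∀ d σ → suc d ℕ.≤ n → Resting (suc d) σ → Runs restBody σ 13 1 (Resting d)
    restBody-runs d σ d<n (ctx , ranked , h≡ , m≡ , m≤j , S≈) =
      run-assign⨾ ℕ.≤-refl $ run-if {k = 5} {l = 1} ℕ.≤-refl
        (λ h≤rank → run-assign ℕ.≤-refl (ctx , ranked , h≡ , m′≡ , ℕ.<⇒≤ m<j ,
          trans (+-cong S≈ (reflexive (≡.trans (≡.cong (λ m → weights σ 0 (m ∷ [])) m′≡y)
              (proj₂ (proj₁ (proj₁ ctx)) y))))
            (trans (+-comm _ _) (sym (W-∈ (≤⇒low {inside i j} {h} {y} (does-≤ℕ h≡ rank≡ h≤rank)))))))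
        (λ h≰rank → run-skip ℕ.≤-refl (ctx , ranked , h≡ , m′≡ , ℕ.<⇒≤ m<j ,
          trans S≈ (sym (W-∉ (dec-false (h ℕ.≤? rank (inside i j) y) (ℕ.<⇒≱ (does-≰ℕ h≡ rank≡ h≰rank)))))))
      where
      m<j : i ℕ.+ d ℕ.< j
      m<j = ℕ.≤-trans (ℕ.≤-reflexive (≡.sym (ℕ.+-suc i d))) m≤j
      m<n = ℕ.<-≤-trans m<j j≤n
      y = key m<n
      toℕ-y : toℕ y ≡ i ℕ.+ d
      toℕ-y = Fin.toℕ-fromℕ< m<n
      m′≡ : nats σ 4 [] ℕ.∸ 1 ≡ i ℕ.+ d
      m′≡ = ≡.trans (≡.cong (ℕ._∸ 1) m≡) (≡.cong (ℕ._∸ 1) (ℕ.+-suc i d))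
      m′≡y : nats σ 4 [] ℕ.∸ 1 ≡ toℕ y
      m′≡y = ≡.trans m′≡ (≡.sym toℕ-y)
      y<j : toℕ y ℕ.< j
      y<j = ℕ.≤-<-trans (ℕ.≤-reflexive toℕ-y) m<j
      rank≡ : nats σ 7 ((nats σ 4 [] ℕ.∸ 1) ∷ []) ≡ rank (inside i j) y
      rank≡ = rank-at {i} {j} {σ = σ} ranked y
        (∈-inside (ℕ.≤-trans (ℕ.m≤m+n i d) (ℕ.≤-reflexive (≡.sym toℕ-y))) y<j) m′≡y
      y+1≡ : suc (toℕ y) ≡ i ℕ.+ suc d
      y+1≡ = ≡.trans (≡.cong suc toℕ-y) (≡.sym (ℕ.+-suc i d))
      W-∈ : y ∈ L → W (inside (i ℕ.+ d) j ∩ L) ≈ w y + W (inside (i ℕ.+ suc d) j ∩ L)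
      W-∈ y∈ = ≡.subst₂ (λ a b → W (inside a j ∩ L) ≈ w y + W (inside b j ∩ L)) toℕ-y y+1≡
        (Σ-insert {p = inside (suc (toℕ y)) j ∩ L} {inside (toℕ y) j ∩ L} {y} w
          (≡.cong (_∧ L y) (∉-inside-bottom y j)) (inside-cons-∈ L y<j y∈))
      W-∉ : L y ≡ false → W (inside (i ℕ.+ d) j ∩ L) ≈ W (inside (i ℕ.+ suc d) j ∩ L)
      W-∉ y∉ = ≡.subst₂ (λ a b → W (inside a j ∩ L) ≈ W (inside b j ∩ L)) toℕ-y y+1≡
        (W-cong (inside-cons-∉ L y<j y∉))

    restLoop-runs : ∀ {σ} → Context i j d₀ σ → Ranked i j σ → nats σ 3 [] ≡ h → nats σ 4 [] ≡ j →
                    weights σ 2 [] ≡ 0# → Runs restLoop σ 23 n (Resting 0)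
    restLoop-runs {σ} ctx ranked h≡ m≡ S≡0 = run-unit (ℕ.≤-reflexive (ℕ.*-identityʳ n))
      (run-while Resting 1≤n ℕ.≤-refl
        (λ { ((_ , i≡ , _) , _ , _ , m≡ , _) → stop-≤ (≡.cong (ℕ._+ 1) i≡) (≡.trans m≡ (ℕ.+-identityʳ i)) (ℕ.m<m+n i ℕ.z<s) })
        (λ { d _ _ ((_ , i≡ , _) , _ , _ , m≡ , _) → continue-≤ (≡.cong (ℕ._+ 1) i≡) m≡ (ℕ.+-monoʳ-≤ i (ℕ.s≤s ℕ.z≤n)) })
        restBody-runs (j ℕ.∸ i) (ℕ.≤-trans (ℕ.m∸n≤m j i) j≤n)
        (ctx , ranked , h≡ , ≡.trans m≡ (≡.sym i+≡j) , ℕ.≤-reflexive i+≡j ,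
          trans (reflexive S≡0) (sym (trans (W-cong λ k → ≡.cong (λ m → inside m j k ∧ L k) i+≡j)
            (Σ-empty {p = inside j j ∩ L} w λ k → ≡.cong (_∧ L k) (inside-empty j k))))))
      where
      i+≡j : i ℕ.+ (j ℕ.∸ i) ≡ j
      i+≡j = ℕ.m+[n∸m]≡n (ℕ.<⇒≤ i<j)

    module _ (h<H : h ℕ.< H) (d₀≤ : d₀ ℕ.≤ suc h) (large : 2 ℕ.+ h ℕ.≤ j ℕ.∸ i) where
      open Step i<j j≤n h<H large

      -- The running minimum `b` stays an upper bound for what follows the root, and it is below the
      -- equal-to candidate and all splits tried so far; these are the premises of `complete`.
      Bounded : ℕ → Store → Set
      Bounded m σ = weights σ 2 [] ≈ W (state i j h) ×
        (o (state i j h) ≤ W (state i j h) + weights σ 3 []) ×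
        weights σ 3 [] ≤ weights σ 1 (i ∷ j ∷ suc h ∷ []) ×
        (∀ m₁ → m ℕ.≤ m₁ → m₁ ℕ.< j → Dominated (weights σ 3 []) m₁)

      Counted : ℕ → Store → Set
      Counted m σ = Context i j d₀ σ × Ranked i j σ × nats σ 3 [] ≡ h × nats σ 4 [] ≡ m × m ℕ.≤ j ×
                    nats σ 5 [] ≡ holesFrom i j h m

      -- The offset by one makes the loop end at `i` + 1, as a less-than test at `i` would send no
      -- key to the left.
      Splitting : ℕ → Store → Set
      Splitting d σ = Counted (suc (i ℕ.+ d)) σ × Bounded (suc (i ℕ.+ d)) σ

      splitBody-runs : ∀ d σ → suc d ℕ.≤ n → Splitting (suc d) σ → Runs splitBody σ 37 1 (Splitting d)
      splitBody-runs d σ d<n ((ctx , ranked , h≡ , m≡ , m≤j , r≡) , (S≈ , sound , b≤ , dominated)) =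
        run-assign⨾ ℕ.≤-refl $
        run-seq {Q = λ σ → Counted (suc (i ℕ.+ d)) σ × Bounded (suc (i ℕ.+ suc d)) σ} count improve
        where
        m<j : suc (i ℕ.+ d) ℕ.< j
        m<j = ℕ.≤-trans (ℕ.≤-reflexive (≡.cong suc (≡.sym (ℕ.+-suc i d)))) m≤j
        i<m : i ℕ.< suc (i ℕ.+ d)
        i<m = ℕ.s≤s (ℕ.m≤m+n i d)
        m<n = ℕ.<-≤-trans m<j j≤n
        y = key m<n
        toℕ-y : toℕ y ≡ suc (i ℕ.+ d)
        toℕ-y = Fin.toℕ-fromℕ< m<n
        m′≡ : nats σ 4 [] ℕ.∸ 1 ≡ suc (i ℕ.+ d)
        m′≡ = ≡.trans (≡.cong (ℕ._∸ 1) m≡) (ℕ.+-suc i d)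
        m′≡y : nats σ 4 [] ℕ.∸ 1 ≡ toℕ y
        m′≡y = ≡.trans m′≡ (≡.sym toℕ-y)
        y<j : toℕ y ℕ.< j
        y<j = ℕ.≤-<-trans (ℕ.≤-reflexive toℕ-y) m<j
        rank≡ : nats σ 7 ((nats σ 4 [] ℕ.∸ 1) ∷ []) ≡ rank (inside i j) y
        rank≡ = rank-at {i} {j} {σ = σ} ranked y
          (∈-inside (ℕ.≤-trans (ℕ.<⇒≤ i<m) (ℕ.≤-reflexive (≡.sym toℕ-y))) y<j) m′≡y
        y+1≡ : suc (toℕ y) ≡ suc (i ℕ.+ suc d)
        y+1≡ = ≡.cong suc (≡.trans toℕ-y (≡.sym (ℕ.+-suc i d)))
        holes-∈ : y ∈ L → holesFrom i j h (suc (i ℕ.+ d)) ≡ holesFrom i j h (suc (i ℕ.+ suc d))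
        holes-∈ y∈ = ≡.subst₂ (λ a b → size (inside a j ∩ ∁ L) ≡ size (inside b j ∩ ∁ L)) toℕ-y y+1≡
          (size-cong {p = inside (toℕ y) j ∩ ∁ L} {inside (suc (toℕ y)) j ∩ ∁ L}
            (inside-cons-∉ (∁ L) y<j (≡.cong not y∈)))
        holes-∉ : y ∈ ∁ L → holesFrom i j h (suc (i ℕ.+ d)) ≡ suc (holesFrom i j h (suc (i ℕ.+ suc d)))
        holes-∉ y∉ = ≡.subst₂ (λ a b → size (inside a j ∩ ∁ L) ≡ suc (size (inside b j ∩ ∁ L))) toℕ-y y+1≡
          (ℕΣ.Σ-insert {p = inside (suc (toℕ y)) j ∩ ∁ L} {inside (toℕ y) j ∩ ∁ L} {y} (const 1)
            (≡.cong (_∧ ∁ L y) (∉-inside-bottom y j)) (inside-cons-∈ (∁ L) y<j y∉))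
        σ₁ : Store
        σ₁ = write nat 4 [] (nats σ 4 [] ℕ.∸ 1) σ
        count : Runs (If h′ ≼ rankAt m′ Then skip Else (5 ⟦ [] ⟧ ≔ r′ ⊕ lit 1)) σ₁ 8 1
                     (λ σ → Counted (suc (i ℕ.+ d)) σ × Bounded (suc (i ℕ.+ suc d)) σ)
        count = run-if {k = 1} {l = 4} ℕ.≤-refl
          (λ h≤rank → run-skip ℕ.≤-refl ((ctx , ranked , h≡ , m′≡ , ℕ.<⇒≤ m<j ,
            ≡.trans r≡ (≡.sym (holes-∈ (≤⇒low {inside i j} {h} {y} (does-≤ℕ h≡ rank≡ h≤rank))))) ,
            (S≈ , sound , b≤ , dominated)))
          (λ h≰rank → run-assign ℕ.≤-refl ((ctx , ranked , h≡ , m′≡ , ℕ.<⇒≤ m<j ,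
            ≡.trans (ℕ.+-comm _ 1) (≡.trans (≡.cong suc r≡)
                (≡.sym (holes-∉ (<⇒∁low {inside i j} {h} {y} (does-≰ℕ h≡ rank≡ h≰rank)))))) ,
            (S≈ , sound , b≤ , dominated)))
        improve : ∀ σ → Counted (suc (i ℕ.+ d)) σ × Bounded (suc (i ℕ.+ suc d)) σ →
                  Runs (If split ≼ b′ Then (3 ⟦ [] ⟧ ≔ split) Else skip) σ 25 1 (Splitting d)
        improve σ ((ctx@(ready , i≡ , j≡ , filled) , ranked , h≡ , m≡ , m≤j , r≡) , (S≈ , sound , b≤ , dominated)) =
          run-if {k = 12} {l = 1} ℕ.≤-refl
            (λ v+u≤b → run-assign ℕ.≤-refl ((ctx , ranked , h≡ , m≡ , m≤j , r≡) ,
              (S≈ , split-sound i<m m<j left-cell right-cell , ≤-trans (does-≤ v+u≤b) b≤ ,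
               extend ≤-refl λ m₁ m<m₁ m₁<j → weaken {m = m₁} (does-≤ v+u≤b) (dominated m₁ m<m₁ m₁<j))))
            (λ v+u≰b → run-skip ℕ.≤-refl ((ctx , ranked , h≡ , m≡ , m≤j , r≡) ,
              (S≈ , sound , b≤ , extend (≰⇒≥ (does-≰ v+u≰b)) dominated)))
          where
          m = suc (i ℕ.+ d)
          v = weights σ 1 (nats σ 1 [] ∷ nats σ 4 [] ∷ (nats σ 3 [] ℕ.∸ nats σ 5 []) ∷ [])
          u = weights σ 1 (nats σ 4 [] ∷ nats σ 2 [] ∷ nats σ 5 [] ∷ [])
          left-cell : Cell i m (h ℕ.∸ holesFrom i j h m) v
          left-cell = cell-at {σ = σ} filled i≡ m≡ (≡.cong₂ ℕ._∸_ h≡ r≡)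
            (i<m , ℕ.<⇒≤ m<n , ℕ.≤-trans (ℕ.m∸n≤m h (holesFrom i j h m)) (ℕ.<⇒≤ h<H) , inj₂ (≡.refl , inj₁ m<j))
          right-cell : Cell m j (holesFrom i j h m) u
          right-cell = cell-at {σ = σ} filled m≡ j≡ r≡
            (m<j , j≤n , ℕ.≤-trans (holesFrom-≤ i<m m<j) (ℕ.<⇒≤ h<H) , inj₁ i<m)
          weaken : ∀ {b b₁ m} → b ≤ b₁ → Dominated b₁ m → Dominated b m
          weaken b≤b₁ (v , u , left , right , b₁≤) = v , u , left , right , ≤-trans b≤b₁ b₁≤
          extend : ∀ {b} → b ≤ v + u → (∀ m₁ → suc (i ℕ.+ suc d) ℕ.≤ m₁ → m₁ ℕ.< j → Dominated b m₁) →
                   ∀ m₁ → m ℕ.≤ m₁ → m₁ ℕ.< j → Dominated b m₁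
          extend {b} b≤v+u later m₁ m≤m₁ m₁<j with ℕ.m≤n⇒m<n∨m≡n m≤m₁
          ... | inj₁ m<m₁ = later m₁ (ℕ.≤-trans (ℕ.≤-reflexive (≡.cong suc (ℕ.+-suc i d))) m<m₁) m₁<j
          ... | inj₂ ≡.refl = v , u , left-cell , right-cell , b≤v+u

      splitLoop-runs : ∀ {σ} → Context i j d₀ σ → Ranked i j σ → nats σ 3 [] ≡ h → nats σ 4 [] ≡ j → nats σ 5 [] ≡ 0 →
                       weights σ 2 [] ≈ W (state i j h) → weights σ 3 [] ≡ weights σ 1 (i ∷ j ∷ suc h ∷ []) →
                       Runs splitLoop σ 47 n (Splitting 0)
      splitLoop-runs {σ} ctx@(_ , _ , _ , filled) ranked h≡ m≡ r≡ S≈ b≡ =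
        run-unit (ℕ.≤-reflexive (ℕ.*-identityʳ n)) (run-while Splitting 1≤n ℕ.≤-refl
          (λ { (((_ , i≡ , _) , _ , _ , m≡ , _) , _) → stop-≤ (≡.cong (ℕ._+ 2) i≡) (≡.trans m≡ (≡.cong suc (ℕ.+-identityʳ i)))
                 (ℕ.≤-reflexive (ℕ.+-comm 2 i)) })
          (λ { d _ _ (((_ , i≡ , _) , _ , _ , m≡ , _) , _) → continue-≤ (≡.cong (ℕ._+ 2) i≡) m≡
                 (ℕ.≤-trans (ℕ.+-monoʳ-≤ i (ℕ.s≤s (ℕ.s≤s (ℕ.z≤n {d})))) (ℕ.≤-reflexive (ℕ.+-suc i (suc d)))) })
          splitBody-runs (j ℕ.∸ suc i) (ℕ.≤-trans (ℕ.m∸n≤m j (suc i)) j≤n)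
          ((ctx , ranked , h≡ , ≡.trans m≡ (≡.sym 1+i+≡j) , ℕ.≤-reflexive 1+i+≡j ,
            ≡.trans r≡ (≡.sym (≡.trans (≡.cong (holesFrom i j h) 1+i+≡j)
              (ℕΣ.Σ-empty {p = inside j j ∩ ∁ L} (const 1) λ k → ≡.cong (_∧ ∁ L k) (inside-empty j k))))) ,
           (S≈ , ≤-trans (eq-sound cell) (+-monoʳ-≤ _ (≤-reflexive (reflexive (≡.sym b≡)))) , ≤-reflexive
               (reflexive b≡) ,
            λ m₁ j≤m₁ m₁<j → contradiction (ℕ.≤-trans (ℕ.≤-reflexive (≡.sym 1+i+≡j)) j≤m₁) (ℕ.<⇒≱ m₁<j))))
        where
        1+i+≡j : suc (i ℕ.+ (j ℕ.∸ suc i)) ≡ j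
        1+i+≡j = ℕ.m+[n∸m]≡n i<j
        cell : Cell i j (suc h) (weights σ 1 (i ∷ j ∷ suc h ∷ []))
        cell = filled i j (suc h) (i<j , j≤n , h<H , inj₂ (≡.refl , inj₂ (≡.refl , d₀≤)))

      split⇒cell : ∀ {σ} → Splitting 0 σ → Cell i j h (weights σ 2 [] + weights σ 3 [])
      split⇒cell {σ} (((_ , _ , _ , filled) , _) , (S≈ , sound , b≤ , dominated)) =
        ≤-respʳ (+-congʳ (sym S≈)) sound ,
        λ budget → ≤-respˡ (+-congʳ (sym S≈)) (complete
          (filled i j (suc h) (i<j , j≤n , h<H , inj₂ (≡.refl , inj₂ (≡.refl , d₀≤)))) b≤
          (λ {m} i<m m<j → dominated m (ℕ.≤-trans (ℕ.≤-reflexive (≡.cong suc (ℕ.+-identityʳ i))) i<m) m<j) budget)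

-- Loops over holes, right ends and left ends

module Rows (K : OrderedRing) {n} (w : Fin n → OrderedRing.Carrier K)
  (1≤w : ∀ k → OrderedRing._≤_ K (OrderedRing.1# K) (w k)) (k₀ : Fin n) (1≤n : 1 ℕ.≤ n)
  (w-injective : Injective _≡_ (OrderedRing._≈_ K) w) (H : ℕ) (1≤H : 1 ℕ.≤ H) where
  open Order K
  open Semantics K
  open Hoare K
  open OptimalTrees K w 1≤w k₀
  open HeavyRoots K w 1≤w k₀
  open Setup K w 1≤w k₀ 1≤n
  open States K w 1≤w k₀ w-injective
  open Cells K w 1≤w k₀ w-injective
  open Table H
  open Tabulate K w 1≤w k₀ 1≤n w-injective H

  1≤Hn : 1 ℕ.≤ H ℕ.* n
  1≤Hn = ℕ.*-mono-≤ 1≤H 1≤n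

  n≤Hn : n ℕ.≤ H ℕ.* n
  n≤Hn = ℕ.≤-trans (ℕ.≤-reflexive (≡.sym (ℕ.*-identityˡ n))) (ℕ.*-monoˡ-≤ n 1≤H)

  module _ {i j : ℕ} (i<j : i ℕ.< j) (j≤n : j ℕ.≤ n) where

    Celling : ℕ → Store → Set
    Celling d σ = Context i j d σ × Ranked i j σ × nats σ 3 [] ≡ d

    region-suc : ∀ d i₁ j₁ h₁ → Region i j d i₁ j₁ h₁ → Region i j (suc d) i₁ j₁ h₁ ⊎ (i₁ ≡ i × j₁ ≡ j × h₁ ≡ d)
    region-suc d i₁ j₁ h₁ (i<j , j≤ , h≤ , inj₁ i<) = inj₁ (i<j , j≤ , h≤ , inj₁ i<)
    region-suc d i₁ j₁ h₁ (i<j , j≤ , h≤ , inj₂ (i≡ , inj₁ j<)) = inj₁ (i<j , j≤ , h≤ , inj₂ (i≡ , inj₁ j<))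
    region-suc d i₁ j₁ h₁ (i<j , j≤ , h≤ , inj₂ (i≡ , inj₂ (j≡ , d≤h))) with ℕ.m≤n⇒m<n∨m≡n d≤h
    ... | inj₁ d<h = inj₁ (i<j , j≤ , h≤ , inj₂ (i≡ , inj₂ (j≡ , d<h)))
    ... | inj₂ d≡h = inj₂ (i≡ , j≡ , ≡.sym d≡h)

    cellBody-runs : ∀ d σ → suc d ℕ.≤ H → Celling (suc d) σ → Runs cellBody σ 103 n (Celling d)
    cellBody-runs d σ d<H (ctx@(ready , i≡ , j≡ , filled) , ranked , h≡) =
      run-assign⨾ 1≤n $ run-if {k = 92} {l = 5} 1≤n
        (λ large → let large = 2+d≤ (does-≤ℕ i+h+2≡ j≡ large) in
          run-assign⨾ 1≤n $ run-assign⨾ 1≤n $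
          run-seq (restLoop-runs {i} {j} {d} {suc d} i<j j≤n ctx ranked h≡′ j≡ ≡.refl)
            λ { σ₁ (ctx@(_ , i≡ , j≡ , _) , ranked , h≡ , _ , _ , S≈) →
          run-assign⨾ 1≤n $ run-assign⨾ 1≤n $ run-assign⨾ 1≤n $
          run-seq (splitLoop-runs {i} {j} {d} {suc d} i<j j≤n d<H ℕ.≤-refl large ctx ranked h≡ j≡ ≡.refl
              (trans S≈ (W-cong λ k → ≡.cong (λ m → inside m j k ∧ low (inside i j) d k) (ℕ.+-identityʳ i)))
              (≡.trans (≡.cong (λ a → weights σ₁ 1 (a ∷ nats σ₁ 2 [] ∷ (nats σ₁ 3 [] ℕ.+ 1) ∷ [])) i≡)
                (≡.cong₂ (λ a b → weights σ₁ 1 (i ∷ a ∷ b ∷ [])) j≡ (≡.trans (ℕ.+-comm _ 1) (≡.cong suc h≡)))))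
            λ { σ₂ inv@((ctx@(ready , i≡ , j≡ , filled) , ranked , h≡ , _) , _) →
          run-assign 1≤n ((ready , i≡ , j≡ ,
            fill {σ = σ₂} filled i≡ j≡ h≡ (split⇒cell {i} {j} {d} {suc d} i<j j≤n d<H ℕ.≤-refl large {σ₂} inv)
                (region-suc d)) ,
            ranked , h≡) } })
        (λ small → run-assign 1≤n ((ready , i≡ , j≡ ,
            fill {σ = write nat 3 [] (nats σ 3 [] ℕ.∸ 1) σ} filled i≡ j≡ h≡′
                (cell-small (ℕ.<⇒≤ i<j) j≤n (≤1+d (does-≰ℕ i+h+2≡ j≡ small))) (region-suc d)) ,
            ranked , h≡′))
      where
      h≡′ : nats σ 3 [] ℕ.∸ 1 ≡ d
      h≡′ = ≡.cong (ℕ._∸ 1) h≡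
      i+h+2≡ : nats σ 1 [] ℕ.+ (nats σ 3 [] ℕ.∸ 1 ℕ.+ 2) ≡ i ℕ.+ (2 ℕ.+ d)
      i+h+2≡ = ≡.cong₂ ℕ._+_ i≡ (≡.trans (ℕ.+-comm _ 2) (≡.cong (2 ℕ.+_) h≡′))
      2+d≤ : i ℕ.+ (2 ℕ.+ d) ℕ.≤ j → 2 ℕ.+ d ℕ.≤ j ℕ.∸ i
      2+d≤ le = ℕ.m+n≤o⇒m≤o∸n (2 ℕ.+ d) (ℕ.≤-trans (ℕ.≤-reflexive (ℕ.+-comm (2 ℕ.+ d) i)) le)
      ≤1+d : j ℕ.< i ℕ.+ (2 ℕ.+ d) → j ℕ.∸ i ℕ.≤ suc d
      ≤1+d lt = ℕ.m≤n+o⇒m∸n≤o j i (ℕ.≤-pred (ℕ.≤-trans lt (ℕ.≤-reflexive (ℕ.+-suc i (suc d)))))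

    cellLoop-runs : ∀ {σ} → Context i j H σ → Ranked i j σ → nats σ 3 [] ≡ H →
                    Runs cellLoop σ 109 (H ℕ.* n) (Celling 0)
    cellLoop-runs ctx ranked h≡ = run-while Celling 1≤H 1≤n
      (λ { (_ , _ , h≡) → ≡.cong (1 ℕ.≤ᵇ_) h≡ }) (λ { d _ _ (_ , _ , h≡) → ≡.cong (1 ℕ.≤ᵇ_) h≡ })
      cellBody-runs H ℕ.≤-refl (ctx , ranked , h≡)

  module RankLoop {i : ℕ} (x : Fin n) (i≤x : i ℕ.≤ toℕ x) where

    private
      j = toℕ x
      j<n : j ℕ.< n
      j<n = Fin.toℕ<n x

    -- Keys not yet compared with `j` still carry their ranks in the old interval, the others their
    -- ranks in the extended one, while the entry of `j` counts the heavier keys met so far.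
    Ranking : ℕ → Store → Set
    Ranking d σ = Context i j 0 σ × nats σ 4 [] ≡ i ℕ.+ d × i ℕ.+ d ℕ.≤ j ×
      (∀ k → k ∈ inside i (i ℕ.+ d) → nats σ 7 (toℕ k ∷ []) ≡ rank (inside i j) k) ×
      (∀ k → k ∈ inside (i ℕ.+ d) j → nats σ 7 (toℕ k ∷ []) ≡ rank (inside i (suc j)) k) ×
      nats σ 7 (j ∷ []) ≡ size (inside (i ℕ.+ d) j ∩ above x)

    rank-snoc-∈ : ∀ {y} → y ∈ inside i j → x ∈ above y → rank (inside i (suc j)) y ≡ suc (rank (inside i j) y)
    rank-snoc-∈ {y} y∈ x∈ = ℕΣ.Σ-insert {p = inside i j ∩ above y} {inside i (suc j) ∩ above y} {x} (const 1)
      (≡.cong (_∧ above y x) (∉-inside-top i x)) pointwise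
      where
      pointwise : inside i (suc j) ∩ above y ≐ (inside i j ∩ above y) ∪ only x
      pointwise k rewrite inside-snoc {x = x} i≤x k with k Fin.≟ x
      ... | yes ≡.refl rewrite x∈ = ≡.trans (≡.cong (_∧ true) (Bool.∨-zeroʳ _)) (≡.sym (Bool.∨-zeroʳ _))
      ... | no _ = ≡.trans (≡.cong (_∧ above y k) (Bool.∨-identityʳ _)) (≡.sym (Bool.∨-identityʳ _))

    rank-snoc-∉ : ∀ {y} → above y x ≡ false → rank (inside i (suc j)) y ≡ rank (inside i j) y
    rank-snoc-∉ {y} x∉ = size-cong {p = inside i (suc j) ∩ above y} {inside i j ∩ above y} pointwise
      where
      pointwise : inside i (suc j) ∩ above y ≐ inside i j ∩ above y
      pointwise k rewrite inside-snoc {x = x} i≤x k with k Fin.≟ x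
      ... | yes ≡.refl rewrite x∉ = ≡.trans (Bool.∧-zeroʳ _) (≡.sym (Bool.∧-zeroʳ _))
      ... | no _ = ≡.cong (_∧ above y k) (Bool.∨-identityʳ _)

    rankBody-runs : ∀ d σ → suc d ℕ.≤ n → Ranking (suc d) σ → Runs rankBody σ 15 1 (Ranking d)
    rankBody-runs d σ d<n (ctx@(((_ , input) , _) , i≡ , j≡ , _) , m≡ , m≤j , old , new , rank-j) =
      run-assign⨾ ℕ.≤-refl $ run-if {k = 6} {l = 6} ℕ.≤-refl
        -- The program compares with ≤; as `y` and `x` are different keys, distinct weights make the
        -- comparison strict.
        (λ m≤x → let y≤x = does-≤ m≤x ; y≤x = ≤-respˡ (reflexive w-y) (≤-respʳ (reflexive w-x) y≤x)
                     x-above : x ∈ above y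
                     x-above = ≰⇒above {x} {y} λ x≤y → y≢x (w-injective (antisym y≤x x≤y)) in
          run-assign ℕ.≤-refl (ctx , m′≡ , ℕ.<⇒≤ m<j ,
            (λ k k∈ → ≡.trans (proj₂ (update-key 7 y k _ (nats σ) m′≡y) (below-≢ k∈)) (old k (below-⊆ k∈))) ,
            (λ k k∈ → case k Fin.≟ y of λ where
              (yes ≡.refl) → ≡.trans (proj₁ (update-key 7 y y _ (nats σ) m′≡y) ≡.refl)
                (≡.trans (ℕ.+-comm _ 1) (≡.trans (≡.cong suc rank-y) (≡.sym (rank-snoc-∈ y∈ x-above))))
              (no k≢y) → ≡.trans (proj₂ (update-key 7 y k _ (nats σ) m′≡y) k≢y) (new k (above-⊆ k∈ k≢y))) ,
            ≡.trans (proj₂ (update-key 7 y x _ (nats σ) m′≡y) (y≢x ∘ ≡.sym)) (≡.trans rank-j (≡.sym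
              (count-∉ (≡.cong not (dec-true (w y ≤? w x) y≤x)))))))
        (λ m≰x → let y≰x = does-≰ m≰x ; y≰x = λ (y≤x : w y ≤ w x) → y≰x (≤-respˡ (reflexive (≡.sym w-y)) (≤-respʳ (reflexive (≡.sym w-x)) y≤x))
                     x∉above : above y x ≡ false
                     x∉above = ≡.cong not (dec-true (w x ≤? w y) (≰⇒≥ y≰x)) in
          run-assign ℕ.≤-refl (ctx , m′≡ , ℕ.<⇒≤ m<j ,
            (λ k k∈ → ≡.trans (proj₂ (update-key 7 x k _ (nats σ) j≡) (inside-≢ (below-⊆ k∈) (below-< k∈)))
                (old k (below-⊆ k∈))) ,
            (λ k k∈ → ≡.trans (proj₂ (update-key 7 x k _ (nats σ) j≡) (inside-≢′ k∈)) (case k Fin.≟ y of λ where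
              (yes ≡.refl) → ≡.trans (old-y) (≡.sym (rank-snoc-∉ {y} x∉above))
              (no k≢y) → new k (above-⊆ k∈ k≢y))) ,
            ≡.trans (proj₁ (update-key 7 x x _ (nats σ) j≡) ≡.refl)
              (≡.trans (ℕ.+-comm _ 1) (≡.trans (≡.cong suc (≡.trans (≡.cong (λ a → nats σ 7 (a ∷ [])) j≡) rank-j))
                (≡.sym (count-∈ (≰⇒above {y} {x} y≰x)))))))
      where
      m<j : i ℕ.+ d ℕ.< j
      m<j = ℕ.≤-trans (ℕ.≤-reflexive (≡.sym (ℕ.+-suc i d))) m≤j
      m<n = ℕ.<-trans m<j j<n
      y = key m<n
      toℕ-y : toℕ y ≡ i ℕ.+ d
      toℕ-y = Fin.toℕ-fromℕ< m<n
      m′≡ : nats σ 4 [] ℕ.∸ 1 ≡ i ℕ.+ d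
      m′≡ = ≡.trans (≡.cong (ℕ._∸ 1) m≡) (≡.cong (ℕ._∸ 1) (ℕ.+-suc i d))
      m′≡y : nats σ 4 [] ℕ.∸ 1 ≡ toℕ y
      m′≡y = ≡.trans m′≡ (≡.sym toℕ-y)
      y<j : toℕ y ℕ.< j
      y<j = ℕ.≤-<-trans (ℕ.≤-reflexive toℕ-y) m<j
      i≤y : i ℕ.≤ toℕ y
      i≤y = ℕ.≤-trans (ℕ.m≤m+n i d) (ℕ.≤-reflexive (≡.sym toℕ-y))
      y∈ : y ∈ inside i j
      y∈ = ∈-inside i≤y y<j
      y≢x : y ≢ x
      y≢x y≡x = ℕ.<⇒≢ y<j (≡.cong toℕ y≡x)
      y+1≡ : suc (toℕ y) ≡ i ℕ.+ suc d
      y+1≡ = ≡.trans (≡.cong suc toℕ-y) (≡.sym (ℕ.+-suc i d))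
      w-y : weights σ 0 ((nats σ 4 [] ℕ.∸ 1) ∷ []) ≡ w y
      w-y = ≡.trans (≡.cong (λ m → weights σ 0 (m ∷ [])) m′≡y) (input y)
      w-x : weights σ 0 (nats σ 2 [] ∷ []) ≡ w x
      w-x = ≡.trans (≡.cong (λ m → weights σ 0 (m ∷ [])) j≡) (input x)
      old-y : nats σ 7 (toℕ y ∷ []) ≡ rank (inside i j) y
      old-y = old y (∈-inside i≤y (ℕ.≤-reflexive y+1≡))
      rank-y : nats σ 7 ((nats σ 4 [] ℕ.∸ 1) ∷ []) ≡ rank (inside i j) y
      rank-y = ≡.trans (≡.cong (λ m → nats σ 7 (m ∷ [])) m′≡y) old-y
      below-< : ∀ {k} → k ∈ inside i (i ℕ.+ d) → toℕ k ℕ.< i ℕ.+ d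
      below-< = inside⇒< {i = i} {i ℕ.+ d}
      below-⊆ : ∀ {k} → k ∈ inside i (i ℕ.+ d) → k ∈ inside i (i ℕ.+ suc d)
      below-⊆ k∈ = ∈-inside (inside⇒≤ {i = i} {i ℕ.+ d} k∈) (ℕ.<-≤-trans (below-< k∈) (ℕ.+-monoʳ-≤ i (ℕ.n≤1+n d)))
      below-≢ : ∀ {k} → k ∈ inside i (i ℕ.+ d) → k ≢ y
      below-≢ k∈ ≡.refl = ℕ.<⇒≢ (below-< k∈) toℕ-y
      inside-≢ : ∀ {k} → k ∈ inside i (i ℕ.+ suc d) → toℕ k ℕ.< i ℕ.+ d → k ≢ x
      inside-≢ _ k<m ≡.refl = ℕ.<⇒≱ k<m (ℕ.<⇒≤ m<j)
      inside-≢′ : ∀ {k} → k ∈ inside (i ℕ.+ d) j → k ≢ x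
      inside-≢′ k∈ ≡.refl = ℕ.<-irrefl ≡.refl (inside⇒< {i = i ℕ.+ d} {j} k∈)
      above-⊆ : ∀ {k} → k ∈ inside (i ℕ.+ d) j → k ≢ y → k ∈ inside (i ℕ.+ suc d) j
      above-⊆ k∈ k≢y = ∈-inside
        (ℕ.≤-trans (ℕ.≤-reflexive (ℕ.+-suc i d)) (ℕ.≤∧≢⇒< (inside⇒≤ {i = i ℕ.+ d} {j} k∈)
          λ eq → k≢y (Fin.toℕ-injective (≡.trans (≡.sym eq) (≡.sym toℕ-y)))))
        (inside⇒< {i = i ℕ.+ d} {j} k∈)
      count-∈ : y ∈ above x → size (inside (i ℕ.+ d) j ∩ above x) ≡ suc (size (inside (i ℕ.+ suc d) j ∩ above x))
      count-∈ y∈ = ≡.subst₂ (λ a b → size (inside a j ∩ above x) ≡ suc (size (inside b j ∩ above x))) toℕ-y y+1≡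
        (ℕΣ.Σ-insert {p = inside (suc (toℕ y)) j ∩ above x} {inside (toℕ y) j ∩ above x} {y} (const 1)
          (≡.cong (_∧ above x y) (∉-inside-bottom y j)) (inside-cons-∈ (above x) y<j y∈))
      count-∉ : above x y ≡ false → size (inside (i ℕ.+ d) j ∩ above x) ≡ size (inside (i ℕ.+ suc d) j ∩ above x)
      count-∉ y∉ = ≡.subst₂ (λ a b → size (inside a j ∩ above x) ≡ size (inside b j ∩ above x)) toℕ-y y+1≡
        (size-cong {p = inside (toℕ y) j ∩ above x} {inside (suc (toℕ y)) j ∩ above x}
            (inside-cons-∉ (above x) y<j y∉))

    rankLoop-runs : ∀ {σ} → Context i j 0 σ → Ranked i j σ → nats σ 4 [] ≡ j → nats σ 7 (j ∷ []) ≡ 0 →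
                    Runs rankLoop σ 25 n (Ranking 0)
    rankLoop-runs {σ} ctx ranked m≡ rank≡0 = run-unit (ℕ.≤-reflexive (ℕ.*-identityʳ n))
      (run-while Ranking 1≤n ℕ.≤-refl
        (λ { ((_ , i≡ , _) , m≡ , _) → stop-≤ (≡.cong (ℕ._+ 1) i≡) (≡.trans m≡ (ℕ.+-identityʳ i)) (ℕ.m<m+n i ℕ.z<s) })
        (λ { d _ _ ((_ , i≡ , _) , m≡ , _) → continue-≤ (≡.cong (ℕ._+ 1) i≡) m≡ (ℕ.+-monoʳ-≤ i (ℕ.s≤s ℕ.z≤n)) })
        rankBody-runs (j ℕ.∸ i) (ℕ.≤-trans (ℕ.m∸n≤m j i) (ℕ.<⇒≤ j<n))
        (ctx , ≡.trans m≡ (≡.sym i+≡j) , ℕ.≤-reflexive i+≡j ,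
         (λ k k∈ → ranked k (≡.subst (λ m → k ∈ inside i m) i+≡j k∈)) ,
         (λ k k∈ → contradiction (≡.trans (≡.sym k∈)
             (≡.trans (≡.cong (λ m → inside m j k) i+≡j) (inside-empty j k))) λ ()) ,
         ≡.trans rank≡0 (≡.sym (≡.trans (≡.cong (λ m → size (inside m j ∩ above x)) i+≡j)
           (ℕΣ.Σ-empty {p = inside j j ∩ above x} (const 1) λ k → ≡.cong (_∧ above x k) (inside-empty j k))))))
      where
      i+≡j : i ℕ.+ (j ℕ.∸ i) ≡ j
      i+≡j = ℕ.m+[n∸m]≡n i≤x

    ranking⇒ranked : ∀ {σ} → Ranking 0 σ → Ranked i (suc j) σ
    ranking⇒ranked (ctx , _ , _ , _ , new , rank-j) k k∈ with k Fin.≟ x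
    ... | yes ≡.refl = ≡.trans rank-j (≡.trans (≡.cong (λ m → size (inside m j ∩ above x)) (ℕ.+-identityʳ i))
            (≡.sym (rank-snoc-∉ {x} (≡.cong not (dec-true (w x ≤? w x) ≤-refl)))))
    ... | no k≢x = new k (≡.subst (λ m → k ∈ inside m j) (≡.sym (ℕ.+-identityʳ i))
            (∈-inside (inside⇒≤ {i = i} {suc j} k∈)
                (ℕ.≤∧≢⇒< (ℕ.≤-pred (inside⇒< {i = i} {suc j} k∈)) (k≢x ∘ Fin.toℕ-injective))))

  open RankLoop

  module _ {i : ℕ} where

    Intervals : ℕ → Store → Set
    Intervals d σ = ∃[ j ] (j ℕ.+ d ≡ n × i ℕ.≤ j × Context i j 0 σ × Ranked i j σ)

    interval-region : ∀ j i₁ j₁ h₁ → Region i (suc j) H i₁ j₁ h₁ → Region i j 0 i₁ j₁ h₁ ⊎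
        (i₁ ≡ i × j₁ ≡ suc j × h₁ ≡ H)
    interval-region j i₁ j₁ h₁ (i<j , j≤ , h≤ , inj₁ i<) = inj₁ (i<j , j≤ , h≤ , inj₁ i<)
    interval-region j i₁ j₁ h₁ (i<j , j≤ , h≤ , inj₂ (i≡ , inj₂ (j≡ , H≤h))) = inj₂ (i≡ , j≡ , ℕ.≤-antisym h≤ H≤h)
    interval-region j i₁ j₁ h₁ (i<j , j≤ , h≤ , inj₂ (i≡ , inj₁ j<)) with ℕ.m≤n⇒m<n∨m≡n (ℕ.≤-pred j<)
    ... | inj₁ j₁<j = inj₁ (i<j , j≤ , h≤ , inj₂ (i≡ , inj₁ j₁<j))
    ... | inj₂ j₁≡j = inj₁ (i<j , j≤ , h≤ , inj₂ (i≡ , inj₂ (j₁≡j , ℕ.z≤n)))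

    intervalBody-runs : ∀ d σ → suc d ℕ.≤ n → Intervals (suc d) σ → Runs intervalBody σ 150 (H ℕ.* n) (Intervals d)
    intervalBody-runs d σ d<n (j , j+d≡n , i≤j , ctx@(_ , _ , j≡ , _) , ranked) =
      run-assign⨾ 1≤Hn $ run-assign⨾ 1≤Hn $
      run-seq (run-unit n≤Hn (rankLoop-runs x i≤x (at-x {σ} ctx) ranked₀ j≡x
        (proj₁ (update-key 7 x x 0 (nats σ) j≡x) ≡.refl)))
        λ { σ₁ inv@((ready@(_ , H≡ , big≤) , i≡ , j≡ , filled) , _) →
      run-assign⨾ 1≤Hn $ run-assign⨾ 1≤Hn $ run-assign⨾ 1≤Hn $
      run-cons (λ { σ₂ (ctx , ranked , _) → suc j , ≡.trans (≡.sym (ℕ.+-suc j d)) j+d≡n , ℕ.m≤n⇒m≤1+n i≤j , ctx , ranked })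
        (cellLoop-runs (ℕ.s≤s i≤j) j<n
          (ready , i≡ , 1+j≡ j≡ ,
            fill {σ = write nat 2 [] (nats σ₁ 2 [] ℕ.+ 1) σ₁} (from-x {σ₁} filled) i≡ (1+j≡ j≡) H≡
              (cell-top {i} {suc j} big≤) (interval-region j))
          (≡.subst (λ j → Ranked i (suc j) σ₁) toℕ-x (ranking⇒ranked x i≤x {σ₁} inv))
          H≡) }
      where
      j<n : j ℕ.< n
      j<n = ℕ.≤-trans (ℕ.s≤s (ℕ.m≤m+n j d)) (ℕ.≤-reflexive (≡.trans (≡.sym (ℕ.+-suc j d)) j+d≡n))
      x = key j<n
      toℕ-x : toℕ x ≡ j
      toℕ-x = Fin.toℕ-fromℕ< j<n
      i≤x : i ℕ.≤ toℕ x
      i≤x = ℕ.≤-trans i≤j (ℕ.≤-reflexive (≡.sym toℕ-x))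
      j≡x : nats σ 2 [] ≡ toℕ x
      j≡x = ≡.trans j≡ (≡.sym toℕ-x)
      at-x : ∀ {σ} → Context i j 0 σ → Context i (toℕ x) 0 σ
      at-x {σ} = ≡.subst (λ j → Context i j 0 σ) (≡.sym toℕ-x)
      from-x : ∀ {σ} → Filled (Region i (toℕ x) 0) σ → Filled (Region i j 0) σ
      from-x {σ} = ≡.subst (λ j → Filled (Region i j 0) σ) toℕ-x
      1+j≡ : ∀ {m} → m ≡ toℕ x → m ℕ.+ 1 ≡ suc j
      1+j≡ m≡ = ≡.trans (ℕ.+-comm _ 1) (≡.cong suc (≡.trans m≡ toℕ-x))
      ranked₀ : Ranked i (toℕ x) (write nat 4 [] (nats σ 2 []) (write nat 7 (nats σ 2 [] ∷ []) 0 σ))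
      ranked₀ k k∈ = ≡.trans (proj₂ (update-key 7 x k 0 (nats σ) j≡x) λ { ≡.refl → ℕ.<-irrefl ≡.refl (inside⇒< {i = i} {toℕ x} k∈) })
        (≡.subst (λ j → Ranked i j σ) (≡.sym toℕ-x) ranked k k∈)

    intervalLoop-runs : ∀ {σ} → i ℕ.≤ n → Context i i 0 σ → Runs intervalLoop σ 160 (n ℕ.* (H ℕ.* n)) (Intervals 0)
    intervalLoop-runs i≤n ctx = run-while Intervals 1≤n 1≤Hn
      (λ { (j , j≡n , _ , (((n≡ , _) , _) , _ , j≡ , _) , _) → stop-≤ (≡.cong (ℕ._+ 1) j≡) n≡
             (ℕ.≤-reflexive (≡.trans (≡.cong suc (≡.trans (≡.sym j≡n) (ℕ.+-identityʳ j))) (ℕ.+-comm 1 j))) })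
      (λ { d _ _ (j , j+d≡n , _ , (((n≡ , _) , _) , _ , j≡ , _) , _) → continue-≤ (≡.cong (ℕ._+ 1) j≡) n≡
             (ℕ.≤-trans (ℕ.+-monoʳ-≤ j (ℕ.s≤s ℕ.z≤n)) (ℕ.≤-reflexive j+d≡n)) })
      intervalBody-runs (n ℕ.∸ i) (ℕ.m∸n≤m n i)
      (i , ℕ.m+[n∸m]≡n i≤n , ℕ.≤-refl , ctx ,
        λ k k∈ → contradiction (≡.trans (≡.sym k∈) (inside-empty i k)) λ ())

  RowRegion : ℕ → ℕ → ℕ → ℕ → Set
  RowRegion i i₁ j₁ h₁ = i₁ ℕ.< j₁ × j₁ ℕ.≤ n × h₁ ℕ.≤ H × i ℕ.≤ i₁

  Rowing : ℕ → Store → Set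
  Rowing d σ = Ready H σ × nats σ 1 [] ≡ d × Filled (RowRegion d) σ

  rowBody-runs : ∀ d σ → suc d ℕ.≤ n → Rowing (suc d) σ → Runs rowBody σ 166 (n ℕ.* (H ℕ.* n)) (Rowing d)
  rowBody-runs d σ d<n (ready , i≡ , filled) =
    run-assign⨾ 1≤U $ run-assign⨾ 1≤U $
    run-cons (λ { σ₁ (j , j≡n , _ , (ready , i≡ , _ , filled) , _) → ready , i≡ , λ i₁ j₁ h₁ r → filled i₁ j₁ h₁ (widen j j≡n i₁ j₁ h₁ r) })
      (intervalLoop-runs {d} (ℕ.<⇒≤ d<n) (ready , i≡′ , i≡′ , λ i₁ j₁ h₁ r → filled i₁ j₁ h₁ (narrow i₁ j₁ h₁ r)))
    where
    1≤U : 1 ℕ.≤ n ℕ.* (H ℕ.* n)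
    1≤U = ℕ.*-mono-≤ 1≤n 1≤Hn
    i≡′ : nats σ 1 [] ℕ.∸ 1 ≡ d
    i≡′ = ≡.cong (ℕ._∸ 1) i≡
    narrow : ∀ i₁ j₁ h₁ → Region d d 0 i₁ j₁ h₁ → RowRegion (suc d) i₁ j₁ h₁
    narrow i₁ j₁ h₁ (i<j , j≤ , h≤ , inj₁ d<i) = i<j , j≤ , h≤ , d<i
    narrow i₁ j₁ h₁ (i<j , j≤ , h≤ , inj₂ (≡.refl , inj₁ j<d)) = contradiction j<d (ℕ.<-asym i<j)
    narrow i₁ j₁ h₁ (i<j , j≤ , h≤ , inj₂ (≡.refl , inj₂ (≡.refl , _))) = contradiction i<j (ℕ.<-irrefl ≡.refl)
    widen : ∀ j → j ℕ.+ 0 ≡ n → ∀ i₁ j₁ h₁ → RowRegion d i₁ j₁ h₁ → Region d j 0 i₁ j₁ h₁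
    widen j j≡n i₁ j₁ h₁ (i<j , j≤ , h≤ , d≤i) with ℕ.m≤n⇒m<n∨m≡n d≤i
    ... | inj₁ d<i = i<j , j≤ , h≤ , inj₁ d<i
    ... | inj₂ d≡i with ℕ.m≤n⇒m<n∨m≡n (ℕ.≤-trans j≤ (ℕ.≤-reflexive (≡.trans (≡.sym j≡n) (ℕ.+-identityʳ j))))
    ...   | inj₁ j₁<j = i<j , j≤ , h≤ , inj₂ (≡.sym d≡i , inj₁ j₁<j)
    ...   | inj₂ j₁≡j = i<j , j≤ , h≤ , inj₂ (≡.sym d≡i , inj₂ (j₁≡j , ℕ.z≤n))

  rowLoop-runs : ∀ {σ} → Ready H σ → nats σ 1 [] ≡ n → Runs rowLoop σ 172 (n ℕ.* (n ℕ.* (H ℕ.* n))) (Rowing 0)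
  rowLoop-runs ready i≡ = run-while Rowing 1≤n (ℕ.*-mono-≤ 1≤n 1≤Hn)
    (λ { (_ , i≡ , _) → ≡.cong (1 ℕ.≤ᵇ_) i≡ }) (λ { d _ _ (_ , i≡ , _) → ≡.cong (1 ℕ.≤ᵇ_) i≡ })
    rowBody-runs n ℕ.≤-refl
    (ready , i≡ , λ i₁ j₁ h₁ (i<j , j≤n , _ , n≤i) → contradiction (ℕ.≤-<-trans n≤i i<j) (ℕ.≤⇒≯ j≤n))

  root-cell : ∀ {σ} → Rowing 0 σ → Cell 0 n 0 (weights σ 1 (0 ∷ nats σ 0 [] ∷ 0 ∷ []))
  root-cell {σ} (((n≡ , _) , _) , _ , filled) = cell-at {σ = σ} filled ≡.refl n≡ ≡.refl
      (1≤n , ℕ.≤-refl , ℕ.z≤n , ℕ.z≤n)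

-- Total time and assembly

add-times : ∀ a b {t u n U} → n ℕ.≤ U → t ℕ.≤ a ℕ.* n → u ℕ.≤ b ℕ.* U → t ℕ.+ u ℕ.≤ (a ℕ.+ b) ℕ.* U
add-times a b {U = U} n≤U t≤ u≤ = ℕ.≤-trans (ℕ.+-mono-≤ (ℕ.≤-trans t≤ (ℕ.*-monoʳ-≤ a n≤U)) u≤)
  (ℕ.≤-reflexive (≡.sym (ℕ.*-distribʳ-+ U a b)))

cubic-time : ∀ C a b c {n H L t} → C ≡ a ℕ.* (b ℕ.+ c) → 1 ℕ.≤ L → t ℕ.≤ a ℕ.* (n ℕ.* (n ℕ.* (H ℕ.* n))) → H ℕ.≤ b
    ℕ.+ c ℕ.* L →
             t ℕ.≤ C ℕ.* (n ℕ.^ 3 ℕ.* L)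
cubic-time C a b c {n} {H} {L} {t} C≡ 1≤L t≤ H≤ = begin
  t                                            ≤⟨ t≤ ⟩
  a ℕ.* (n ℕ.* (n ℕ.* (H ℕ.* n)))              ≡⟨ ≡.cong (a ℕ.*_) reorder ⟩
  a ℕ.* (n ℕ.^ 3 ℕ.* H)                        ≤⟨ ℕ.*-monoʳ-≤ a (ℕ.*-monoʳ-≤ (n ℕ.^ 3) H≤[b+c]L) ⟩
  a ℕ.* (n ℕ.^ 3 ℕ.* ((b ℕ.+ c) ℕ.* L))        ≡⟨ ≡.cong (a ℕ.*_) (swap (n ℕ.^ 3) (b ℕ.+ c) L) ⟩
  a ℕ.* ((b ℕ.+ c) ℕ.* (n ℕ.^ 3 ℕ.* L))        ≡⟨ ℕ.*-assoc a (b ℕ.+ c) (n ℕ.^ 3 ℕ.* L) ⟨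
  a ℕ.* (b ℕ.+ c) ℕ.* (n ℕ.^ 3 ℕ.* L)          ≡⟨ ≡.cong (ℕ._* (n ℕ.^ 3 ℕ.* L)) C≡ ⟨
  C ℕ.* (n ℕ.^ 3 ℕ.* L)                        ∎
  where
  open ℕ.≤-Reasoning
  swap : ∀ a b c → a ℕ.* (b ℕ.* c) ≡ b ℕ.* (a ℕ.* c)
  swap a b c = ≡.trans (≡.sym (ℕ.*-assoc a b c)) (≡.trans (≡.cong (ℕ._* c) (ℕ.*-comm a b)) (ℕ.*-assoc b a c))
  reorder : n ℕ.* (n ℕ.* (H ℕ.* n)) ≡ n ℕ.^ 3 ℕ.* H
  reorder = ≡.trans (≡.cong (λ m → n ℕ.* (n ℕ.* m))
      (≡.trans (ℕ.*-comm H n) (≡.cong (ℕ._* H) (≡.sym (ℕ.*-identityʳ n)))))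
    (≡.trans (≡.cong (n ℕ.*_) (≡.sym (ℕ.*-assoc n (n ℕ.* 1) H))) (≡.sym (ℕ.*-assoc n (n ℕ.* (n ℕ.* 1)) H)))
  H≤[b+c]L : H ℕ.≤ (b ℕ.+ c) ℕ.* L
  H≤[b+c]L = ℕ.≤-trans H≤ (ℕ.≤-trans
    (ℕ.+-monoˡ-≤ (c ℕ.* L) (ℕ.≤-trans (ℕ.≤-reflexive (≡.sym (ℕ.*-identityʳ b))) (ℕ.*-monoʳ-≤ b 1≤L)))
    (ℕ.≤-reflexive (≡.sym (ℕ.*-distribʳ-+ L b c))))

abstract
  -- 48 comes from the setup and 179 from the table with the final output; 27 + 24 bounds `H` in
  -- multiples of `L`, since 27 + 24L ≤ 51L for L ≥ 1.
  timeFactor : ℕ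
  timeFactor = (48 ℕ.+ 179) ℕ.* (27 ℕ.+ 24)

  timeFactor≡ : timeFactor ≡ (48 ℕ.+ 179) ℕ.* (27 ℕ.+ 24)
  timeFactor≡ = ≡.refl

module Main (K : OrderedRing) {n} (2≤n : 2 ℕ.≤ n) (w : Fin n → OrderedRing.Carrier K)
  (w-injective : Injective _≡_ (OrderedRing._≈_ K) w)
  (1≤w : ∀ k → OrderedRing._≤_ K (OrderedRing.1# K) (w k)) where

  1≤n : 1 ℕ.≤ n
  1≤n = ℕ.≤-trans (ℕ.s≤s ℕ.z≤n) 2≤n

  k₀ : Fin n
  k₀ = fromℕ< 1≤n

  open Order K
  open Semantics K
  open Optimality K using (IsOptimal) renaming (cost to treeCost)
  open Hoare K
  open OptimalTrees K w 1≤w k₀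
  open Structure K w 1≤w k₀
  open Budgets K w 1≤w k₀
  open Setup K w 1≤w k₀ 1≤n
  open States K w 1≤w k₀ w-injective
  open Cells K w 1≤w k₀ w-injective

  tree : Tree n
  tree = proj₁ (best-tree all)

  tree-minimal : Minimal all tree
  tree-minimal = proj₂ (best-tree all)

  cost≈ : ∀ t → cost all t ≈ treeCost w t
  cost≈ t = Σ-sum all (λ k → depth t k · w k)

  tree-optimal : IsOptimal w tree
  tree-optimal = record
    { valid = record
      { bijective = ∼bag⇒↭ (unique∧set⇒bag unique (Unique.allFin⁺ n) (mk⇔ (λ _ → ∈-allFin _) (λ _ → complete ≡.refl)))
      ; correct   = λ q → Minimal.correct tree-minimal ≡.refl
      }
    ; minimal = λ t valid → ≤-respˡ (cost≈ tree) (≤-respʳ (cost≈ t)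
        (Minimal.minimal tree-minimal t λ {k} _ → Is2WCST.correct valid k))
    }
    where open Proper (Minimal.proper tree-minimal (k₀ , ≡.refl))

  initial-input : Input (initial w)
  initial-input = ≡.refl , read-key
    where
    read-key : ∀ k → weights (initial w) 0 (toℕ k ∷ []) ≡ w k
    read-key k with toℕ k ℕ.<? n
    ... | yes k<n = ≡.cong w (Fin.fromℕ<-toℕ k k<n)
    ... | no k≮n  = contradiction (Fin.toℕ<n k) k≮n

  state≐all : state 0 n 0 ≐ all
  state≐all k = ∧-intro (∈-inside ℕ.z≤n (Fin.toℕ<n k)) (≤⇒low {inside 0 n} {0} {k} ℕ.z≤n)

  output-correct : ∀ {H v} → Budget all H → Table.Cell H 0 n 0 v → v ≈ treeCost w tree
  output-correct budget (o≤v , v≤o) = trans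
    (antisym (v≤o (budget-⊆ {state 0 n 0} {all} (λ _ → ≡.refl) ℕ.≤-refl budget)) o≤v)
    (trans (o-cong state≐all) (cost≈ tree))

  Bound : ℕ → ℕ → Set
  Bound H t = t ℕ.≤ (48 ℕ.+ 179) ℕ.* (n ℕ.* (n ℕ.* (H ℕ.* n))) × (∀ L → W⊤ ≤ pow₂ L → H ℕ.≤ 27 ℕ.+ 24 ℕ.* L)

  program-from : Runs setup (initial w) 48 n Prepared →
                 ∃[ H ] ∃[ t ] (Bound H t × Computes program w (treeCost w tree) t)
  program-from (runs σ₁ t setup⇓ t≤ (H , ready , budget , 1≤H , H≤)) =
    H , t ℕ.+ u , (add-times 48 179 n≤U t≤ u≤ , H≤) , σ₂ , ⇓seq setup⇓ rest⇓ , out≈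
    where
    open Rows K w 1≤w k₀ 1≤n w-injective H 1≤H
    U = n ℕ.* (n ℕ.* (H ℕ.* n))
    1≤U : 1 ℕ.≤ U
    1≤U = ℕ.*-mono-≤ 1≤n (ℕ.*-mono-≤ 1≤n 1≤Hn)
    n≤U : n ℕ.≤ U
    n≤U = ℕ.≤-trans (ℕ.≤-reflexive (≡.sym (ℕ.*-identityʳ n))) (ℕ.*-monoʳ-≤ n (ℕ.*-mono-≤ 1≤n 1≤Hn))
    rest-runs : Runs (1 ⟦ [] ⟧ ≔ n′ ⨾ rowLoop ⨾ 0 ⟦ [] ⟧ ≔ V (lit 0) n′ (lit 0)) σ₁ 179 U
                     (λ σ → output σ ≈ treeCost w tree)
    rest-runs = run-assign⨾ 1≤U $ run-seq (rowLoop-runs ready (proj₁ (proj₁ ready)))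
      λ σ inv → run-assign 1≤U (output-correct budget (root-cell {σ} inv))
    open Runs rest-runs renaming (final to σ₂; time to u; exec to rest⇓; time≤ to u≤; post to out≈)

  abstract
    program-runs : ∃[ H ] ∃[ t ] (Bound H t × Computes program w (treeCost w tree) t)
    program-runs = program-from (setup-runs (initial w) initial-input ≡.refl ≡.refl)

  module _ {R : Carrier} (1≤R : 1# ≤ R) (w≤R : ∀ k → w k ≤ R) where

    W⊤≤ : W⊤ ≤ n · R
    W⊤≤ = ≤-respˡ (sym (Σ-sum all w)) (≤-respʳ (sum-replicate n) (sum-mono w≤R))

    -- This is where two keys are required: nR ≥ 2 rules out L = 0, so the additive constant 27 can
    -- be absorbed into the logarithm.
    1≤L : ∀ L → n · R ≤ pow₂ L → 1 ℕ.≤ L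
    1≤L zero    nR≤ = contradiction (·1-cancel-≤ n 1 (≤-trans (·-mono-≤ n 1≤R) nR≤)) (ℕ.<⇒≱ 2≤n)
    1≤L (suc L) _   = ℕ.s≤s ℕ.z≤n

    time-bound : ∀ {H t} → Bound H t → ∀ L → n · R ≤ pow₂ L → t ℕ.≤ timeFactor ℕ.* (n ℕ.^ 3 ℕ.* L)
    time-bound (t≤ , H≤) L nR≤ = cubic-time timeFactor (48 ℕ.+ 179) 27 24 {n} timeFactor≡ (1≤L L nR≤) t≤
        (H≤ L (≤-trans W⊤≤ nR≤))

mainTheorem12 : ∃[ P ] ∃[ C ]
    ((K : OrderedRing) → let open OrderedRing K in let open Semantics K in let open Optimality K in
    (n : ℕ) → 2 ℕ.≤ n →
    (w : Fin n → Carrier) → Injective _≡_ _≈_ w →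
    (R : Carrier) → 1# ≤ R → (∀ k → 1# ≤ w k × w k ≤ R) →
    ∃[ T ] ∃[ t ]
    (IsOptimal w T × Computes P w (cost w T) t ×
    (∀ L → ⌈log₂ n · R ⌉≤ L → t ℕ.≤ C ℕ.* (n ℕ.^ 3 ℕ.* L))))
mainTheorem12 = program , timeFactor , λ K n 2≤n w w-injective R 1≤R w-bounds →
  let open Main K 2≤n w w-injective (proj₁ ∘ w-bounds)
      H , t , bound , computes = program-runs
  in tree , t , tree-optimal , computes , time-bound 1≤R (proj₂ ∘ w-bounds) {H} bound
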